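{- Let $n_3, n_6, n_8, n_{10}, n_{13}$ be the five graphs on vertex set $\{1,\dots,6\}$ with ten edges each whose edge sets are listed in the context. Let $n$ be a non-negative integer. (i) For each $G \in \{n_3, n_6, n_{10}\}$ and each $n \neq 16$: a $G$-design of order $n$ exists if and only if $n \equiv 0, 1, 5$ or $16 \pmod{20}$ and $n \neq 5$. (Nothing is asserted about $n = 16$.) (ii) An $n_8$-design of order $n$ exists if and only if $n \equiv 0, 1, 5$ or $16 \pmod{20}$ and $n \notin \{5, 16\}$. (iii) An $n_{13}$-design of order $n$ exists if and only if $n \equiv 0, 1, 5$ or $16 \pmod{20}$ and $n \notin \{5, 16, 20\}$.
   Context: All graphs are simple. A decomposition of a graph $K$ into a graph $G$ is a partition of the edge set of $K$ into edge sets of subgraphs of $K$ each isomorphic to $G$. A $G$-design of order $n$ is a decomposition of the complete graph $K_n$ into $G$ (for $n \in \{0,1\}$ the graph $K_n$ has no edges and the empty decomposition counts as a design). The graphs have vertex set $\{1,2,3,4,5,6\}$ and the following edge sets: - $n_3$: $\{5,3\},\{5,2\},\{5,1\},\{4,3\},\{4,2\},\{4,1\},\{6,1\},\{3,2\},\{3,1\},\{2,1\}$; - $n_6$: $\{6,2\},\{6,3\},\{6,1\},\{5,2\},\{5,3\},\{5,1\},\{4,2\},\{4,3\},\{4,1\},\{2,1\}$; - $n_8$: $\{6,4\},\{6,2\},\{6,1\},\{5,3\},\{5,2\},\{5,1\},\{4,2\},\{4,1\},\{3,2\},\{3,1\}$; - $n_{10}$: $\{4,3\},\{4,2\},\{4,5\},\{4,1\},\{6,1\},\{3,2\},\{3,5\},\{3,1\},\{2,5\},\{2,1\}$;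 - $n_{13}$: $\{6,4\},\{6,3\},\{6,1\},\{5,3\},\{5,2\},\{5,1\},\{4,2\},\{4,1\},\{3,1\},\{2,1\}$. -}

module Defs where

open import Level using (0ℓ)
open import Data.Nat using (ℕ)
open import Data.Fin using (Fin; zero; suc)
open import Data.Fin.Properties using (_≟_)
open import Data.Fin.Subset using (Subset; _∈_)
open import Data.List using (List; []; _∷_)
open import Data.List.Relation.Unary.All using (all?; lookup)
import Data.List.Membership.Propositional as List
open import Data.Product using (_×_; _,_; ∃; ∃₂; ∃!; proj₁; proj₂)
open import Data.Sum using (_⊎_; inj₁; inj₂; swap)
open import Function.Bundles using (_⇔_; _↔_; Inverse)
open import Relation.Binary using (Rel; Symmetric; Irreflexive)
open import Relation.Binary.PropositionalEquality using (_≡_; _≢_; refl; ≢-sym)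
open import Relation.Nullary.Decidable using (True; toWitness; ¬?)

record Graph (V : Set) : Set₁ where
  field
    Adj    : Rel V 0ℓ
    sym    : Symmetric Adj
    irrefl : Irreflexive _≡_ Adj

open Graph public using (Adj)

record _≅_ {V W : Set} (G : Graph V) (H : Graph W) : Set where
  field
    bijection : V ↔ W
    adj⇔adj   : ∀ x y → Adj G x y ⇔ Adj H (Inverse.to bijection x) (Inverse.to bijection y)

record Subgraph {n : ℕ} (K : Graph (Fin n)) : Set₁ where
  field
    vertices : Subset n
    Edge     : Rel (Fin n) 0ℓ
    sym      : Symmetric Edge
    edge⇒adj : ∀ {x y} → Edge x y → Adj K x y
    -- By symmetry this covers both endpoints.
    edge⇒∈   : ∀ {x y} → Edge x y → x ∈ vertices

  graph : Graph (∃ λ x → x ∈ vertices)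
  graph = record
    { Adj    = λ x y → Edge (proj₁ x) (proj₁ y)
    ; sym    = sym
    ; irrefl = λ { refl e → Graph.irrefl K refl (edge⇒adj e) }
    }

-- The edge set of K is partitioned by the edge sets of the blocks.  Each edge
-- lies in exactly one block, and every block has an edge, so the blocks are
-- automatically pairwise distinct.
record Decomposition {n : ℕ} {W : Set} (K : Graph (Fin n)) (G : Graph W) : Set₁ where
  field
    size     : ℕ
    block    : Fin size → Subgraph K
    iso      : ∀ i → Subgraph.graph (block i) ≅ G
    nonempty : ∀ i → ∃₂ λ x y → Subgraph.Edge (block i) x y
    covered  : ∀ x y → Adj K x y → ∃! _≡_ λ i → Subgraph.Edge (block i) x y

complete : (n : ℕ) → Graph (Fin n)
complete n = record
  { Adj    = _≢_
  ; sym    = ≢-sym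
  ; irrefl = λ x≡y x≢y → x≢y x≡y
  }

Design : {W : Set} → Graph W → ℕ → Set₁
Design G n = Decomposition (complete n) G

-- The implicit argument, solved by evaluation, rules out loops in the list.
fromEdges : {m : ℕ} (es : List (Fin m × Fin m)) →
            {True (all? (λ e → ¬? (proj₁ e ≟ proj₂ e)) es)} → Graph (Fin m)
fromEdges es {loopless} = record
  { Adj    = λ x y → ((x , y) List.∈ es) ⊎ ((y , x) List.∈ es)
  ; sym    = swap
  ; irrefl = λ { refl (inj₁ e) → lookup (toWitness loopless) e refl
               ; refl (inj₂ e) → lookup (toWitness loopless) e refl }
  }

pattern v1 = zero
pattern v2 = suc zero
pattern v3 = suc (suc zero)
pattern v4 = suc (suc (suc zero))
pattern v5 = suc (suc (suc (suc zero)))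
pattern v6 = suc (suc (suc (suc (suc zero))))

n₃ n₆ n₈ n₁₀ n₁₃ : Graph (Fin 6)
n₃ = fromEdges
  ( (v5 , v3) ∷ (v5 , v2) ∷ (v5 , v1) ∷ (v4 , v3) ∷ (v4 , v2)
  ∷ (v4 , v1) ∷ (v6 , v1) ∷ (v3 , v2) ∷ (v3 , v1) ∷ (v2 , v1) ∷ [])
n₆ = fromEdges
  ( (v6 , v2) ∷ (v6 , v3) ∷ (v6 , v1) ∷ (v5 , v2) ∷ (v5 , v3)
  ∷ (v5 , v1) ∷ (v4 , v2) ∷ (v4 , v3) ∷ (v4 , v1) ∷ (v2 , v1) ∷ [])
n₈ = fromEdges
  ( (v6 , v4) ∷ (v6 , v2) ∷ (v6 , v1) ∷ (v5 , v3) ∷ (v5 , v2)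
  ∷ (v5 , v1) ∷ (v4 , v2) ∷ (v4 , v1) ∷ (v3 , v2) ∷ (v3 , v1) ∷ [])
n₁₀ = fromEdges
  ( (v4 , v3) ∷ (v4 , v2) ∷ (v4 , v5) ∷ (v4 , v1) ∷ (v6 , v1)
  ∷ (v3 , v2) ∷ (v3 , v5) ∷ (v3 , v1) ∷ (v2 , v5) ∷ (v2 , v1) ∷ [])
n₁₃ = fromEdges
  ( (v6 , v4) ∷ (v6 , v3) ∷ (v6 , v1) ∷ (v5 , v3) ∷ (v5 , v2)
  ∷ (v5 , v1) ∷ (v4 , v2) ∷ (v4 , v1) ∷ (v3 , v1) ∷ (v2 , v1) ∷ [])

{-# OPTIONS --safe #-}

-- Necessity.  Counting edges gives n² ≡ n (mod 20).  In a design of order n every point has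
-- degree n − 1, a sum of degrees of its positions in the blocks.  For n₈ (degrees 4 and 3) and
-- n₁₃ (degrees 5 and 3) this determines how often a point is a hub, that is, a vertex of the
-- larger degree, and hubs are never adjacent: for n = 16, and for n₁₃ also n = 20, double
-- counting gives a contradiction.
--
-- Sufficiency.  If at most n(n−1)/20 copies cover all pairs of points, each pair is covered once,
-- so only coverage has to be verified.  Take m parts of 20 points, indexed by ℤ/m with m prime to
-- 6, and a small hole.  Points a, b of a part are assigned a step κ a b ∈ {1, 2, 3}, and for
-- 1 ≤ d ≤ (m−1)/2 a set of blocks on the parts x, x + d, x + 2d, x + 3d joins a in part X to b
-- in the parts X ± κ a b · d.  As κ a b is invertible modulo m, a and b in distinct parts are
-- joined for exactly one d.  For a few d the blocks also join some points of the hole to all parts.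
-- What remains are the pairs inside the parts, together with at most ten points of the hole, and
-- the pairs inside the hole; these are smaller designs.  The designs of small order come from
-- cyclic groups.

module Submission where

open import Defs

-- The count of edges leaves a gadget no room for an edge inside a part. Each of the five graphs
-- contains a triangle, and if its vertices lie in parts, their differences are s, t and s + t; so
-- the step cannot be the same for all points. Were all steps 1 or 2, then giving the parts x and x
-- + 3d one colour would 3-colour each block without hole points; `n₃`, `n₁₀` and `n₁₃` are not
-- 3-colourable, hence the step 3 and the condition that m be prime to 6. Other numbers of parts are
-- reached by merging up to five parts into the hole. Every point of the hole beyond those shared by
-- the parts must be joined to all parts by a gadget, and each d takes one gadget: with m = 5 or m =
-- 7 only two or three are available, and the orders for which this is too few have designs of their
-- own. A part is filled together with none, one or ten shared points of the hole. Ten are used for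
-- `n₁₃`, where a part cannot be filled alone, because there is no design of order 20.

-- Tight coverings by copies of a graph are decompositions

module FromCoverings where

  open import Data.Bool using (true)
  open import Data.Nat using (ℕ; zero; suc; _+_; _*_; _∸_; _≤_)
  import Data.List.Membership.Propositional as List
  import Data.Nat.Properties as ℕₚ
  open import Data.Fin using (Fin; zero; suc; punchIn; punchOut; combine; remQuot; join; splitAt)
  open import Data.Fin.Properties using (_≟_; any?; injective⇒≤; punchIn-punchOut; punchInᵢ≢i; punchIn-injective; remQuot-combine; combine-remQuot; splitAt-join)
  open import Data.Fin.Subset using (Subset; _∈_)
  open import Data.List using (List; _∷_; length; lookup)
  open import Data.List.Relation.Unary.Any as Any using (Any; here)
  open import Data.List.Relation.Unary.Any.Properties using (lookup-index)
  open import Data.Product using (_×_; _,_; ∃; ∃₂; proj₁; proj₂)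
  open import Data.Sum using (inj₁; inj₂; [_,_]′)
  open import Data.Vec as Vec using (Vec; tabulate; _[_]=_; here; there)
  open import Data.Vec.Properties using (lookup∘tabulate; []=⇒lookup; lookup⇒[]=)
  open import Function using (_∘_)
  open import Function.Bundles using (mk⇔; mk↔ₛ′)
  open import Function.Definitions using (Injective)
  open import Relation.Binary.PropositionalEquality
  open import Relation.Nullary using (Dec; yes; no; does; contradiction)
  open import Data.List.Relation.Unary.All using (all?)
  open import Relation.Nullary.Decidable using (True; ¬?; dec-true)

  does-sound : ∀ {P : Set} (P? : Dec P) → does P? ≡ true → P
  does-sound (yes p) _ = p

  -- A vertex of a subgraph is a point paired with a membership proof, so the inverse laws of an
  -- isomorphism compare such proofs.
  []=-irrelevant : ∀ {A : Set} {n} {xs : Vec A n} {i x} (p q : xs [ i ]= x) → p ≡ q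
  []=-irrelevant here here = refl
  []=-irrelevant (there p) (there q) = cong there ([]=-irrelevant p q)

  module _ {n : ℕ} (f : Fin 6 → Fin n) (f-inj : Injective _≡_ _≡_ f) where

    private
      hit? : (x : Fin n) → Dec (∃ λ p → f p ≡ x)
      hit? x = any? (λ p → f p ≟ x)

      image : Subset n
      image = tabulate (does ∘ hit?)

      ∈⇒hit : ∀ {x} → x ∈ image → ∃ λ p → f p ≡ x
      ∈⇒hit {x} m = does-sound (hit? x) (trans (sym (lookup∘tabulate (does ∘ hit?) x)) ([]=⇒lookup m))

      hit⇒∈ : ∀ {x} → (∃ λ p → f p ≡ x) → x ∈ image
      hit⇒∈ {x} h = lookup⇒[]= x image (trans (lookup∘tabulate (does ∘ hit?) x) (dec-true (hit? x) h))

    module _ (G : Graph (Fin 6)) where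

      copy : Subgraph (complete n)
      copy = record
        { vertices = image
        ; Edge     = λ x y → ∃₂ λ p q → Adj G p q × f p ≡ x × f q ≡ y
        ; sym      = λ { (p , q , e , a , b) → q , p , Graph.sym G e , b , a }
        ; edge⇒adj = λ { (p , q , e , refl , refl) fp≡fq → Graph.irrefl G (f-inj fp≡fq) e }
        ; edge⇒∈   = λ { (p , _ , _ , a , _) → hit⇒∈ (p , a) }
        }

      copy-≅ : Subgraph.graph copy ≅ G
      copy-≅ = record
        { bijection = mk↔ₛ′ to from to∘from from∘to
        ; adj⇔adj   = λ x y → mk⇔
            (λ { (p , q , e , a , b) → subst₂ (Adj G) (f-inj (trans a (sym (proj₂ (∈⇒hit (proj₂ x))))))
                                                      (f-inj (trans b (sym (proj₂ (∈⇒hit (proj₂ y)))))) e })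
            (λ e → to x , to y , e , proj₂ (∈⇒hit (proj₂ x)) , proj₂ (∈⇒hit (proj₂ y)))
        }
        where
        to : (∃ λ x → x ∈ image) → Fin 6
        to (x , m) = proj₁ (∈⇒hit m)
        from : Fin 6 → ∃ λ x → x ∈ image
        from p = f p , hit⇒∈ (p , refl)
        to∘from : ∀ p → to (from p) ≡ p
        to∘from p = f-inj (proj₂ (∈⇒hit (hit⇒∈ (p , refl))))
        from∘to : ∀ v → from (to v) ≡ v
        from∘to (x , m) with ∈⇒hit m
        ... | p , refl = cong (f p ,_) ([]=-irrelevant _ _)

  -- A surjection from at most n(n−1) arcs onto the n(n−1) ordered pairs is injective.
  module _ {n L : ℕ} (es : List (Fin 6 × Fin 6)) {loopless : True (all? (λ e → ¬? (proj₁ e ≟ proj₂ e)) es)} (f : Fin L → Fin 6 → Fin n)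
           (f-inj : ∀ i → Injective _≡_ _≡_ (f i)) where

    private
      G = fromEdges es {loopless}
      E = length es
      Slot = Fin (L * (E + E))

      -- The edge list occurs twice, the second time with the ends exchanged: slots number the arcs
      -- of all blocks, to be compared with ordered pairs of points.
      ends : Fin (E + E) → Fin 6 × Fin 6
      ends s = [ lookup es , (λ k → proj₂ (lookup es k) , proj₁ (lookup es k)) ]′ (splitAt E s)

      slot : ∀ {p q} → Adj G p q → ∃ λ s → ends s ≡ (p , q)
      slot (inj₁ e) = join E E (inj₁ (Any.index e)) ,
        trans (cong [ _ , _ ]′ (splitAt-join E E (inj₁ (Any.index e)))) (sym (lookup-index e))
      slot (inj₂ e) = join E E (inj₂ (Any.index e)) ,
        trans (cong [ _ , _ ]′ (splitAt-join E E (inj₂ (Any.index e))))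
              (cong (λ z → proj₂ z , proj₁ z) (sym (lookup-index e)))

      arcAt : Fin L × Fin (E + E) → Fin n × Fin n
      arcAt (i , t) = f i (proj₁ (ends t)) , f i (proj₂ (ends t))

      arcOf : Slot → Fin n × Fin n
      arcOf s = arcAt (remQuot {L} (E + E) s)

      Edge : Fin L → Fin n → Fin n → Set
      Edge i x y = ∃₂ λ p q → Adj G p q × f i p ≡ x × f i q ≡ y

      toSlot : ∀ {i x y} → Edge i x y → Slot
      toSlot {i} (p , q , e , _) = combine i (proj₁ (slot e))

      toSlot-arc : ∀ {i x y} (e : Edge i x y) → arcOf (toSlot e) ≡ (x , y)
      toSlot-arc {i} (p , q , e , refl , refl) = trans (cong arcAt (remQuot-combine i (proj₁ (slot e))))
        (cong (λ z → f i (proj₁ z) , f i (proj₂ z)) (proj₂ (slot e)))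

    module _ (cov : ∀ x y → x ≢ y → ∃ λ i → Edge i x y) (few : L * (E + E) ≤ n * (n ∸ 1)) where

      -- Pigeonhole: choose a slot for each of the n (n ∸ 1) ordered pairs. An arc in two blocks
      -- would occupy a further slot, more than `few` allows.
      covering-unique : ∀ {x y i j} → x ≢ y → Edge i x y → Edge j x y → i ≡ j
      covering-unique = go n refl
        where
        -- `n` is a module parameter; it is split through an equation, so that `n ∸ 1` reduces to
        -- `k` and pairs can be numbered by `punchIn`.
        go : ∀ k → n ≡ k → ∀ {x y i j} → x ≢ y → Edge i x y → Edge j x y → i ≡ j
        go zero refl {()}
        go (suc k) refl {x} {y} {i} {j} x≢y e e′ with i ≟ j
        ... | yes i≡j = i≡j
        ... | no i≢j = contradiction (ℕₚ.≤-trans (injective⇒≤ h-inj) few) ℕₚ.1+n≰n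
          where
          pairOf : Fin (suc k) × Fin k → Fin n × Fin n
          pairOf (a , b) = a , punchIn a b

          pairOf-inj : ∀ u v → pairOf u ≡ pairOf v → u ≡ v
          pairOf-inj (a , b) (a′ , b′) eq with cong proj₁ eq
          ... | refl = cong (a ,_) (punchIn-injective a b b′ (cong proj₂ eq))

          pair : Fin (suc k * k) → Fin n × Fin n
          pair c = pairOf (remQuot {suc k} k c)

          pair-inj : ∀ {c d} → pair c ≡ pair d → c ≡ d
          pair-inj {c} {d} eq = trans (sym (combine-remQuot {suc k} k c))
            (trans (cong (λ z → combine (proj₁ z) (proj₂ z)) (pairOf-inj _ _ eq)) (combine-remQuot {suc k} k d))

          edge : ∀ c → ∃ λ l → Edge l (proj₁ (pair c)) (proj₂ (pair c))
          edge c = cov _ _ (punchInᵢ≢i _ _ ∘ sym)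

          g : Fin (suc k * k) → Slot
          g c = toSlot (proj₂ (edge c))

          c₀ : Fin (suc k * k)
          c₀ = combine x (punchOut x≢y)

          pair-c₀ : pair c₀ ≡ (x , y)
          pair-c₀ = trans (cong pairOf (remQuot-combine x (punchOut x≢y))) (cong (x ,_) (punchIn-punchOut x≢y))

          -- The slot chosen for `c₀` lies in one block only. As `i` and `j` differ, one of the two
          -- given edges lies in another block and yields a second slot with the same pair.
          extra : ∃ λ s → arcOf s ≡ pair c₀ × s ≢ g c₀
          extra with proj₁ (edge c₀) ≟ i
          ... | no l≢i = toSlot e , trans (toSlot-arc e) (sym pair-c₀) ,
            λ eq → l≢i (sym (cong proj₁ (combine-split eq)))
            where combine-split : toSlot e ≡ g c₀ → (i , proj₁ (slot (proj₁ (proj₂ (proj₂ e))))) ≡ _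
                  combine-split eq = trans (sym (remQuot-combine i _)) (trans (cong (remQuot (E + E)) eq) (remQuot-combine _ _))
          ... | yes l≡i = toSlot e′ , trans (toSlot-arc e′) (sym pair-c₀) ,
            λ eq → i≢j (trans (sym l≡i) (sym (cong proj₁ (combine-split eq))))
            where combine-split : toSlot e′ ≡ g c₀ → (j , proj₁ (slot (proj₁ (proj₂ (proj₂ e′))))) ≡ _
                  combine-split eq = trans (sym (remQuot-combine j _)) (trans (cong (remQuot (E + E)) eq) (remQuot-combine _ _))

          h : Fin (suc (suc k * k)) → Slot
          h zero = proj₁ extra
          h (suc c) = g c

          extra≢g : ∀ c → proj₁ extra ≢ g c
          extra≢g c eq with pair-inj {c} {c₀} (trans (sym (toSlot-arc (proj₂ (edge c))))
                              (trans (cong arcOf (sym eq)) (proj₁ (proj₂ extra))))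
          ... | refl = proj₂ (proj₂ extra) eq

          h-inj : Injective _≡_ _≡_ h
          h-inj {zero} {zero} _ = refl
          h-inj {zero} {suc c} eq = contradiction eq (extra≢g c)
          h-inj {suc c} {zero} eq = contradiction (sym eq) (extra≢g c)
          h-inj {suc c} {suc d} eq = cong suc (pair-inj (trans (sym (toSlot-arc (proj₂ (edge c))))
                                       (trans (cong arcOf eq) (toSlot-arc (proj₂ (edge d))))))

      covering⇒Design : 1 ≤ E → Design G n
      covering⇒Design 1≤E = record
        { size     = L
        ; block    = λ i → copy (f i) (f-inj i) G
        ; iso      = λ i → copy-≅ (f i) (f-inj i) G
        ; nonempty = λ i → let p , q , e = someArc es 1≤E (λ x → x) in f i p , f i q , p , q , inj₁ e , refl , refl
        ; covered  = λ x y x≢y → let i , e = cov x y x≢y in i , e , covering-unique x≢y e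
        }
        where
        someArc : (ds : List (Fin 6 × Fin 6)) → 1 ≤ length ds → (∀ {x} → x List.∈ ds → x List.∈ es) → ∃₂ λ p q → (p , q) List.∈ es
        someArc ((p , q) ∷ _) _ inc = p , q , inc (here refl)

-- Double counting over the arcs of a design

module ArcSums where

  open import Data.Bool using (if_then_else_)
  open import Data.Nat using (ℕ; zero; suc; _+_; _*_; _≤_; z≤n)
  open import Data.Nat.Properties hiding (suc-injective)
  open import Data.Fin using (Fin; zero; suc)
  import Data.Fin.Properties as Fin
  open import Data.Product using (_×_; _,_; ∃; proj₁)
  open import Function using (_∘_)
  open import Function.Bundles using (Inverse; Equivalence)
  open import Relation.Binary.PropositionalEquality
  open import Relation.Nullary using (¬_; Dec; yes; no; does; contradiction)
  open import Algebra.Properties.Semiring.Sum +-*-semiring using (sum; sum-cong-≗; sum-replicate-zero; ∑-comm; ∑-distrib-+; *-distribˡ-sum; *-distribʳ-sum)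

  𝟙 : ∀ {P : Set} → Dec P → ℕ
  𝟙 d = if does d then 1 else 0

  𝟙-yes : ∀ {P : Set} (d : Dec P) → P → 𝟙 d ≡ 1
  𝟙-yes (yes _) _ = refl
  𝟙-yes (no ¬p) p = contradiction p ¬p

  𝟙-no : ∀ {P : Set} (d : Dec P) → ¬ P → 𝟙 d ≡ 0
  𝟙-no (yes p) ¬p = contradiction p ¬p
  𝟙-no (no _) _ = refl

  δ : ∀ {n} → Fin n → Fin n → ℕ
  δ x y = 𝟙 (x Fin.≟ y)

  sum-zero : ∀ {n} (g : Fin n → ℕ) → (∀ i → g i ≡ 0) → sum g ≡ 0
  sum-zero {n} g g≡0 = trans (sum-cong-≗ g≡0) (sum-replicate-zero n)

  sum-single : ∀ {n} (g : Fin n → ℕ) i → (∀ j → j ≢ i → g j ≡ 0) → sum g ≡ g i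
  sum-single g zero h = trans (cong (g zero +_) (sum-zero (g ∘ suc) (λ j → h (suc j) λ ()))) (+-identityʳ _)
  sum-single g (suc i) h = cong₂ _+_ (h zero λ ()) (sum-single (g ∘ suc) i (λ j j≢i → h (suc j) (j≢i ∘ Fin.suc-injective)))

  sum-const : ∀ n c → sum {n} (λ _ → c) ≡ n * c
  sum-const zero c = refl
  sum-const (suc n) c = cong (c +_) (sum-const n c)

  sum-mono : ∀ {n} (g h : Fin n → ℕ) → (∀ i → g i ≤ h i) → sum g ≤ sum h
  sum-mono {zero} g h _ = z≤n
  sum-mono {suc n} g h g≤h = +-mono-≤ (g≤h zero) (sum-mono (g ∘ suc) (h ∘ suc) (g≤h ∘ suc))

  sum-δ : ∀ {n} (x : Fin n) (g : Fin n → ℕ) → sum (λ y → δ x y * g y) ≡ g x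
  sum-δ x g = trans (sum-single _ x (λ y y≢x → cong (_* g y) (𝟙-no (x Fin.≟ y) (≢-sym y≢x))))
                    (trans (cong (_* g x) (𝟙-yes (x Fin.≟ x) refl)) (*-identityˡ _))

  term-≤-sum : ∀ {n} (g : Fin n → ℕ) i → g i ≤ sum g
  term-≤-sum g zero = m≤m+n (g zero) _
  term-≤-sum g (suc i) = ≤-trans (term-≤-sum (g ∘ suc) i) (m≤n+m _ (g zero))

  δ-comm : ∀ {n} (x y : Fin n) → δ x y ≡ δ y x
  δ-comm x y with x Fin.≟ y
  ... | yes refl = sym (𝟙-yes (x Fin.≟ x) refl)
  ... | no x≢y = sym (𝟙-no (y Fin.≟ x) (x≢y ∘ sym))

  module Necessary {n k : ℕ} (G : Graph (Fin k)) (adj? : ∀ p q → Dec (Adj G p q)) (D : Design G n) where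

    open Decomposition D public using (size)
    open Decomposition D hiding (size)

    at : Fin size → Fin k → Fin n
    at i p = proj₁ (Inverse.from (_≅_.bijection (iso i)) p)

    private
      at-to : ∀ i x → at i (Inverse.to (_≅_.bijection (iso i)) x) ≡ proj₁ x
      at-to i x = cong proj₁ (Inverse.strictlyInverseʳ (_≅_.bijection (iso i)) x)

      at⇒Adj : ∀ i p q → Subgraph.Edge (block i) (at i p) (at i q) → Adj G p q
      at⇒Adj i p q e = subst₂ (Adj G) (Inverse.strictlyInverseˡ b p) (Inverse.strictlyInverseˡ b q)
        (Equivalence.to (_≅_.adj⇔adj (iso i) (Inverse.from b p) (Inverse.from b q)) e)
        where b = _≅_.bijection (iso i)

      Adj⇒at : ∀ i p q → Adj G p q → Subgraph.Edge (block i) (at i p) (at i q)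
      Adj⇒at i p q e = Equivalence.from (_≅_.adj⇔adj (iso i) (Inverse.from b p) (Inverse.from b q))
        (subst₂ (Adj G) (sym (Inverse.strictlyInverseˡ b p)) (sym (Inverse.strictlyInverseˡ b q)) e)
        where b = _≅_.bijection (iso i)

      ∈-unique : ∀ {n} {V : Fin n → Set} {x y : ∃ V} → (∀ {z} (p q : V z) → p ≡ q) → proj₁ x ≡ proj₁ y → x ≡ y
      ∈-unique irr refl = cong (_ ,_) (irr _ _)

    open FromCoverings using ([]=-irrelevant)

    at-injective : ∀ i {p q} → at i p ≡ at i q → p ≡ q
    at-injective i {p} {q} eq = trans (sym (Inverse.strictlyInverseˡ b p))
      (trans (cong (Inverse.to b) (∈-unique []=-irrelevant eq)) (Inverse.strictlyInverseˡ b q))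
      where b = _≅_.bijection (iso i)

    adj : Fin k → Fin k → ℕ
    adj p q = 𝟙 (adj? p q)

    arcSum : (Fin n → Fin n → ℕ) → ℕ
    arcSum F = sum λ i → sum λ p → sum λ q → adj p q * F (at i p) (at i q)

    private
      arcSum-cong : ∀ {F F′} → (∀ x y → F x y ≡ F′ x y) → arcSum F ≡ arcSum F′
      arcSum-cong eq = sum-cong-≗ λ i → sum-cong-≗ λ p → sum-cong-≗ λ q → cong (adj p q *_) (eq (at i p) (at i q))

      arcSum-sum : ∀ {l} (H : Fin l → Fin n → Fin n → ℕ) → arcSum (λ u v → sum λ x → H x u v) ≡ sum λ x → arcSum (H x)
      arcSum-sum H = begin
        (sum λ i → sum λ p → sum λ q → adj p q * sum λ x → H x (at i p) (at i q))
          ≡⟨ (sum-cong-≗ λ i → sum-cong-≗ λ p → sum-cong-≗ λ q → *-distribˡ-sum (adj p q) λ x → H x (at i p) (at i q)) ⟩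
        (sum λ i → sum λ p → sum λ q → sum λ x → adj p q * H x (at i p) (at i q))
          ≡⟨ (sum-cong-≗ λ i → sum-cong-≗ λ p → ∑-comm λ q x → adj p q * H x (at i p) (at i q)) ⟩
        (sum λ i → sum λ p → sum λ x → sum λ q → adj p q * H x (at i p) (at i q))
          ≡⟨ (sum-cong-≗ λ i → ∑-comm λ p x → sum λ q → adj p q * H x (at i p) (at i q)) ⟩
        (sum λ i → sum λ x → sum λ p → sum λ q → adj p q * H x (at i p) (at i q))
          ≡⟨ (∑-comm λ i x → sum λ p → sum λ q → adj p q * H x (at i p) (at i q)) ⟩
        (sum λ x → arcSum (H x)) ∎
        where open ≡-Reasoning

      arcSum-* : ∀ c F → arcSum (λ u v → F u v * c) ≡ arcSum F * c
      arcSum-* c F = begin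
        (sum λ i → sum λ p → sum λ q → adj p q * (F (at i p) (at i q) * c))
          ≡⟨ (sum-cong-≗ λ i → sum-cong-≗ λ p → sum-cong-≗ λ q → sym (*-assoc (adj p q) (F (at i p) (at i q)) c)) ⟩
        (sum λ i → sum λ p → sum λ q → adj p q * F (at i p) (at i q) * c)
          ≡⟨ (sum-cong-≗ λ i → sum-cong-≗ λ p → sym (*-distribʳ-sum c λ q → adj p q * F (at i p) (at i q))) ⟩
        (sum λ i → sum λ p → (sum λ q → adj p q * F (at i p) (at i q)) * c)
          ≡⟨ (sum-cong-≗ λ i → sym (*-distribʳ-sum c λ p → sum λ q → adj p q * F (at i p) (at i q))) ⟩
        (sum λ i → (sum λ p → sum λ q → adj p q * F (at i p) (at i q)) * c)
          ≡⟨ sym (*-distribʳ-sum c λ i → sum λ p → sum λ q → adj p q * F (at i p) (at i q)) ⟩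
        arcSum F * c ∎
        where open ≡-Reasoning

      cell : Fin n → Fin n → Fin n → Fin n → ℕ
      cell x y u v = δ u x * δ v y

      blockSum : Fin size → Fin n → Fin n → ℕ
      blockSum i x y = sum λ p → sum λ q → adj p q * cell x y (at i p) (at i q)

      cell-zero : ∀ {x y} i p q → ¬ (Adj G p q × at i p ≡ x × at i q ≡ y) → adj p q * cell x y (at i p) (at i q) ≡ 0
      cell-zero {x} {y} i p q ¬e with adj? p q | at i p Fin.≟ x | at i q Fin.≟ y
      ... | no _ | _ | _ = refl
      ... | yes _ | no _ | _ = refl
      ... | yes _ | yes _ | no _ = refl
      ... | yes e | yes a | yes b = contradiction (e , a , b) ¬e

      blockSum-no : ∀ {x y} i → ¬ Subgraph.Edge (block i) x y → blockSum i x y ≡ 0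
      blockSum-no {x} {y} i ¬e = sum-zero _ λ p → sum-zero _ λ q → cell-zero i p q
        λ { (e , refl , refl) → ¬e (Adj⇒at i p q e) }

      -- `at i` is injective, so exactly one position carries `x` and one carries `y`: a single term
      -- of the double sum survives.
      blockSum-yes : ∀ {x y} i → Subgraph.Edge (block i) x y → blockSum i x y ≡ 1
      blockSum-yes {x} {y} i e = trans
        (sum-single _ p λ p′ p′≢p → sum-zero _ λ q′ → cell-zero i p′ q′ λ { (_ , a , _) → p′≢p (at-injective i (trans a (sym p↦x))) })
        (trans (sum-single _ q λ q′ q′≢q → cell-zero i p q′ λ { (_ , _ , a) → q′≢q (at-injective i (trans a (sym q↦y))) })
               (cong₂ _*_ (𝟙-yes (adj? p q) (at⇒Adj i p q (subst₂ (Subgraph.Edge (block i)) (sym p↦x) (sym q↦y) e)))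
                          (cong₂ _*_ (𝟙-yes (at i p Fin.≟ x) p↦x) (𝟙-yes (at i q Fin.≟ y) q↦y))))
        where
        open Inverse (_≅_.bijection (iso i)) using (to)
        p = to (x , Subgraph.edge⇒∈ (block i) e)
        q = to (y , Subgraph.edge⇒∈ (block i) (Subgraph.sym (block i) e))
        p↦x : at i p ≡ x
        p↦x = at-to i _
        q↦y : at i q ≡ y
        q↦y = at-to i _

      -- This is the partition property as a numerical identity: multiplied by `F x y` and summed,
      -- it splits any double sum into its diagonal and the blocks.
      cells : ∀ x y → δ x y + sum (λ i → blockSum i x y) ≡ 1
      cells x y with x Fin.≟ y
      ... | yes refl = cong suc (sum-zero _ λ i → blockSum-no i λ e → Subgraph.edge⇒adj (block i) e refl)
      ... | no x≢y with covered x y x≢y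
      ...   | i , e , uniq = trans (sum-single _ i λ j j≢i → blockSum-no j λ e′ → j≢i (sym (uniq e′))) (blockSum-yes i e)

    -- Every ordered pair of distinct points is exactly one arc of one block.
    arc-sum : (F : Fin n → Fin n → ℕ) → sum (λ x → sum (F x)) ≡ sum (λ x → F x x) + arcSum F
    arc-sum F = begin
      sum (λ x → sum (F x))
        ≡⟨ (sum-cong-≗ λ x → sum-cong-≗ λ y → trans (sym (*-identityˡ _)) (trans (cong (_* F x y) (sym (cells x y)))
             (*-distribʳ-+ (F x y) (δ x y) (sum λ i → blockSum i x y)))) ⟩
      sum (λ x → sum λ y → δ x y * F x y + sum (λ i → blockSum i x y) * F x y)
        ≡⟨ (sum-cong-≗ λ x → trans (∑-distrib-+ (λ y → δ x y * F x y) λ y → sum (λ i → blockSum i x y) * F x y)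
             (cong (_+ sum λ y → sum (λ i → blockSum i x y) * F x y) (sum-δ x (F x)))) ⟩
      sum (λ x → F x x + sum λ y → sum (λ i → blockSum i x y) * F x y)
        ≡⟨ ∑-distrib-+ (λ x → F x x) (λ x → sum λ y → sum (λ i → blockSum i x y) * F x y) ⟩
      sum (λ x → F x x) + sum (λ x → sum λ y → arcSum (cell x y) * F x y)
        ≡⟨ cong (sum (λ x → F x x) +_) (sym step) ⟩
      sum (λ x → F x x) + arcSum F ∎
      where
      open ≡-Reasoning
      -- `F` is a linear combination of the indicator functions `cell x y`, so its sum over the arcs
      -- follows from theirs by linearity.
      expand : ∀ u v → F u v ≡ sum λ x → sum λ y → cell x y u v * F x y
      expand u v = sym (trans
        (sum-cong-≗ λ x → trans (sum-cong-≗ λ y → *-assoc (δ u x) (δ v y) (F x y))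
          (trans (sym (*-distribˡ-sum (δ u x) λ y → δ v y * F x y)) (cong (δ u x *_) (sum-δ v (F x)))))
        (sum-δ u λ x → F x v))
      step : arcSum F ≡ sum λ x → sum λ y → arcSum (cell x y) * F x y
      step = trans (arcSum-cong {F} {λ u v → sum λ x → sum λ y → cell x y u v * F x y} expand)
        (trans (arcSum-sum λ x u v → sum λ y → cell x y u v * F x y)
          (sum-cong-≗ λ x → trans (arcSum-sum λ y u v → cell x y u v * F x y)
            (sum-cong-≗ λ y → arcSum-* (F x y) (cell x y))))

    -- Counts the occurrences of `z` in the blocks, an occurrence in position `p` with weight `w p`.
    -- An indicator function as weight counts the blocks in which `z` has a given role.
    load : (Fin k → ℕ) → Fin n → ℕ
    load w z = sum λ i → sum λ p → w p * δ (at i p) z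

    load-sum : ∀ w (g : Fin n → ℕ) → sum (λ z → load w z * g z) ≡ sum λ i → sum λ p → w p * g (at i p)
    load-sum w g = begin
      sum (λ z → load w z * g z)
        ≡⟨ (sum-cong-≗ λ z → trans (*-distribʳ-sum (g z) λ i → sum λ p → w p * δ (at i p) z) (sum-cong-≗ λ i → *-distribʳ-sum (g z) λ p → w p * δ (at i p) z)) ⟩
      sum (λ z → sum λ i → sum λ p → w p * δ (at i p) z * g z)
        ≡⟨ trans (∑-comm λ z i → sum λ p → w p * δ (at i p) z * g z) (sum-cong-≗ λ i → ∑-comm λ z p → w p * δ (at i p) z * g z) ⟩
      sum (λ i → sum λ p → sum λ z → w p * δ (at i p) z * g z)
        ≡⟨ (sum-cong-≗ λ i → sum-cong-≗ λ p → trans (sum-cong-≗ λ z → *-assoc (w p) (δ (at i p) z) (g z))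
             (trans (sym (*-distribˡ-sum (w p) λ z → δ (at i p) z * g z)) (cong (w p *_) (sum-δ (at i p) g)))) ⟩
      sum (λ i → sum λ p → w p * g (at i p)) ∎
      where open ≡-Reasoning

    degree : Fin k → ℕ
    degree p = sum (adj p)

    -- `arc-sum` applied to the indicator of the arcs that start in `z`; the summand 1 is the
    -- diagonal pair.
    degree-sum : ∀ z → n ≡ 1 + load degree z
    degree-sum z = begin
      n                                                ≡⟨ sym (sum-δ z (λ _ → n)) ⟩
      sum {n} (λ x → δ z x * n)                        ≡⟨ (sum-cong-≗ λ x → trans (*-comm (δ z x) n) (sym (sum-const n (δ z x)))) ⟩
      sum {n} (λ x → sum {n} λ y → δ z x)              ≡⟨ arc-sum (λ x _ → δ z x) ⟩
      sum {n} (δ z) + arcSum (λ x _ → δ z x)           ≡⟨ cong₂ _+_ (trans (sum-cong-≗ {n} λ x → sym (*-identityʳ (δ z x))) (sum-δ z (λ _ → 1)))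
                                                            (sum-cong-≗ λ i → sum-cong-≗ λ p → trans (sym (*-distribʳ-sum (δ z (at i p)) (adj p)))
                                                              (cong (degree p *_) (δ-comm z (at i p)))) ⟩
      1 + load degree z                                ∎
      where open ≡-Reasoning

    -- `arc-sum` applied to the constant function 1.
    size-equation : n * n ≡ n + size * sum degree
    size-equation = begin
      n * n                                       ≡⟨ sym (sum-const n n) ⟩
      sum {n} (λ _ → n)                           ≡⟨ (sum-cong-≗ {n} λ _ → trans (sym (*-identityʳ n)) (sym (sum-const n 1))) ⟩
      sum {n} (λ _ → sum {n} λ _ → 1)             ≡⟨ arc-sum (λ _ _ → 1) ⟩
      sum {n} (λ _ → 1) + arcSum (λ _ _ → 1)      ≡⟨ cong₂ _+_ (trans (sum-const n 1) (*-identityʳ n))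
                                                       (trans (sum-cong-≗ {size} λ i → sum-cong-≗ λ p → sum-cong-≗ λ q → *-identityʳ (adj p q))
                                                              (sum-const size _)) ⟩
      n + size * sum degree                       ∎
      where open ≡-Reasoning

    load-+ : ∀ w w′ z → load (λ p → w p + w′ p) z ≡ load w z + load w′ z
    load-+ w w′ z = trans
      (sum-cong-≗ λ i → trans (sum-cong-≗ λ p → *-distribʳ-+ (δ (at i p) z) (w p) (w′ p))
        (∑-distrib-+ (λ p → w p * δ (at i p) z) (λ p → w′ p * δ (at i p) z)))
      (∑-distrib-+ (λ i → sum λ p → w p * δ (at i p) z) (λ i → sum λ p → w′ p * δ (at i p) z))

    load-* : ∀ c w z → load (λ p → c * w p) z ≡ c * load w z
    load-* c w z = trans
      (sum-cong-≗ λ i → trans (sum-cong-≗ λ p → *-assoc c (w p) (δ (at i p) z))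
        (sym (*-distribˡ-sum c λ p → w p * δ (at i p) z)))
      (sym (*-distribˡ-sum c λ i → sum λ p → w p * δ (at i p) z))

    load-cong : ∀ {w w′} z → (∀ p → w p ≡ w′ p) → load w z ≡ load w′ z
    load-cong z eq = sum-cong-≗ λ i → sum-cong-≗ λ p → cong (_* δ (at i p) z) (eq p)

    load-total : ∀ w → sum (load w) ≡ size * sum w
    load-total w = trans (sum-cong-≗ λ z → sym (*-identityʳ (load w z))) (trans (load-sum w (λ _ → 1))
      (trans (sum-cong-≗ {size} λ i → sum-cong-≗ λ p → *-identityʳ (w p)) (sum-const size _)))

    load-≥ : ∀ w i p → w p ≤ load w (at i p)
    load-≥ w i p = ≤-trans (≤-reflexive (trans (sym (*-identityʳ (w p))) (cong (w p *_) (sym (𝟙-yes (at i p Fin.≟ at i p) refl)))))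
      (≤-trans (term-≤-sum (λ q → w q * δ (at i q) (at i p)) p) (term-≤-sum (λ j → sum λ q → w q * δ (at j q) (at i p)) i))

    adj-comm : ∀ p q → adj p q ≡ adj q p
    adj-comm p q with adj? p q
    ... | yes e = sym (𝟙-yes (adj? q p) (Graph.sym G e))
    ... | no ¬e = sym (𝟙-no (adj? q p) (¬e ∘ Graph.sym G))

    -- Handshaking: every vertex is the first end of `degree p` arcs and the second end of as many.
    end-sum : ∀ (g : Fin k → ℕ) → sum (λ p → sum λ q → adj p q * (g p + g q)) ≡ 2 * sum (λ p → degree p * g p)
    end-sum g = begin
      (sum λ p → sum λ q → adj p q * (g p + g q))
        ≡⟨ (sum-cong-≗ λ p → trans (sum-cong-≗ λ q → *-distribˡ-+ (adj p q) (g p) (g q))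
             (∑-distrib-+ (λ q → adj p q * g p) (λ q → adj p q * g q))) ⟩
      (sum λ p → (sum λ q → adj p q * g p) + (sum λ q → adj p q * g q))
        ≡⟨ ∑-distrib-+ (λ p → sum λ q → adj p q * g p) (λ p → sum λ q → adj p q * g q) ⟩
      (sum λ p → sum λ q → adj p q * g p) + (sum λ p → sum λ q → adj p q * g q)
        ≡⟨ cong ((sum λ p → sum λ q → adj p q * g p) +_) (trans (∑-comm λ p q → adj p q * g q)
             (sum-cong-≗ λ q → sum-cong-≗ λ p → cong (_* g q) (adj-comm p q))) ⟩
      (sum λ p → sum λ q → adj p q * g p) + (sum λ p → sum λ q → adj p q * g p)
        ≡⟨ cong₂ _+_ collect (trans collect (sym (+-identityʳ _))) ⟩
      2 * sum (λ p → degree p * g p) ∎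
      where
      open ≡-Reasoning
      collect : (sum λ p → sum λ q → adj p q * g p) ≡ sum (λ p → degree p * g p)
      collect = sum-cong-≗ λ p → sym (*-distribʳ-sum (g p) (adj p))

    -- Each arc is charged to an end of positive weight, where the factor belonging to the other end
    -- is estimated by `c`. A weighted vertex has degree `d`, and its edges count in both
    -- directions, whence the factors `d` and 2.
    arcSum-bound : ∀ (w : Fin k → ℕ) (a : Fin n → ℕ) c d → (∀ z → a z ≤ c) →
      (∀ p q → Adj G p q → 1 ≤ w p + w q) → (∀ p → degree p * w p ≡ d * w p) →
      arcSum (λ x y → a x * a y) ≤ c * (2 * (d * sum (λ z → load w z * a z)))
    arcSum-bound w a c d a≤c covers degree-w = ≤-trans
      (sum-mono _ _ λ i → sum-mono _ _ λ p → sum-mono _ _ λ q → bound p q (at i p) (at i q))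
      (≤-reflexive total)
      where
      open ≡-Reasoning
      bound : ∀ p q x y → adj p q * (a x * a y) ≤ adj p q * (c * (w p * a x) + c * (w q * a y))
      bound p q x y with adj? p q
      ... | no _ = z≤n
      ... | yes e = *-monoʳ-≤ 1 (charge (w p) (w q) (covers p q e))
        where
        charge : ∀ s t → 1 ≤ s + t → a x * a y ≤ c * (s * a x) + c * (t * a y)
        charge (suc s) t _ = ≤-trans (≤-trans (≤-reflexive (*-comm (a x) (a y))) (*-mono-≤ (a≤c y) (m≤m+n (a x) (s * a x)))) (m≤m+n _ _)
        charge zero (suc t) _ = ≤-trans (*-mono-≤ (a≤c x) (m≤m+n (a y) (t * a y))) (m≤n+m _ _)
      reassoc : ∀ p m → degree p * (c * (w p * m)) ≡ c * d * (w p * m)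
      reassoc p m = begin
        degree p * (c * (w p * m))   ≡⟨ sym (*-assoc (degree p) c _) ⟩
        degree p * c * (w p * m)     ≡⟨ cong (_* (w p * m)) (*-comm (degree p) c) ⟩
        c * degree p * (w p * m)     ≡⟨ *-assoc c (degree p) _ ⟩
        c * (degree p * (w p * m))   ≡⟨ cong (c *_) (sym (*-assoc (degree p) (w p) m)) ⟩
        c * (degree p * w p * m)     ≡⟨ cong (λ t → c * (t * m)) (degree-w p) ⟩
        c * (d * w p * m)            ≡⟨ cong (c *_) (*-assoc d (w p) m) ⟩
        c * (d * (w p * m))          ≡⟨ sym (*-assoc c d _) ⟩
        c * d * (w p * m)            ∎
      total : (sum λ i → sum λ p → sum λ q → adj p q * (c * (w p * a (at i p)) + c * (w q * a (at i q))))
            ≡ c * (2 * (d * sum (λ z → load w z * a z)))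
      total = begin
        (sum λ i → sum λ p → sum λ q → adj p q * (c * (w p * a (at i p)) + c * (w q * a (at i q))))
          ≡⟨ (sum-cong-≗ λ i → end-sum λ p → c * (w p * a (at i p))) ⟩
        (sum λ i → 2 * sum λ p → degree p * (c * (w p * a (at i p))))
          ≡⟨ (sum-cong-≗ λ i → cong (2 *_) (trans (sum-cong-≗ λ p → reassoc p (a (at i p))) (sym (*-distribˡ-sum (c * d) λ p → w p * a (at i p))))) ⟩
        (sum λ i → 2 * (c * d * sum λ p → w p * a (at i p)))
          ≡⟨ sym (*-distribˡ-sum 2 λ i → c * d * sum λ p → w p * a (at i p)) ⟩
        2 * (sum λ i → c * d * sum λ p → w p * a (at i p))
          ≡⟨ cong (2 *_) (sym (*-distribˡ-sum (c * d) λ i → sum λ p → w p * a (at i p))) ⟩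
        2 * (c * d * sum λ i → sum λ p → w p * a (at i p))
          ≡⟨ cong (λ t → 2 * (c * d * t)) (sym (load-sum w a)) ⟩
        2 * (c * d * S)
          ≡⟨ cong (2 *_) (*-assoc c d S) ⟩
        2 * (c * (d * S))
          ≡⟨ trans (sym (*-assoc 2 c _)) (trans (cong (_* (d * S)) (*-comm 2 c)) (*-assoc c 2 _)) ⟩
        c * (2 * (d * S)) ∎
        where S = sum (λ z → load w z * a z)

-- Necessary conditions

module Necessity where

  open import Data.Nat using (ℕ; zero; suc; _+_; _*_; _≤_; _<_; _%_; _≟_; z≤n; s≤s; _≤?_)
  open import Data.Nat.DivMod using (m%n<n; %-distribˡ-*; [m+kn]%n≡m%n)
  open import Data.Nat.Properties hiding (suc-injective; _≟_; _<?_; _≤?_)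
  open import Data.Fin using (Fin; zero; suc)
  import Data.Fin.Properties as Fin
  open import Data.List using (List)
  import Data.List.Membership.DecPropositional as DecMembership
  open import Data.Product using (_×_; _,_; proj₁; proj₂)
  open import Data.Product.Properties using (≡-dec)
  open import Data.Sum using (_⊎_)
  open import Function using (_∘_)
  open import Relation.Binary.PropositionalEquality
  open import Relation.Nullary using (¬_; Dec; contradiction)
  open import Relation.Nullary.Decidable using (True; toWitness; _×-dec_; _⊎-dec_; _→-dec_; from-yes)
  open import Algebra.Properties.Semiring.Sum +-*-semiring using (sum; sum-cong-≗; *-distribˡ-sum; *-distribʳ-sum; ∑-distrib-+)
  open ArcSums

  adj? : ∀ {m} (es : List (Fin m × Fin m)) {ok : _} p q → Dec (Adj (fromEdges es {ok}) p q)
  adj? {m} es p q = ((p , q) ∈? es) ⊎-dec ((q , p) ∈? es)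
    where open DecMembership (≡-dec (Fin._≟_ {m}) Fin._≟_) using (_∈?_)

  adj₃? : ∀ p q → Dec (Adj n₃ p q)
  adj₃? = adj? _

  adj₆? : ∀ p q → Dec (Adj n₆ p q)
  adj₆? = adj? _

  adj₈? : ∀ p q → Dec (Adj n₈ p q)
  adj₈? = adj? _

  adj₁₀? : ∀ p q → Dec (Adj n₁₀ p q)
  adj₁₀? = adj? _

  adj₁₃? : ∀ p q → Dec (Adj n₁₃ p q)
  adj₁₃? = adj? _

  Admissible : ℕ → Set
  Admissible r = r ≡ 0 ⊎ r ≡ 1 ⊎ r ≡ 5 ⊎ r ≡ 16

  admissible? : ∀ r → Dec (Admissible r)
  admissible? r = (r ≟ 0) ⊎-dec (r ≟ 1) ⊎-dec (r ≟ 5) ⊎-dec (r ≟ 16)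

  -- The admissible residues are the idempotents modulo 20: the numbers that are 0 or 1 modulo 4 and
  -- modulo 5.
  square-residue : ∀ {r} → r < 20 → (r * r) % 20 ≡ r → Admissible r
  square-residue = from-yes (allUpTo? (λ r → ((r * r) % 20 ≟ r) →-dec admissible? r) 20)

  sum-product : ∀ {n} (a : Fin n → ℕ) → sum (λ x → sum λ y → a x * a y) ≡ sum a * sum a
  sum-product a = trans (sum-cong-≗ λ x → sym (*-distribˡ-sum (a x) a)) (sym (*-distribʳ-sum (sum a) a))

  module TenEdges {n : ℕ} (G : Graph (Fin 6)) (adj?′ : ∀ p q → Dec (Adj G p q)) (D : Design G n)
                  (20-arcs : sum (λ p → sum λ q → 𝟙 (adj?′ p q)) ≡ 20) where

    open Necessary G adj?′ D public

    size-20 : n * n ≡ n + size * 20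
    size-20 = trans size-equation (cong (λ s → n + size * s) 20-arcs)

    residue : Admissible (n % 20)
    residue = square-residue (m%n<n n 20) (trans (sym (%-distribˡ-* n n 20))
      (trans (cong (_% 20) size-20) ([m+kn]%n≡m%n n size 20)))

    size≡ : ∀ {k} s → n ≡ k → k * k ≡ k + s * 20 → size ≡ s
    size≡ {k} s refl eq = *-cancelʳ-≡ size s 20 (+-cancelˡ-≡ n (size * 20) (s * 20) (trans (sym size-20) eq))

    -- The ten edges of `complete 5` would form a single block, but a block has six points.
    n≢5 : n ≢ 5
    n≢5 n≡5 = no-block size (size≡ 1 n≡5 refl) at (at-injective)
      where
      -- `size` is not a variable; it is generalised to `s`, so that matching on `s ≡ 1` makes
      -- `zero` a block.
      no-block : ∀ s → s ≡ 1 → (f : Fin s → Fin 6 → Fin n) → ¬ (∀ i {p q} → f i p ≡ f i q → p ≡ q)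
      no-block _ refl f inj with ≤-trans (Fin.injective⇒≤ (inj zero)) (≤-reflexive n≡5)
      ... | s≤s (s≤s (s≤s (s≤s (s≤s ()))))

    module Roles (u v : ℕ) (hub rim : Fin 6 → ℕ) (degrees : ∀ p → degree p ≡ u * hub p + v * rim p) where

      a b : Fin n → ℕ
      a = load hub
      b = load rim

      degree-equation : ∀ z → n ≡ 1 + (u * a z + v * b z)
      degree-equation z = trans (degree-sum z) (cong suc (trans (load-cong z degrees)
        (trans (load-+ (λ p → u * hub p) (λ p → v * rim p) z) (cong₂ _+_ (load-* u hub z) (load-* v rim z)))))

      module _ (a²≡3a : ∀ z → a z * a z ≡ 3 * a z) where

        -- That `a` takes the values 0 and 3 only is expressed by a² = 3a: the diagonal of the
        -- double sum then becomes a multiple of `sum a`, which is known from the number of blocks.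
        hub-sum : sum a * sum a ≡ 3 * sum a + arcSum (λ x y → a x * a y)
        hub-sum = trans (sym (sum-product a)) (trans (arc-sum (λ x y → a x * a y))
          (cong (_+ arcSum (λ x y → a x * a y)) (trans (sum-cong-≗ a²≡3a) (sym (*-distribˡ-sum 3 a)))))

  module _ {u v : ℕ} (P : ℕ → ℕ → Set) (P? : ∀ a b → Dec (P a b)) where
    -- Both coefficients are positive, so `a` and `b` are less than `n` and the property can be
    -- evaluated for all candidates.
    solutions : ∀ n {_ : True (allUpTo? (λ a → allUpTo? (λ b → (n ≟ 1 + (suc u * a + suc v * b)) →-dec P? a b) n) n)}
                → ∀ a b → n ≡ 1 + (suc u * a + suc v * b) → P a b
    solutions n {t} a b eq = toWitness t {a} (bound u a (suc v * b) eq) {b} (bound v b (suc u * a) (trans eq (cong suc (+-comm (suc u * a) _)))) eq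
      where
      bound : ∀ u a t → n ≡ 1 + (suc u * a + t) → a < n
      bound u a t eq = ≤-trans (s≤s (≤-trans (m≤n*m a (suc u)) (m≤m+n (suc u * a) t))) (≤-reflexive (sym eq))

  -- `n₁₃` is a wheel: `v1` is joined to all vertices of the 5-cycle `v2`, `v5`, `v3`, `v6`, `v4`.
  wheel-hub wheel-rim : Fin 6 → ℕ
  wheel-hub zero = 1
  wheel-hub (suc _) = 0
  wheel-rim zero = 0
  wheel-rim (suc _) = 1

  module Wheel {n : ℕ} (D : Design n₁₃ n) where
    open TenEdges n₁₃ adj₁₃? D refl

    degrees : ∀ p → degree p ≡ 5 * wheel-hub p + 3 * wheel-rim p
    degrees = λ { v1 → refl ; v2 → refl ; v3 → refl ; v4 → refl ; v5 → refl ; v6 → refl }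

    open Roles 5 3 wheel-hub wheel-rim degrees

    n₁₃-residue : Admissible (n % 20)
    n₁₃-residue = residue

    n₁₃≢5 : n ≢ 5
    n₁₃≢5 = n≢5

    -- 19 = 5a + 3b forces a = 2 at each of the 20 points, but the 19 blocks have one hub each.
    n₁₃≢20 : n ≢ 20
    n₁₃≢20 n≡20 = contradiction (begin
      n * 2               ≡⟨ sym (sum-const n 2) ⟩
      sum {n} (λ _ → 2)   ≡⟨ (sum-cong-≗ λ z → sym (a≡2 z)) ⟩
      sum a               ≡⟨ load-total wheel-hub ⟩
      size * 1            ≡⟨ cong (_* 1) (size≡ 19 n≡20 refl) ⟩
      19                  ∎) (λ e → contradiction (trans (cong (_* 2) (sym n≡20)) e) λ ())
      where
      open ≡-Reasoning
      a≡2 : ∀ z → a z ≡ 2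
      a≡2 z = solutions {4} {2} (λ a _ → a ≡ 2) (λ a _ → a ≟ 2) 20 (a z) (b z) (trans (sym n≡20) (degree-equation z))

    -- 15 = 5a + 3b has the solutions (0 , 5) and (3 , 0), and Σ a = 12: two of the four points
    -- that are hubs whenever they occur cannot be joined.
    n₁₃≢16 : n ≢ 16
    n₁₃≢16 n≡16 = contradiction (begin
      144                                       ≡⟨ sym (cong₂ _*_ total total) ⟩
      sum a * sum a                             ≡⟨ hub-sum (proj₁ ∘ cases) ⟩
      3 * sum a + arcSum (λ x y → a x * a y)    ≡⟨ cong₂ _+_ (cong (3 *_) total) no-hub-arcs ⟩
      36                                        ∎) λ ()
      where
      open ≡-Reasoning
      cases : ∀ z → a z * a z ≡ 3 * a z × (1 ≤ b z → a z ≡ 0)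
      cases z = solutions {4} {2} (λ a b → a * a ≡ 3 * a × (1 ≤ b → a ≡ 0)) (λ a b → (a * a ≟ 3 * a) ×-dec ((1 ≤? b) →-dec (a ≟ 0)))
        16 (a z) (b z) (trans (sym n≡16) (degree-equation z))
      total : sum a ≡ 12
      total = trans (load-total wheel-hub) (cong (_* 1) (size≡ 12 n≡16 refl))
      rim⇒a≡0 : ∀ i p → 1 ≤ wheel-rim p → a (at i p) ≡ 0
      rim⇒a≡0 i p 1≤ = proj₂ (cases _) (≤-trans 1≤ (load-≥ wheel-rim i p))
      zero-arc : ∀ i p q → adj p q * (a (at i p) * a (at i q)) ≡ 0
      zero-arc i zero zero = refl
      zero-arc i (suc p) q = trans (cong (λ t → adj (suc p) q * (t * a (at i q))) (rim⇒a≡0 i (suc p) (s≤s z≤n))) (*-zeroʳ (adj (suc p) q))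
      zero-arc i zero (suc q) = trans (cong (λ t → adj zero (suc q) * (a (at i zero) * t)) (rim⇒a≡0 i (suc q) (s≤s z≤n)))
        (trans (cong (adj zero (suc q) *_) (*-zeroʳ (a (at i zero)))) (*-zeroʳ (adj zero (suc q))))
      no-hub-arcs : arcSum (λ x y → a x * a y) ≡ 0
      no-hub-arcs = sum-zero _ λ i → sum-zero _ λ p → sum-zero _ λ q → zero-arc i p q

  -- `n₈` is an octahedron with poles `v1` and `v2`, from whose equator two opposite edges are
  -- deleted.
  octahedral-hub octahedral-rim : Fin 6 → ℕ
  octahedral-hub v1 = 1
  octahedral-hub v2 = 1
  octahedral-hub _  = 0
  octahedral-rim v1 = 0
  octahedral-rim v2 = 0
  octahedral-rim _  = 1


  module Octahedral {n : ℕ} (D : Design n₈ n) where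
    open TenEdges n₈ adj₈? D refl

    degrees : ∀ p → degree p ≡ 4 * octahedral-hub p + 3 * octahedral-rim p
    degrees = λ { v1 → refl ; v2 → refl ; v3 → refl ; v4 → refl ; v5 → refl ; v6 → refl }

    open Roles 4 3 octahedral-hub octahedral-rim degrees

    n₈-residue : Admissible (n % 20)
    n₈-residue = residue

    n₈≢5 : n ≢ 5
    n₈≢5 = n≢5

    -- 15 = 4a + 3b has the solutions (0 , 5) and (3 , 1), and Σ a = 24: the eight points with a = 3
    -- occur only eight times outside the hubs, which are not adjacent, so at most 24 of their 28 pairs
    -- are joined.  Below this is 432 < 504, each pair being weighted by 3 · 3 and counted twice.
    n₈≢16 : n ≢ 16
    n₈≢16 n≡16 = <⇒≱ (s≤s (≤-trans (arcSum-bound octahedral-rim a 3 3 (proj₁ ∘ proj₂ ∘ cases) one-rim rim-degree)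
        (≤-reflexive (cong (λ t → 3 * (2 * (3 * t))) (trans (sum-cong-≗ (proj₂ ∘ proj₂ ∘ cases)) total)))))
      (≤-trans (≤-trans (n≤1+n 433) (m≤m+n 434 70)) (≤-reflexive (+-cancelˡ-≡ 72 504 _ (begin
        576                                       ≡⟨ sym (cong₂ _*_ total total) ⟩
        sum a * sum a                             ≡⟨ hub-sum (proj₁ ∘ cases) ⟩
        3 * sum a + arcSum (λ x y → a x * a y)    ≡⟨ cong (λ t → 3 * t + arcSum (λ x y → a x * a y)) total ⟩
        72 + arcSum (λ x y → a x * a y)           ∎))))
      where
      open ≡-Reasoning
      cases : ∀ z → a z * a z ≡ 3 * a z × a z ≤ 3 × b z * a z ≡ a z
      cases z = solutions {3} {2} (λ a b → a * a ≡ 3 * a × a ≤ 3 × b * a ≡ a)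
        (λ a b → (a * a ≟ 3 * a) ×-dec ((a ≤? 3) ×-dec (b * a ≟ a)))
        16 (a z) (b z) (trans (sym n≡16) (degree-equation z))
      total : sum a ≡ 24
      total = trans (load-total octahedral-hub) (cong (_* 2) (size≡ 12 n≡16 refl))
      one-rim : ∀ p q → Adj n₈ p q → 1 ≤ octahedral-rim p + octahedral-rim q
      one-rim = from-yes (Fin.all? λ p → Fin.all? λ q → adj₈? p q →-dec (1 ≤? octahedral-rim p + octahedral-rim q))
      rim-degree : ∀ p → degree p * octahedral-rim p ≡ 3 * octahedral-rim p
      rim-degree = λ { v1 → refl ; v2 → refl ; v3 → refl ; v4 → refl ; v5 → refl ; v6 → refl }

-- Coverings and their verification by evaluation

module Coverings where

  open FromCoverings
  open import Data.Bool using (Bool; true; false; _∧_; not; if_then_else_; T)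
  open import Data.Nat using (ℕ; zero; suc; _+_; _*_; _∸_; _%_; _≤_; _<_; _≡ᵇ_; _<ᵇ_; _≤ᵇ_; z≤n)
  open import Data.Nat.Properties using (≡ᵇ⇒≡; <ᵇ⇒<; ≤ᵇ⇒≤; <-cmp; ≡⇒≡ᵇ; ≤-reflexive; ≤-trans; m≤n⇒m<n∨m≡n; m≤m+n; <-irrefl; <-trans; +-identityʳ; +-suc; m+[n∸m]≡n; n≤1+n; n∸n≡0; m+n∸n≡m)
  open import Data.Fin using (Fin; zero; suc; toℕ; fromℕ<)
  open import Data.Fin.Properties using (toℕ<n; toℕ-fromℕ<; toℕ-injective)
  open import Data.List using (List; []; _∷_; concat; concatMap; map; length; lookup)
  open import Data.List.Membership.Propositional using (_∈_; find; lose)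
  open import Data.List.Membership.Propositional.Properties using (∈-map⁺; ∈-concat⁻; ∈-lookup)
  open import Data.List.Relation.Unary.All as All using (All; []; _∷_)
  open import Data.List.Relation.Unary.Any as Any using (Any; here; there)
  open import Data.List.Relation.Unary.Any.Properties using (lookup-index; concatMap⁺; concatMap⁻; map⁻)
  open import Data.Product using (_×_; _,_; ∃; ∃₂; proj₁; proj₂)
  open import Data.Sum using (_⊎_; inj₁; inj₂; swap)
  open import Data.Unit using (tt)
  open import Data.Vec as Vec using (Vec; []; _∷_)
  open import Function.Definitions using (Injective)
  open import Relation.Binary using (tri<; tri≈; tri>)
  open import Relation.Binary.PropositionalEquality
  open import Relation.Nullary using (contradiction)

  -- A block lists the points in the positions v1, …, v6.
  Block : Set
  Block = Vec ℕ 6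

  infixl 8 _!_
  _!_ : Block → Fin 6 → ℕ
  _!_ = Vec.lookup

  Edges : Set
  Edges = List (Fin 6 × Fin 6)

  record Valid (n : ℕ) (B : Block) : Set where
    constructor valid
    field
      bound    : ∀ i → B ! i < n
      distinct : Injective _≡_ _≡_ (B !_)

  Joins : Edges → ℕ → ℕ → Block → Set
  Joins es x y B = Any (λ e → (B ! proj₁ e ≡ x × B ! proj₂ e ≡ y) ⊎ (B ! proj₁ e ≡ y × B ! proj₂ e ≡ x)) es

  Covers : Edges → List Block → ℕ → ℕ → Set
  Covers es L x y = Any (Joins es x y) L

  -- The pairs x < y < n with x < w are all covered, and no more blocks are used
  -- than there are such pairs: a design of order n with a hole on the last n ∸ w points.
  record Covering (es : Edges) (w n : ℕ) : Set where
    field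
      blocks : List Block
      ok     : All (Valid n) blocks
      covers : ∀ {x y} → x < w → x < y → y < n → Covers es blocks x y
      few    : length blocks * (length es + length es) + (n ∸ w) * (n ∸ w ∸ 1) ≤ n * (n ∸ 1)

  Joins-sym : ∀ {es x y B} → Joins es x y B → Joins es y x B
  Joins-sym = Any.map swap

  Covering⇒Design : ∀ es {loopless} n → 1 ≤ length es → Covering es n n → Design (fromEdges es {loopless}) n
  Covering⇒Design es {loopless} n 1≤es C = covering⇒Design es {loopless} f f-inj cov
    (≤-trans (m≤m+n _ ((n ∸ n) * (n ∸ n ∸ 1))) few) 1≤es
    where
    open Covering C
    valid-at : ∀ i → Valid n (lookup blocks i)
    valid-at i = All.lookup ok (∈-lookup i)
    f : Fin (length blocks) → Fin 6 → Fin n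
    f i p = fromℕ< (Valid.bound (valid-at i) p)
    toℕ-f : ∀ i p → toℕ (f i p) ≡ lookup blocks i ! p
    toℕ-f i p = toℕ-fromℕ< (Valid.bound (valid-at i) p)
    f-inj : ∀ i → Injective _≡_ _≡_ (f i)
    f-inj i {p} {q} eq = Valid.distinct (valid-at i) (trans (sym (toℕ-f i p)) (trans (cong toℕ eq) (toℕ-f i q)))
    covers′ : ∀ x y → x ≢ y → Covers es blocks (toℕ x) (toℕ y)
    covers′ x y x≢y with <-cmp (toℕ x) (toℕ y)
    ... | tri< x<y _ _ = covers (toℕ<n x) x<y (toℕ<n y)
    ... | tri≈ _ x≡y _ = contradiction (toℕ-injective x≡y) x≢y
    ... | tri> _ _ y<x = Any.map (λ {B} → Joins-sym {es} {toℕ y} {toℕ x} {B}) (covers (toℕ<n y) y<x (toℕ<n x))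
    f≡ : ∀ i p x → lookup blocks i ! p ≡ toℕ x → f i p ≡ x
    f≡ i p x eq = toℕ-injective (trans (toℕ-f i p) eq)
    cov : ∀ x y → x ≢ y → ∃ λ i → ∃₂ λ p q → Adj (fromEdges es {loopless}) p q × f i p ≡ x × f i q ≡ y
    cov x y x≢y with covers′ x y x≢y
    ... | c with find (lookup-index c)
    ...   | (p , q) , e∈es , inj₁ (a , b) = Any.index c , p , q , inj₁ e∈es , f≡ _ p x a , f≡ _ q y b
    ...   | (p , q) , e∈es , inj₂ (a , b) = Any.index c , q , p , inj₂ e∈es , f≡ _ q x b , f≡ _ p y a

  Pair : Set
  Pair = ℕ × ℕ

  -- This gives the lexicographic order as long as second coordinates stay below 1000; the largest
  -- order checked below is 240.
  key : Pair → ℕ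
  key (x , y) = x * 1000 + y

  merge : List Pair → List Pair → List Pair
  merge [] ys = ys
  merge (x ∷ xs) [] = x ∷ xs
  merge (x ∷ xs) (y ∷ ys) = if key x <ᵇ key y then x ∷ merge xs (y ∷ ys) else y ∷ merge (x ∷ xs) ys

  -- The soundness of the check rests on this direction: merging invents no pair. Pairs in a wrong
  -- order could only make the check fail.
  ∈-merge : ∀ {z} xs ys → z ∈ merge xs ys → z ∈ xs ⊎ z ∈ ys
  ∈-merge [] ys m = inj₂ m
  ∈-merge (x ∷ xs) [] m = inj₁ m
  ∈-merge (x ∷ xs) (y ∷ ys) m with key x <ᵇ key y
  ∈-merge (x ∷ xs) (y ∷ ys) (here eq) | true = inj₁ (here eq)
  ∈-merge (x ∷ xs) (y ∷ ys) (there m) | true with ∈-merge xs (y ∷ ys) m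
  ... | inj₁ m′ = inj₁ (there m′)
  ... | inj₂ m′ = inj₂ m′
  ∈-merge (x ∷ xs) (y ∷ ys) (here eq) | false = inj₂ (here eq)
  ∈-merge (x ∷ xs) (y ∷ ys) (there m) | false with ∈-merge (x ∷ xs) ys m
  ... | inj₁ m′ = inj₁ m′
  ... | inj₂ m′ = inj₂ (there m′)

  mergePairs : List (List Pair) → List (List Pair)
  mergePairs (xs ∷ ys ∷ zss) = merge xs ys ∷ mergePairs zss
  mergePairs zss = zss

  ∈-mergePairs : ∀ {z} zss → Any (z ∈_) (mergePairs zss) → Any (z ∈_) zss
  ∈-mergePairs [] m = m
  ∈-mergePairs (xs ∷ []) m = m
  ∈-mergePairs (xs ∷ ys ∷ zss) (here m) with ∈-merge xs ys m
  ... | inj₁ m′ = here m′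
  ... | inj₂ m′ = there (here m′)
  ∈-mergePairs (xs ∷ ys ∷ zss) (there m) = there (there (∈-mergePairs zss m))

  -- Merging in k rounds sorts up to 2ᵏ pairs.
  sort : ℕ → List (List Pair) → List Pair
  sort zero zss = concat zss
  sort (suc k) zss = sort k (mergePairs zss)

  ∈-sort : ∀ {z} k zss → z ∈ sort k zss → Any (z ∈_) zss
  ∈-sort zero zss m = ∈-concat⁻ zss m
  ∈-sort (suc k) zss m = ∈-mergePairs zss (∈-sort k (mergePairs zss) m)

  ∧-split : ∀ a {b} → T (a ∧ b) → T a × T b
  ∧-split true t = tt , t

  -- One simultaneous pass over two sorted lists, skipping unmatched entries of the first. It is
  -- linear, while a separate search for each pair would be quadratic.
  includesᵇ : List Pair → List Pair → Bool
  includesᵇ _ [] = true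
  includesᵇ [] (_ ∷ _) = false
  includesᵇ ((x , y) ∷ zs) ((x′ , y′) ∷ zs′) =
    if (x ≡ᵇ x′) ∧ (y ≡ᵇ y′) then includesᵇ zs zs′ else includesᵇ zs ((x′ , y′) ∷ zs′)

  includes-sound : ∀ xs ys → T (includesᵇ xs ys) → ∀ {z} → z ∈ ys → z ∈ xs
  includes-sound ((x , y) ∷ zs) ((x′ , y′) ∷ zs′) t z∈ with (x ≡ᵇ x′) ∧ (y ≡ᵇ y′) in eq
  ... | false = there (includes-sound zs ((x′ , y′) ∷ zs′) t z∈)
  includes-sound ((x , y) ∷ zs) ((x′ , y′) ∷ zs′) t (there z∈) | true = there (includes-sound zs zs′ t z∈)
  includes-sound ((x , y) ∷ zs) ((x′ , y′) ∷ zs′) t (here refl) | true =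
    let tx , ty = ∧-split (x ≡ᵇ x′) (subst T (sym eq) tt) in here (sym (cong₂ _,_ (≡ᵇ⇒≡ x x′ tx) (≡ᵇ⇒≡ y y′ ty)))

  range : ℕ → ℕ → List ℕ
  range s zero = []
  range s (suc k) = s ∷ range (suc s) k

  ∈-range : ∀ {y} s k → s ≤ y → y < s + k → y ∈ range s k
  ∈-range s zero s≤y y<s = contradiction (≤-trans (≤-trans y<s (≤-reflexive (+-identityʳ s))) s≤y) (<-irrefl refl)
  ∈-range s (suc k) s≤y y<s with m≤n⇒m<n∨m≡n s≤y
  ... | inj₁ s<y = there (∈-range (suc s) k s<y (≤-trans y<s (≤-reflexive (+-suc s k))))
  ... | inj₂ refl = here refl

  rows : (ℕ → List ℕ) → ℕ → List Pair
  rows row w = concatMap (λ x → map (x ,_) (row x)) (range 0 w)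

  ∈-rows : ∀ {row w x y} → x < w → y ∈ row x → (x , y) ∈ rows row w
  ∈-rows {row} {w} {x} x<w y∈ = concatMap⁺ (λ x → map (x ,_) (row x)) (lose (∈-range 0 w z≤n x<w) (∈-map⁺ (x ,_) y∈))

  -- For a list of blocks, the list of the images of their edges under g,
  -- sorted, is compared with the sorted list of the pairs (x , y) with x < w and y in row x.
  module Check (es : Edges) (g : ℕ → ℕ → Pair) where

    images : List Block → List (List Pair)
    images = concatMap λ B → map (λ e → g (B ! proj₁ e) (B ! proj₂ e) ∷ []) es

    attains : (ℕ → List ℕ) → ℕ → List Block → Bool
    attains row w L = includesᵇ (sort 16 (images L)) (rows row w)

    attains-sound : ∀ row w L → T (attains row w L) → ∀ {x y} → x < w → y ∈ row x →
      Any (λ B → Any (λ e → g (B ! proj₁ e) (B ! proj₂ e) ≡ (x , y)) es) L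
    attains-sound row w L t {x} {y} x<w y∈ = Any.map (λ m → Any.map (λ { (here eq) → sym eq }) (map⁻ m))
      (concatMap⁻ (λ B → map (λ e → g (B ! proj₁ e) (B ! proj₂ e) ∷ []) es) {xs = L}
        (∈-sort 16 (images L) (includes-sound (sort 16 (images L)) (rows row w) t (∈-rows {row} x<w y∈))))

  ∉ᵇ : ∀ {k} → ℕ → Vec ℕ k → Bool
  ∉ᵇ x [] = true
  ∉ᵇ x (y ∷ ys) = not (x ≡ᵇ y) ∧ ∉ᵇ x ys

  distinctᵇ : ∀ {k} → Vec ℕ k → Bool
  distinctᵇ [] = true
  distinctᵇ (x ∷ xs) = ∉ᵇ x xs ∧ distinctᵇ xs

  boundedᵇ : ∀ {k} → ℕ → Vec ℕ k → Bool
  boundedᵇ n [] = true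
  boundedᵇ n (x ∷ xs) = (x <ᵇ n) ∧ boundedᵇ n xs

  not-both : ∀ {A : Set} b → T (not b) → T b → A
  not-both true () _
  not-both false _ ()

  ∉-sound : ∀ {k} x (xs : Vec ℕ k) → T (∉ᵇ x xs) → ∀ i → x ≢ Vec.lookup xs i
  ∉-sound x (y ∷ ys) t i eq with ∧-split (not (x ≡ᵇ y)) t
  ∉-sound x (.x ∷ ys) t zero refl | t₁ , _ = not-both (x ≡ᵇ x) t₁ (≡⇒≡ᵇ x x refl)
  ∉-sound x (y ∷ ys) t (suc i) eq | _ , t₂ = ∉-sound x ys t₂ i eq

  distinct-sound : ∀ {k} (xs : Vec ℕ k) → T (distinctᵇ xs) → Injective _≡_ _≡_ (Vec.lookup xs)
  distinct-sound (x ∷ xs) t {i} {j} eq with ∧-split (∉ᵇ x xs) t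
  distinct-sound (x ∷ xs) t {zero} {zero} eq | _ = refl
  distinct-sound (x ∷ xs) t {zero} {suc j} eq | t₁ , _ = contradiction eq (∉-sound x xs t₁ j)
  distinct-sound (x ∷ xs) t {suc i} {zero} eq | t₁ , _ = contradiction (sym eq) (∉-sound x xs t₁ i)
  distinct-sound (x ∷ xs) t {suc i} {suc j} eq | _ , t₂ = cong suc (distinct-sound xs t₂ eq)

  bounded-sound : ∀ {k n} (xs : Vec ℕ k) → T (boundedᵇ n xs) → ∀ i → Vec.lookup xs i < n
  bounded-sound {n = n} (x ∷ xs) t i with ∧-split (x <ᵇ n) t
  bounded-sound {n = n} (x ∷ xs) t zero | t₁ , _ = <ᵇ⇒< x n t₁
  bounded-sound (x ∷ xs) t (suc i) | _ , t₂ = bounded-sound xs t₂ i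

  allValidᵇ : ℕ → List Block → Bool
  allValidᵇ n [] = true
  allValidᵇ n (B ∷ L) = (boundedᵇ n B ∧ distinctᵇ B) ∧ allValidᵇ n L

  allValid-sound : ∀ n L → T (allValidᵇ n L) → All (Valid n) L
  allValid-sound n [] _ = []
  allValid-sound n (B ∷ L) t with ∧-split (boundedᵇ n B ∧ distinctᵇ B) t
  ... | t₁ , t₂ with ∧-split (boundedᵇ n B) t₁
  ...   | t₃ , t₄ = valid (bounded-sound B t₃) (distinct-sound B t₄) ∷ allValid-sound n L t₂

  ordered : ℕ → ℕ → Pair
  ordered x y = if x <ᵇ y then (x , y) else (y , x)

  ordered-sound : ∀ {x y u v} → ordered x y ≡ (u , v) → (x ≡ u × y ≡ v) ⊎ (x ≡ v × y ≡ u)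
  ordered-sound {x} {y} eq with x <ᵇ y
  ordered-sound refl | true = inj₁ (refl , refl)
  ordered-sound refl | false = inj₂ (refl , refl)

  isCovering : Edges → ℕ → ℕ → List Block → Bool
  isCovering es w n L = allValidᵇ n L ∧ Check.attains es ordered (λ x → range (suc x) (n ∸ suc x)) w L
    ∧ (length L * (length es + length es) + (n ∸ w) * (n ∸ w ∸ 1) ≤ᵇ n * (n ∸ 1))

  covering : ∀ es w n L → T (isCovering es w n L) → Covering es w n
  covering es w n L t = record
    { blocks = L
    ; ok     = allValid-sound n L (proj₁ t₁)
    ; covers = λ {x} {y} x<w x<y y<n → Any.map (Any.map ordered-sound)
        (Check.attains-sound es ordered (λ x → range (suc x) (n ∸ suc x)) w L (proj₁ t₂) x<w
          (∈-range (suc x) (n ∸ suc x) x<y (≤-trans y<n (≤-reflexive (sym (m+[n∸m]≡n (<-trans x<y y<n)))))))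
    ; few    = ≤ᵇ⇒≤ _ _ (proj₂ t₂)
    }
    where
    t₁ = ∧-split (allValidᵇ n L) t
    t₂ = ∧-split (Check.attains es ordered (λ x → range (suc x) (n ∸ suc x)) w L) (proj₂ t₁)

  -- A design is a design with a hole of size 1.
  puncture : ∀ {es n} → Covering es (suc n) (suc n) → Covering es n (suc n)
  puncture {es} {n} C = record
    { blocks = Covering.blocks C
    ; ok     = Covering.ok C
    ; covers = λ x<n → Covering.covers C (≤-trans x<n (n≤1+n n))
    ; few    = subst (λ k → length (Covering.blocks C) * (length es + length es) + k ≤ suc n * n) (sym holes)
        (subst (λ k → length (Covering.blocks C) * (length es + length es) + k * (k ∸ 1) ≤ suc n * n) (n∸n≡0 n) (Covering.few C))
    }
    where
    holes : (suc n ∸ n) * (suc n ∸ n ∸ 1) ≡ 0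
    holes = cong (λ k → k * (k ∸ 1)) (m+n∸n≡m 1 n)

  Cycles : Set
  Cycles = List (ℕ × ℕ)

  -- The points are numbered consecutively along the cycles; a cycle is given by its
  -- length and the distance that its points move in one step.
  shift : Cycles → ℕ → ℕ → ℕ
  shift [] s p = p
  shift ((zero , _) ∷ cs) s p = shift cs s p
  shift ((c@(suc _) , d) ∷ cs) s p = if p <ᵇ c then (p + s * d) % c else c + shift cs s (p ∸ c)

-- Arithmetic modulo the number of parts, and gadgets on four parts

module Gadgetry where

  open Coverings
  open import Data.Bool using (Bool; true; false; _∧_; if_then_else_; T)
  open import Data.Nat using (ℕ; _+_; _*_; _∸_; _/_; _%_; _≤_; _<_; _≡ᵇ_; _<ᵇ_; _≤ᵇ_; z≤n; NonZero; >-nonZero)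
  open import Data.Nat.DivMod
  open import Data.Nat.Divisibility using (_∣_; divides; ∣⇒≤; ∣m+n∣m⇒∣n; ∣n⇒∣m*n)
  open import Data.Nat.Properties
  open import Data.List using (List; []; _∷_; concatMap; map; length)
  open import Data.List.Relation.Unary.All as All using (All; []; _∷_)
  open import Data.List.Membership.Propositional using (find; lose)
  import Data.List.Relation.Unary.All.Properties as All
  open import Data.List.Relation.Unary.Any as Any using (Any)
  import Data.List.Relation.Unary.Any.Properties as Any
  open import Data.Product using (_×_; _,_; ∃; proj₁; proj₂)
  open import Data.Sum using (_⊎_; inj₁; inj₂)
  open import Data.Unit using (tt)
  open import Data.Vec as Vec using (Vec)
  open import Data.Vec.Properties using (lookup-map)
  open import Function using (_∘_)
  open import Relation.Binary.PropositionalEquality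
  open import Relation.Nullary using (¬_; contradiction)

  module _ (m : ℕ) .{{_ : NonZero m}} where

    %-+ˡ : ∀ a b → (a % m + b) % m ≡ (a + b) % m
    %-+ˡ a b = trans (%-distribˡ-+ (a % m) b m)
      (trans (cong (λ t → (t + b % m) % m) (m%n%n≡m%n a m)) (sym (%-distribˡ-+ a b m)))

    -- `X + i * (m ∸ d)` stands for X - id, the base part from which `X` is reached after `i` steps
    -- of length `d`.
    retract : ∀ i d X → d ≤ m → X < m → ((X + i * (m ∸ d)) % m + i * d) % m ≡ X
    retract i d X d≤m X<m = begin
      ((X + i * (m ∸ d)) % m + i * d) % m ≡⟨ %-+ˡ (X + i * (m ∸ d)) (i * d) ⟩
      (X + i * (m ∸ d) + i * d) % m       ≡⟨ cong (_% m) (trans (+-assoc X _ _) (cong (X +_) (trans (sym (*-distribˡ-+ i (m ∸ d) d)) (cong (i *_) (m∸n+n≡m d≤m))))) ⟩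
      (X + i * m) % m                     ≡⟨ [m+kn]%n≡m%n X i m ⟩
      X % m                               ≡⟨ m<n⇒m%n≡m X<m ⟩
      X                                   ∎
      where open ≡-Reasoning

    advance : ∀ x i k d X Y → (x + i * d) % m ≡ X → (X + k * d) % m ≡ Y → (x + (i + k) * d) % m ≡ Y
    advance x i k d X Y refl refl = trans (cong (λ t → (x + t) % m) (*-distribʳ-+ d i k))
      (trans (cong (_% m) (sym (+-assoc x (i * d) (k * d)))) (sym (%-+ˡ (x + i * d) (k * d))))

    record Invertible (k : ℕ) : Set where
      field
        k⁻  : ℕ
        inv : ∃ λ c → k * k⁻ ≡ 1 + c * m

    -- Solves X + ke = Y by multiplying Y - X with the inverse of `k`; `m ∸ X` replaces -X. The
    -- solution 0 would mean `X ≡ Y`.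
    difference : ∀ {k} → Invertible k → ∀ {X Y} → X < m → Y < m → X ≢ Y →
      ∃ λ e → 1 ≤ e × e < m × (X + k * e) % m ≡ Y
    difference {k} I {X} {Y} X<m Y<m X≢Y = e , nonzero , m%n<n _ m , eq
      where
      open Invertible I
      open ≡-Reasoning
      e₀ = k⁻ * (Y + (m ∸ X))
      e = e₀ % m
      %-+ʳ : ∀ a b → (a + b % m) % m ≡ (a + b) % m
      %-+ʳ a b = trans (cong (_% m) (+-comm a (b % m))) (trans (%-+ˡ b a) (cong (_% m) (+-comm b a)))
      %-*ʳ : ∀ a b → (a * (b % m)) % m ≡ (a * b) % m
      %-*ʳ a b = trans (%-distribˡ-* a (b % m) m) (trans (cong (λ t → (a % m * t) % m) (m%n%n≡m%n b m)) (sym (%-distribˡ-* a b m)))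
      c = proj₁ inv
      Z = Y + (m ∸ X)
      eq : (X + k * e) % m ≡ Y
      eq = begin
        (X + k * e) % m             ≡⟨ sym (%-+ʳ X (k * e)) ⟩
        (X + (k * e) % m) % m       ≡⟨ cong (λ t → (X + t) % m) (%-*ʳ k e₀) ⟩
        (X + (k * e₀) % m) % m      ≡⟨ %-+ʳ X (k * e₀) ⟩
        (X + k * e₀) % m            ≡⟨ cong (λ t → (X + t) % m) (trans (sym (*-assoc k k⁻ Z)) (trans (cong (_* Z) (proj₂ inv)) (cong (Z +_) (trans (*-assoc c m Z) (trans (cong (c *_) (*-comm m Z)) (sym (*-assoc c Z m))))))) ⟩
        (X + (Z + c * Z * m)) % m   ≡⟨ cong (_% m) (sym (+-assoc X Z _)) ⟩
        (X + Z + c * Z * m) % m     ≡⟨ [m+kn]%n≡m%n (X + Z) (c * Z) m ⟩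
        (X + (Y + (m ∸ X))) % m     ≡⟨ cong (_% m) (trans (sym (+-assoc X Y _)) (trans (cong (_+ (m ∸ X)) (+-comm X Y)) (trans (+-assoc Y X _) (cong (Y +_) (m+[n∸m]≡n (<⇒≤ X<m)))))) ⟩
        (Y + m) % m                 ≡⟨ [m+n]%n≡m%n Y m ⟩
        Y % m                       ≡⟨ m<n⇒m%n≡m Y<m ⟩
        Y                           ∎
      nonzero : 1 ≤ e
      nonzero = n≢0⇒n>0 λ e≡0 → X≢Y (begin
        X                 ≡⟨ sym (m<n⇒m%n≡m X<m) ⟩
        X % m             ≡⟨ cong (_% m) (sym (trans (cong (λ t → X + k * t) e≡0) (trans (cong (X +_) (*-zeroʳ k)) (+-identityʳ X)))) ⟩
        (X + k * e) % m   ≡⟨ eq ⟩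
        Y                 ∎)

    -- The two moves add up to `k * m`, that is, to `k` full turns.
    reverse : ∀ k e {X Y} → e ≤ m → X < m → (X + k * e) % m ≡ Y → (Y + k * (m ∸ e)) % m ≡ X
    reverse k e {X} e≤m X<m refl = begin
      ((X + k * e) % m + k * (m ∸ e)) % m ≡⟨ %-+ˡ (X + k * e) (k * (m ∸ e)) ⟩
      (X + k * e + k * (m ∸ e)) % m       ≡⟨ cong (_% m) (trans (+-assoc X _ _) (cong (X +_) (trans (sym (*-distribˡ-+ k e (m ∸ e))) (cong (k *_) (m+[n∸m]≡n e≤m))))) ⟩
      (X + k * m) % m                     ≡⟨ [m+kn]%n≡m%n X k m ⟩
      X % m                               ≡⟨ m<n⇒m%n≡m X<m ⟩
      X                                   ∎
      where open ≡-Reasoning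

    -- Otherwise `m` would divide kd, hence, after multiplication by the inverse of `k`, also the
    -- smaller positive number `d`. This keeps the parts x, x + d, x + 2d, x + 3d distinct.
    no-return : ∀ {k} → Invertible k → ∀ {d X} → 1 ≤ d → d < m → (X + k * d) % m ≢ X
    no-return {k} I {d} {X} 1≤d d<m eq = contradiction (∣⇒≤ {{>-nonZero 1≤d}} m∣d) (<⇒≱ d<m)
      where
      open Invertible I
      c = proj₁ inv
      m∣kd : m ∣ k * d
      m∣kd = divides ((X + k * d) / m) (+-cancelˡ-≡ X _ _ (trans (m≡m%n+[m/n]*n (X + k * d) m) (cong (_+ (X + k * d) / m * m) eq)))
      m∣d : m ∣ d
      m∣d = ∣m+n∣m⇒∣n (subst (m ∣_) eq′ (∣n⇒∣m*n k⁻ m∣kd)) (divides (c * d) refl)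
        where
        eq′ : k⁻ * (k * d) ≡ c * d * m + d
        eq′ = trans (sym (*-assoc k⁻ k d)) (trans (cong (_* d) (trans (*-comm k⁻ k) (proj₂ inv)))
          (trans (cong (d +_) (trans (*-assoc c m d) (trans (cong (c *_) (*-comm m d)) (sym (*-assoc c d m))))) (+-comm d _)))

  if-true : ∀ {A : Set} {b} {x y : A} → T b → (if b then x else y) ≡ x
  if-true {b = true} _ = refl

  if-false : ∀ {A : Set} {b} {x y : A} → ¬ T b → (if b then x else y) ≡ y
  if-false {b = true} ¬t = contradiction tt ¬t
  if-false {b = false} _ = refl

  if-cases : ∀ {A : Set} b {x y z : A} → (if b then x else y) ≡ z → (T b × x ≡ z) ⊎ (¬ T b × y ≡ z)
  if-cases true eq = inj₁ (tt , eq)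
  if-cases false eq = inj₂ ((λ ()) , eq)

  map-valid : ∀ {n n′} (f : ℕ → ℕ) → (∀ {p} → p < n → f p < n′) → (∀ {p q} → p < n → q < n → f p ≡ f q → p ≡ q) →
    ∀ {B} → Valid n B → Valid n′ (Vec.map f B)
  map-valid f f< f-inj {B} (valid bound distinct) = valid
    (λ i → subst (_< _) (sym (lookup-map i f B)) (f< (bound i)))
    (λ {i} {j} eq → distinct (f-inj (bound i) (bound j) (trans (sym (lookup-map i f B)) (trans eq (lookup-map j f B)))))

  map-joins : ∀ es (f : ℕ → ℕ) {x y B} → Joins es x y B → Joins es (f x) (f y) (Vec.map f B)
  map-joins es f {B = B} = Any.map λ
    { {e} (inj₁ (refl , refl)) → inj₁ (lookup-map (proj₁ e) f B , lookup-map (proj₂ e) f B)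
    ; {e} (inj₂ (refl , refl)) → inj₂ (lookup-map (proj₁ e) f B , lookup-map (proj₂ e) f B) }

  infix 7 _at_
  _at_ : ℕ → ℕ → ℕ
  a at X = a + X * 20

  at-% : ∀ {a} X → a < 20 → (a at X) % 20 ≡ a
  at-% {a} X a<20 = trans ([m+kn]%n≡m%n a X 20) (m<n⇒m%n≡m a<20)

  at-/ : ∀ {a} X → a < 20 → (a at X) / 20 ≡ X
  at-/ {a} X a<20 = trans (+-distrib-/-∣ʳ a (divides X refl)) (cong₂ _+_ (m<n⇒m/n≡0 a<20) (m*n/n≡m X 20))

  at-< : ∀ {a X m} → a < 20 → X < m → a at X < m * 20
  at-< {a} {X} a<20 X<m = ≤-trans (+-monoˡ-≤ (X * 20) a<20) (*-monoˡ-≤ 20 X<m)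

  at-injective : ∀ {a b X Y} → a < 20 → b < 20 → a at X ≡ b at Y → a ≡ b × X ≡ Y
  at-injective {X = X} {Y} a<20 b<20 eq = trans (sym (at-% X a<20)) (trans (cong (_% 20) eq) (at-% Y b<20)) ,
    trans (sym (at-/ X a<20)) (trans (cong (_/ 20) eq) (at-/ Y b<20))

  at-decode : ∀ p → p ≡ (p % 20) at (p / 20)
  at-decode p = m≡m%n+[m/n]*n p 20

  -- A gadget is a set of blocks on the points a at i (i < 4) and 80 + j (j < s).
  -- Replacing a at i by the point a of part x + id, for all x modulo m, yields blocks that
  -- join a in part X to b in part X + κ a b * d, and every one of the s further points to all parts.
  module Gadgets (es : Edges) (κ : ℕ → ℕ → ℕ) where

    record Gadget : Set where
      field
        s      : ℕ
        blocks : List Block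
        ok     : All (Valid (80 + s)) blocks
        joins  : ∀ {a b} → a < 20 → b < 20 →
                 Any (λ B → ∃ λ i → i + κ a b < 4 × Joins es (a at i) (b at (i + κ a b)) B) blocks
        joins∞ : ∀ {a j} → a < 20 → j < s → Any (λ B → ∃ λ i → i < 4 × Joins es (a at i) (80 + j) B) blocks
        -- There are 20 · 20 joins between points of parts and 20 · s joins to the further points,
        -- each counted in both directions.
        count  : length blocks * (length es + length es) ≤ 800 + 40 * s

    -- The join that an edge with p < q realises: (a , b) for points at the prescribed distance, and
    -- (a , 20 + j) for the further point 80 + j, whence `q ∸ 60`. The default has first coordinate
    -- 20, which is no point of a part, so other edges realise nothing.
    normalise : ℕ → ℕ → Pair
    normalise p q =
      if q <ᵇ 80 then (if p / 20 + κ (p % 20) (q % 20) ≡ᵇ q / 20 then (p % 20 , q % 20) else (20 , 0))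
      else (if p <ᵇ 80 then (p % 20 , q ∸ 60) else (20 , 0))

    link : ℕ → ℕ → Pair
    link p q = let u , v = ordered p q in normalise u v

    isGadget : ℕ → List Block → Bool
    isGadget s L = allValidᵇ (80 + s) L ∧ Check.attains es link (λ _ → range 0 (20 + s)) 20 L
      ∧ (length L * (length es + length es) ≤ᵇ 800 + 40 * s)

    private
      bad : ∀ {a b : ℕ} → a < 20 → (20 , 0) ≢ (a , b)
      bad a<20 refl = <-irrefl refl a<20

      finite : ∀ u v {a b} → a < 20 → b < 20 → normalise u v ≡ (a , b) →
               ∃ λ i → i + κ a b < 4 × u ≡ a at i × v ≡ b at (i + κ a b)
      finite u v a<20 b<20 eq with if-cases (v <ᵇ 80) eq
      ... | inj₁ (v<80 , eq′) with if-cases (u / 20 + κ (u % 20) (v % 20) ≡ᵇ v / 20) eq′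
      ...   | inj₂ (_ , eq″) = contradiction eq″ (bad a<20)
      ...   | inj₁ (t , refl) = u / 20 , subst (_< 4) (sym step) (m<n*o⇒m/o<n (<ᵇ⇒< v 80 v<80)) , at-decode u ,
              trans (at-decode v) (cong ((v % 20) at_) (sym step))
        where step = ≡ᵇ⇒≡ (u / 20 + κ (u % 20) (v % 20)) (v / 20) t
      finite u v a<20 b<20 eq | inj₂ (v≥80 , eq′) with if-cases (u <ᵇ 80) eq′
      ...   | inj₂ (_ , eq″) = contradiction eq″ (bad a<20)
      ...   | inj₁ (_ , refl) = contradiction b<20 (≤⇒≯ (∸-monoˡ-≤ {80} {v} 60 (≮⇒≥ (v≥80 ∘ <⇒<ᵇ))))

      infinite : ∀ u v {a j} → a < 20 → normalise u v ≡ (a , 20 + j) → ∃ λ i → i < 4 × u ≡ a at i × v ≡ 80 + j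
      infinite u v {a} {j} a<20 eq with if-cases (v <ᵇ 80) eq
      ... | inj₁ (v<80 , eq′) with if-cases (u / 20 + κ (u % 20) (v % 20) ≡ᵇ v / 20) eq′
      ...   | inj₂ (_ , eq″) = contradiction eq″ (bad a<20)
      ...   | inj₁ (_ , eq″) = contradiction (m%n<n v 20) (≤⇒≯ (≤-trans (m≤m+n 20 j) (≤-reflexive (sym (cong proj₂ eq″)))))
      infinite u v {a} {j} a<20 eq | inj₂ (v≥80 , eq′) with if-cases (u <ᵇ 80) eq′
      ...   | inj₂ (_ , eq″) = contradiction eq″ (bad a<20)
      ...   | inj₁ (u<80 , eq″) = u / 20 , m<n*o⇒m/o<n (<ᵇ⇒< u 80 u<80) ,
              trans (at-decode u) (cong (_at (u / 20)) (cong proj₁ eq″)) ,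
              trans (sym (m+[n∸m]≡n {60} {v} (≤-trans (m≤m+n 60 20) (≮⇒≥ (v≥80 ∘ <⇒<ᵇ))))) (cong (60 +_) (cong proj₂ eq″))

      orient : ∀ p q {P : ℕ → ℕ → Set} → P (proj₁ (ordered p q)) (proj₂ (ordered p q)) →
        (P p q) ⊎ (P q p)
      orient p q P with p <ᵇ q
      ... | true = inj₁ P
      ... | false = inj₂ P

    gadget : ∀ s L → T (isGadget s L) → Gadget
    gadget s L t = record
      { s = s ; blocks = L ; ok = allValid-sound (80 + s) L (proj₁ t₁)
      ; joins  = λ {a} {b} a<20 b<20 → Any.map (λ {B} m → joins₁ B a<20 b<20 m)
          (Check.attains-sound es link (λ _ → range 0 (20 + s)) 20 L (proj₁ t₂) a<20 (∈-range 0 (20 + s) z≤n (≤-trans b<20 (m≤m+n 20 s))))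
      ; joins∞ = λ {a} {j} a<20 j<s → Any.map (λ {B} m → joins₂ B a<20 m)
          (Check.attains-sound es link (λ _ → range 0 (20 + s)) 20 L (proj₁ t₂) a<20 (∈-range 0 (20 + s) z≤n (+-monoʳ-< 20 j<s)))
      ; count  = ≤ᵇ⇒≤ _ _ (proj₂ t₂)
      }
      where
      t₁ = ∧-split (allValidᵇ (80 + s) L) t
      t₂ = ∧-split (Check.attains es link (λ _ → range 0 (20 + s)) 20 L) (proj₂ t₁)
      joins₁ : ∀ B {a b} → a < 20 → b < 20 → Any (λ e → link (B ! proj₁ e) (B ! proj₂ e) ≡ (a , b)) es →
               ∃ λ i → i + κ a b < 4 × Joins es (a at i) (b at (i + κ a b)) B
      joins₁ B {a} {b} a<20 b<20 m with find m
      ... | e , e∈ , eq with orient (B ! proj₁ e) (B ! proj₂ e) {λ u v → ∃ λ i → i + κ a b < 4 × u ≡ a at i × v ≡ b at (i + κ a b)} (finite (proj₁ (ordered (B ! proj₁ e) (B ! proj₂ e))) (proj₂ (ordered (B ! proj₁ e) (B ! proj₂ e))) a<20 b<20 eq)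
      ...   | inj₁ (i , i< , p , q) = i , i< , lose e∈ (inj₁ (p , q))
      ...   | inj₂ (i , i< , p , q) = i , i< , lose e∈ (inj₂ (q , p))
      joins₂ : ∀ B {a j} → a < 20 → Any (λ e → link (B ! proj₁ e) (B ! proj₂ e) ≡ (a , 20 + j)) es →
               ∃ λ i → i < 4 × Joins es (a at i) (80 + j) B
      joins₂ B {a} {j} a<20 m with find m
      ... | e , e∈ , eq with orient (B ! proj₁ e) (B ! proj₂ e) {λ u v → ∃ λ i → i < 4 × u ≡ a at i × v ≡ 80 + j} (infinite (proj₁ (ordered (B ! proj₁ e) (B ! proj₂ e))) (proj₂ (ordered (B ! proj₁ e) (B ! proj₂ e))) a<20 eq)
      ...   | inj₁ (i , i< , p , q) = i , i< , lose e∈ (inj₁ (p , q))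
      ...   | inj₂ (i , i< , p , q) = i , i< , lose e∈ (inj₂ (q , p))

    total : List Gadget → ℕ
    total [] = 0
    total (g ∷ gs) = Gadget.s g + total gs

    -- The images of base blocks under `q` powers of one permutation. In its uses this rotates the
    -- four parts alike and thereby preserves a circulant `κ`.
    developed : ℕ → Cycles → List Block → List Block
    developed q cs L = concatMap (λ s → map (Vec.map (shift cs s)) L) (range 0 q)

-- Composing gadgets, parts and hole

module Composition where

  open Coverings
  open Gadgetry
  open import Data.Bool using (if_then_else_)
  open import Data.Nat using (ℕ; zero; suc; _+_; _*_; _∸_; _/_; _%_; _≤_; _<_; _<ᵇ_; s≤s; z≤n; NonZero)
  open import Data.Nat.DivMod
  open import Data.Nat.Properties
  open import Data.List using (List; []; _∷_; _++_; concatMap; map; length; replicate)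
  open import Data.List.Properties using (length-map; length-++; length-replicate)
  open import Data.List.Membership.Propositional using (_∈_; find; lose)
  open import Data.List.Relation.Unary.All as All using (All; []; _∷_)
  import Data.List.Relation.Unary.All.Properties as All
  open import Data.List.Relation.Unary.Any as Any using (Any; here; there)
  import Data.List.Relation.Unary.Any.Properties as Any
  open import Data.Nat.Solver using (module +-*-Solver)
  open import Data.Product using (_,_; proj₁)
  open import Data.Sum using (inj₁; inj₂)
  open import Data.Vec as Vec using (Vec)
  open import Function using (_∘_)
  open import Relation.Binary using (tri<; tri≈; tri>)
  open import Relation.Binary.PropositionalEquality
  open import Relation.Nullary using (yes; no; contradiction)

  concatMap-All : ∀ {A B : Set} {P : B → Set} (f : A → List B) xs → (∀ {x} → x ∈ xs → All P (f x)) → All P (concatMap f xs)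
  concatMap-All f [] _ = []
  concatMap-All f (x ∷ xs) h = All.++⁺ (h (here refl)) (concatMap-All f xs (h ∘ there))

  concatMap-length : ∀ {A B : Set} (f : A → List B) xs k → (∀ x → length (f x) ≡ k) → length (concatMap f xs) ≡ length xs * k
  concatMap-length f [] k h = refl
  concatMap-length f (x ∷ xs) k h = trans (length-++ (f x)) (cong₂ _+_ (h x) (concatMap-length f xs k h))

  range-length : ∀ s k → length (range s k) ≡ k
  range-length s zero = refl
  range-length s (suc k) = cong suc (range-length (suc s) k)

  range-< : ∀ {x} s k → x ∈ range s k → x < s + k
  range-< s (suc k) (here refl) = ≤-trans (≤-reflexive (sym (+-comm s 1))) (+-monoʳ-≤ s (s≤s z≤n))
  range-< s (suc k) (there x∈) = ≤-trans (range-< (suc s) k x∈) (≤-reflexive (sym (+-suc s k)))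

  -- Adding `n` turns the bound with truncated subtraction into one by a square, so that the
  -- counting becomes an identity in a semiring.
  cancel-pred : ∀ x n → x + n ≤ n * n → x ≤ n * (n ∸ 1)
  cancel-pred x zero p = ≤-trans (m≤m+n x 0) p
  cancel-pred x (suc k) p = +-cancelʳ-≤ (suc k) x (suc k * k) (≤-trans p (≤-reflexive
    (trans (*-suc (suc k) k) (+-comm (suc k) (suc k * k)))))

  square-pred : ∀ n → n * (n ∸ 1) + n ≡ n * n
  square-pred zero = refl
  square-pred (suc k) = trans (+-comm (suc k * k) (suc k)) (sym (*-suc (suc k) k))

  record Steps (κ : ℕ → ℕ → ℕ) : Set where
    field
      lower : ∀ {a b} → a < 20 → b < 20 → 1 ≤ κ a b
      upper : ∀ {a b} → a < 20 → b < 20 → κ a b ≤ 3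
      symm  : ∀ {a b} → a < 20 → b < 20 → κ a b ≡ κ b a

  module Compose (es : Edges) (κ : ℕ → ℕ → ℕ) (steps : Steps κ)
                 (D : ℕ) (inverses : ∀ k → 1 ≤ k → k ≤ 3 → Invertible (suc (D + D)) k) where

    m : ℕ
    m = suc (D + D)

    open Gadgets es κ
    open Gadget

    -- The `m` parts are numbered before the hole, which starts at `m * 20`. The points from 20 on
    -- are shared by all parts and become the first points of the hole.
    place : ℕ → ℕ → ℕ
    place x p = if p <ᵇ 20 then p at x else (p ∸ 20) + m * 20

    -- `off` is the number of hole points already taken, by the shared points and by the gadgets of
    -- smaller differences.
    spread : ℕ → ℕ → ℕ → ℕ → ℕ
    spread off d x p = if p <ᵇ 80 then (p % 20) at ((x + p / 20 * d) % m) else (p ∸ 80) + off + m * 20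

    place-in : ∀ {x a} → a < 20 → place x a ≡ a at x
    place-in {a = a} a<20 = if-true {b = a <ᵇ 20} (<⇒<ᵇ {a} {20} a<20)

    place-out : ∀ {x} r → place x (20 + r) ≡ r + m * 20
    place-out {x} r = trans (if-false {b = 20 + r <ᵇ 20} {(20 + r) at x} {20 + r ∸ 20 + m * 20} (λ t → <⇒≱ (<ᵇ⇒< (20 + r) 20 t) (m≤m+n 20 r))) (cong (_+ m * 20) (m+n∸m≡n 20 r))

    spread-in : ∀ {off d x a i} → a < 20 → i < 4 → spread off d x (a at i) ≡ a at ((x + i * d) % m)
    spread-in {off} {d} {x} {a} {i} a<20 i<4 = trans (if-true {b = a at i <ᵇ 80} (<⇒<ᵇ {a at i} {80} (at-< a<20 i<4)))
      (cong₂ (λ u v → u at ((x + v * d) % m)) (at-% i a<20) (at-/ i a<20))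

    spread-out : ∀ {off d x} j → spread off d x (80 + j) ≡ j + off + m * 20
    spread-out {off} {d} {x} j = trans (if-false {b = 80 + j <ᵇ 80} {((80 + j) % 20) at ((x + (80 + j) / 20 * d) % m)} {80 + j ∸ 80 + off + m * 20} (λ t → <⇒≱ (<ᵇ⇒< (80 + j) 80 t) (m≤m+n 80 j))) (cong (λ t → t + off + m * 20) (m+n∸m≡n 80 j))

    data Position (w : ℕ) : ℕ → Set where
      inside  : ∀ {a i} → a < 20 → i < w → Position w (a at i)
      outside : ∀ j → Position w (w * 20 + j)

    position : ∀ w p → Position w p
    position w p with p <? w * 20
    ... | yes p< = subst (Position w) (sym (at-decode p)) (inside (m%n<n p 20) (m<n*o⇒m/o<n p<))
    ... | no p≮ = subst (Position w) (m+[n∸m]≡n (≮⇒≥ p≮)) (outside (p ∸ w * 20))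

    clash : ∀ {a X j} → a < 20 → X < m → a at X ≢ j + m * 20
    clash {j = j} a<20 X<m eq = <⇒≱ (at-< a<20 X<m) (≤-trans (m≤n+m (m * 20) j) (≤-reflexive (sym eq)))

    module _ {off s h d x : ℕ} (off+s≤h : off + s ≤ h) (1≤d : 1 ≤ d) (d<m : d < m) where

      spread-< : ∀ {p} → p < 80 + s → spread off d x p < h + m * 20
      spread-< {p} p< with position 4 p
      ... | inside {a} {i} a<20 i<4 = subst (_< h + m * 20) (sym (spread-in {off} {d} {x} a<20 i<4))
        (≤-trans (at-< a<20 (m%n<n (x + i * d) m)) (m≤n+m (m * 20) h))
      ... | outside j = subst (_< h + m * 20) (sym (spread-out {off} {d} {x} j))
        (+-monoˡ-< (m * 20) (≤-trans (≤-trans (+-monoˡ-< off (+-cancelˡ-< 80 j s p<)) (≤-reflexive (+-comm s off))) off+s≤h))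

      -- Two indices below 4 differ by 1, 2 or 3, and these are invertible modulo `m`.
      collide : ∀ {i i′} → i′ < 4 → i < i′ → (x + i * d) % m ≢ (x + i′ * d) % m
      collide {i} {i′} i′<4 i<i′ eq = no-return m (inverses (i′ ∸ i) (m<n⇒0<n∸m i<i′) (≤-trans (m∸n≤m i′ i) (≤-pred i′<4))) 1≤d d<m
        (trans (trans (%-+ˡ m (x + i * d) ((i′ ∸ i) * d)) (cong (_% m) (trans (+-assoc x _ _)
          (cong (x +_) (trans (sym (*-distribʳ-+ d i (i′ ∸ i))) (cong (_* d) (m+[n∸m]≡n (<⇒≤ i<i′)))))))) (sym eq))

      spread-injective : ∀ {p q} → p < 80 + s → q < 80 + s → spread off d x p ≡ spread off d x q → p ≡ q
      spread-injective {p} {q} p< q< eq with position 4 p | position 4 q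
      ... | inside {a} {i} a<20 i<4 | inside {b} {i′} b<20 i′<4
        with at-injective a<20 b<20 (trans (sym (spread-in {off} {d} {x} a<20 i<4)) (trans eq (spread-in {off} {d} {x} b<20 i′<4)))
      ...   | refl , same with <-cmp i i′
      ...     | tri< i<i′ _ _ = contradiction same (collide i′<4 i<i′)
      ...     | tri≈ _ refl _ = refl
      ...     | tri> _ _ i′<i = contradiction (sym same) (collide i<4 i′<i)
      spread-injective p< q< eq | inside {a} {i} a<20 i<4 | outside j =
        contradiction (trans (sym (spread-in {off} {d} {x} a<20 i<4)) (trans eq (spread-out {off} {d} {x} j))) (clash a<20 (m%n<n (x + i * d) m))
      spread-injective p< q< eq | outside j | inside {a} {i} a<20 i<4 =
        contradiction (trans (sym (spread-in {off} {d} {x} a<20 i<4)) (trans (sym eq) (spread-out {off} {d} {x} j))) (clash a<20 (m%n<n (x + i * d) m))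
      spread-injective p< q< eq | outside j | outside j′ = cong (80 +_) (+-cancelʳ-≡ off j j′ (+-cancelʳ-≡ (m * 20) (j + off) (j′ + off)
        (trans (sym (spread-out {off} {d} {x} j)) (trans eq (spread-out {off} {d} {x} j′)))))

    module _ {h R x : ℕ} (R≤h : R ≤ h) (x<m : x < m) where

      place-< : ∀ {p} → p < 20 + R → place x p < h + m * 20
      place-< {p} p< with position 1 p
      ... | inside {a} {zero} a<20 _ = subst (λ t → place x t < h + m * 20) (sym (+-identityʳ a))
        (subst (_< h + m * 20) (sym (place-in {x} a<20)) (≤-trans (at-< a<20 x<m) (m≤n+m (m * 20) h)))
      ... | inside {a} {suc _} _ (s≤s ())
      ... | outside r = subst (_< h + m * 20) (sym (place-out {x} r)) (+-monoˡ-< (m * 20) (≤-trans (+-cancelˡ-< 20 r R p<) R≤h))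

      place-injective : ∀ {p q} → p < 20 + R → q < 20 + R → place x p ≡ place x q → p ≡ q
      place-injective {p} {q} p< q< eq with position 1 p | position 1 q
      ... | inside {_} {suc _} _ (s≤s ()) | _
      ... | _ | inside {_} {suc _} _ (s≤s ())
      ... | inside {a} {zero} a<20 _ | inside {b} {zero} b<20 _ = cong (_+ 0) (proj₁ (at-injective {X = x} {x} a<20 b<20 (trans (sym (pl a a<20)) (trans eq (pl b b<20)))))
        where pl : ∀ a → a < 20 → place x (a + 0) ≡ a at x
              pl a a<20 = trans (cong (place x) (+-identityʳ a)) (place-in {x} a<20)
      ... | inside {a} {zero} a<20 _ | outside r = contradiction (trans (sym (trans (cong (place x) (+-identityʳ a)) (place-in {x} a<20))) (trans eq (place-out {x} r))) (clash a<20 x<m)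
      ... | outside r | inside {a} {zero} a<20 _ = contradiction (trans (sym (trans (cong (place x) (+-identityʳ a)) (place-in {x} a<20))) (trans (sym eq) (place-out {x} r))) (clash a<20 x<m)
      ... | outside r | outside r′ = cong (20 +_) (+-cancelʳ-≡ (m * 20) r r′ (trans (sym (place-out {x} r)) (trans eq (place-out {x} r′))))

    -- Successive gadgets of the list serve successive differences, and their further points occupy
    -- successive intervals of the hole.
    classBlocks : ℕ → ℕ → List Gadget → List Block
    classBlocks off d [] = []
    classBlocks off d (g ∷ gs) = concatMap (λ x → map (Vec.map (spread off d x)) (blocks g)) (range 0 m)
      ++ classBlocks (off + s g) (suc d) gs

    class-ok : ∀ h gs off d → off + total gs ≤ h → 1 ≤ d → d + length gs ≤ m → All (Valid (h + m * 20)) (classBlocks off d gs)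
    class-ok h [] off d _ _ _ = []
    class-ok h (g ∷ gs) off d off≤ 1≤d d≤ = All.++⁺
      (concatMap-All _ (range 0 m) λ {x} _ → All.map⁺ (All.map (λ {B} → map-valid (spread off d x)
        (spread-< {off} {s g} {h} {d} {x} off+s≤h 1≤d d<m) (spread-injective {off} {s g} {h} {d} {x} off+s≤h 1≤d d<m) {B}) (ok g)))
      (class-ok h gs (off + s g) (suc d) (≤-trans (≤-reflexive (+-assoc off (s g) (total gs))) off≤) (s≤s z≤n)
        (≤-trans (≤-reflexive (sym (+-suc d (length gs)))) d≤))
      where
      off+s≤h : off + s g ≤ h
      off+s≤h = ≤-trans (+-monoʳ-≤ off (m≤m+n (s g) (total gs))) off≤
      d<m : d < m
      d<m = ≤-trans (≤-trans (≤-reflexive (sym (+-comm d 1))) (+-monoʳ-≤ d (s≤s z≤n))) d≤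

    ∈-parts : ∀ {X} → X < m → X ∈ range 0 m
    ∈-parts = ∈-range 0 m z≤n

    -- The gadget of difference `e` joins `a` at some index `i` to `b` at index `i + κ a b`. Its
    -- copy based at part X - ie has these indices in the parts `X` and `Y`.
    class-pair : ∀ gs off d {e a b X Y} → d ≤ e → e < d + length gs → e ≤ m → a < 20 → b < 20 → X < m →
      (X + κ a b * e) % m ≡ Y → Covers es (classBlocks off d gs) (a at X) (b at Y)
    class-pair [] off d d≤e e<d _ _ _ _ _ = contradiction (≤-trans e<d (≤-reflexive (+-identityʳ d))) (≤⇒≯ d≤e)
    class-pair (g ∷ gs) off d {e} {a} {b} {X} {Y} d≤e e<d e≤m a<20 b<20 X<m eq with m≤n⇒m<n∨m≡n d≤e
    ... | inj₁ d<e = Any.++⁺ʳ (concatMap (λ x → map (Vec.map (spread off d x)) (blocks g)) (range 0 m))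
      (class-pair gs (off + s g) (suc d) d<e (≤-trans e<d (≤-reflexive (+-suc d (length gs)))) e≤m a<20 b<20 X<m eq)
    ... | inj₂ refl with find (joins g a<20 b<20)
    ...   | B , B∈ , i , i+κ<4 , J = Any.++⁺ˡ (Any.concatMap⁺ (λ x → map (Vec.map (spread off d x)) (blocks g))
        (lose {x = x} (∈-parts {x} (m%n<n (X + i * (m ∸ d)) m)) (Any.map⁺ (lose {x = B} B∈
          (subst₂ (λ u v → Joins es u v (Vec.map (spread off d x) B))
            (trans (spread-in {off} {d} {x} a<20 (≤-trans (s≤s (m≤m+n i (κ a b))) i+κ<4)) (cong (a at_) back))
            (trans (spread-in {off} {d} {x} b<20 i+κ<4) (cong (b at_) (advance m x i (κ a b) d X Y back eq)))
            (map-joins es (spread off d x) {B = B} J))))))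
      where
      x = (X + i * (m ∸ d)) % m
      back : (x + i * d) % m ≡ X
      back = retract m i d X e≤m X<m

    class-hole : ∀ gs off d {a X j} → d + length gs ≤ m → a < 20 → X < m → off ≤ j → j < off + total gs →
      Covers es (classBlocks off d gs) (a at X) (j + m * 20)
    class-hole [] off d _ _ _ off≤j j< = contradiction (≤-trans j< (≤-reflexive (+-identityʳ off))) (≤⇒≯ off≤j)
    class-hole (g ∷ gs) off d {a} {X} {j} d≤ a<20 X<m off≤j j< with j <? off + s g
    ... | no j≮ = Any.++⁺ʳ (concatMap (λ x → map (Vec.map (spread off d x)) (blocks g)) (range 0 m))
      (class-hole gs (off + s g) (suc d) (≤-trans (≤-reflexive (sym (+-suc d (length gs)))) d≤) a<20 X<m (≮⇒≥ j≮)
        (≤-trans j< (≤-reflexive (sym (+-assoc off (s g) (total gs))))))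
    ... | yes j<s with find (joins∞ g a<20 (+-cancelˡ-< off (j ∸ off) (s g) (≤-trans (≤-reflexive (cong suc (m+[n∸m]≡n off≤j))) j<s)))
    ...   | B , B∈ , i , i<4 , J = Any.++⁺ˡ (Any.concatMap⁺ (λ x → map (Vec.map (spread off d x)) (blocks g))
        (lose {x = x} (∈-parts {x} (m%n<n (X + i * (m ∸ d)) m)) (Any.map⁺ (lose {x = B} B∈
          (subst₂ (λ u v → Joins es u v (Vec.map (spread off d x) B))
            (trans (spread-in {off} {d} {x} a<20 i<4) (cong (a at_) (retract m i d X d≤m X<m)))
            (trans (spread-out {off} {d} {x} (j ∸ off)) (cong (_+ m * 20) (m∸n+n≡m off≤j)))
            (map-joins es (spread off d x) {B = B} J))))))
      where
      x = (X + i * (m ∸ d)) % m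
      d≤m : d ≤ m
      d≤m = ≤-trans (m≤m+n d _) d≤

    private
      A = length es + length es

    class-count : ∀ gs off d → length (classBlocks off d gs) * A ≤ m * (length gs * 800 + 40 * total gs)
    class-count [] off d = z≤n
    class-count (g ∷ gs) off d = begin
      length (classBlocks off d (g ∷ gs)) * A
        ≡⟨ cong (_* A) (trans (length-++ (concatMap (λ x → map (Vec.map (spread off d x)) (blocks g)) (range 0 m)))
             (cong (_+ length (classBlocks (off + s g) (suc d) gs)) (trans (concatMap-length (λ x → map (Vec.map (spread off d x)) (blocks g)) (range 0 m) (length (blocks g))
               (λ x → length-map (Vec.map (spread off d x)) (blocks g))) (cong (_* length (blocks g)) (range-length 0 m))))) ⟩
      (m * length (blocks g) + length (classBlocks (off + s g) (suc d) gs)) * A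
        ≡⟨ trans (*-distribʳ-+ A (m * length (blocks g)) _) (cong (_+ length (classBlocks (off + s g) (suc d) gs) * A) (*-assoc m (length (blocks g)) A)) ⟩
      m * (length (blocks g) * A) + length (classBlocks (off + s g) (suc d) gs) * A
        ≤⟨ +-mono-≤ (*-monoʳ-≤ m (count g)) (class-count gs (off + s g) (suc d)) ⟩
      m * (800 + 40 * s g) + m * (length gs * 800 + 40 * total gs)
        ≡⟨ trans (sym (*-distribˡ-+ m (800 + 40 * s g) (length gs * 800 + 40 * total gs)))
             (cong (m *_) {800 + 40 * s g + (length gs * 800 + 40 * total gs)} {length (g ∷ gs) * 800 + 40 * total (g ∷ gs)} (solve 3 (λ x l t → con 800 :+ con 40 :* x :+ (l :* con 800 :+ con 40 :* t)
             := con 800 :+ l :* con 800 :+ con 40 :* (x :+ t)) refl (s g) (length gs) (total gs))) ⟩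
      m * (length (g ∷ gs) * 800 + 40 * total (g ∷ gs)) ∎
      where
      open ≤-Reasoning
      open +-*-Solver

    -- `H` covers a part and its joins to the `R` shared points, and `S` covers the hole. The bound
    -- 380 + 40R is (20 + R)(19 + R) - R(R - 1), the bound in `few` with the subtraction carried
    -- out.
    module _ {R h : ℕ} (H : Covering es 20 (20 + R)) (H-count : length (Covering.blocks H) * A ≤ 380 + 40 * R)
             (gs : List Gadget) (gs-length : length gs ≡ D) (h≡ : R + total gs ≡ h) (S : Covering es h h) where

      open Covering

      private
        N = h + m * 20

        R≤h : R ≤ h
        R≤h = ≤-trans (m≤m+n R (total gs)) (≤-reflexive h≡)

        holeBlocks partBlocks allBlocks : List Block
        holeBlocks = map (Vec.map (_+ m * 20)) (blocks S)
        partBlocks = concatMap (λ x → map (Vec.map (place x)) (blocks H)) (range 0 m)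
        allBlocks = holeBlocks ++ partBlocks ++ classBlocks R 1 gs

        gs≤m : 1 + length gs ≤ m
        gs≤m = s≤s (≤-trans (≤-reflexive gs-length) (m≤m+n D D))

        allValid : All (Valid N) allBlocks
        allValid = All.++⁺ (All.map⁺ (All.map (λ {B} → map-valid (_+ m * 20) (+-monoˡ-< (m * 20)) (λ {p} {q} _ _ → +-cancelʳ-≡ (m * 20) p q) {B}) (ok S)))
          (All.++⁺ (concatMap-All _ (range 0 m) λ {x} x∈ → All.map⁺ (All.map (λ {B} →
              map-valid (place x) (place-< {h} {R} {x} R≤h (range-< 0 m x∈)) (place-injective {h} {R} {x} R≤h (range-< 0 m x∈)) {B}) (ok H)))
            (class-ok h gs R 1 (≤-reflexive h≡) (s≤s z≤n) gs≤m))

        flip : ∀ {L x y} → Covers es L x y → Covers es L y x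
        flip {x = x} {y} = Any.map λ {B} → Joins-sym {es} {x} {y} {B}

        in-hole : ∀ {x y} → Covers es holeBlocks x y → Covers es allBlocks x y
        in-hole = Any.++⁺ˡ

        in-part : ∀ {x y} → Covers es partBlocks x y → Covers es allBlocks x y
        in-part c = Any.++⁺ʳ holeBlocks (Any.++⁺ˡ c)

        in-class : ∀ {x y} → Covers es (classBlocks R 1 gs) x y → Covers es allBlocks x y
        in-class c = Any.++⁺ʳ holeBlocks (Any.++⁺ʳ partBlocks c)

        part-cover : ∀ {X p q} → X < m → p < 20 → p < q → q < 20 + R → Covers es partBlocks (place X p) (place X q)
        part-cover {X} X<m p<20 p<q q< = Any.concatMap⁺ (λ x → map (Vec.map (place x)) (blocks H))
          (lose {x = X} (∈-parts X<m) (Any.map⁺ (Any.map (λ {B} → map-joins es (place X) {B = B}) (covers H p<20 p<q q<))))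

        same-part : ∀ {X a b} → X < m → a < b → b < 20 → Covers es allBlocks (a at X) (b at X)
        same-part {X} {a} {b} X<m a<b b<20 = in-part (subst₂ (Covers es partBlocks) (place-in {X} (<-trans a<b b<20)) (place-in {X} b<20)
          (part-cover X<m (<-trans a<b b<20) a<b (≤-trans b<20 (m≤m+n 20 R))))

        -- Seen from the other part, the difference `e` becomes `m ∸ e`, and exactly one of the two
        -- is at most `D`. The exchange of `a` and `b` is possible because `κ` is symmetric.
        distinct-parts : ∀ {X Y a b} → X < m → Y < m → X ≢ Y → a < 20 → b < 20 → Covers es allBlocks (a at X) (b at Y)
        distinct-parts {X} {Y} {a} {b} X<m Y<m X≢Y a<20 b<20
          with difference m (inverses (κ a b) (Steps.lower steps a<20 b<20) (Steps.upper steps a<20 b<20)) X<m Y<m X≢Y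
        ... | e , 1≤e , e<m , eq with e ≤? D
        ...   | yes e≤D = in-class (class-pair gs R 1 1≤e (s≤s (≤-trans e≤D (≤-reflexive (sym gs-length)))) (<⇒≤ e<m) a<20 b<20 X<m eq)
        ...   | no e≰D = in-class (flip (class-pair gs R 1 {m ∸ e} (m<n⇒0<n∸m e<m)
                  (s≤s (≤-trans (≤-trans (∸-monoʳ-≤ m (≰⇒> e≰D)) (≤-reflexive (m+n∸m≡n D D))) (≤-reflexive (sym gs-length))))
                  (m∸n≤m m e) b<20 a<20 Y<m
                  (subst (λ k → (Y + k * (m ∸ e)) % m ≡ X) (Steps.symm steps a<20 b<20) (reverse m (κ a b) e (<⇒≤ e<m) X<m eq))))

        part-hole : ∀ {X a j} → X < m → a < 20 → j < h → Covers es allBlocks (a at X) (j + m * 20)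
        part-hole {X} {a} {j} X<m a<20 j<h with j <? R
        ... | yes j<R = in-part (subst₂ (Covers es partBlocks) (place-in {X} a<20) (place-out {X} j)
                (part-cover X<m a<20 (≤-trans a<20 (m≤m+n 20 j)) (+-monoʳ-< 20 j<R)))
        ... | no j≮R = in-class (class-hole gs R 1 gs≤m a<20 X<m (≮⇒≥ j≮R) (≤-trans j<h (≤-reflexive (sym h≡))))

        hole-cover : ∀ {i j} → i < j → j < h → Covers es allBlocks (i + m * 20) (j + m * 20)
        hole-cover i<j j<h = in-hole (Any.map⁺ (Any.map (λ {B} → map-joins es (_+ m * 20) {B = B}) (covers S (<-trans i<j j<h) i<j j<h)))

        hole-< : ∀ {j} → m * 20 + j < N → j < h
        hole-< {j} p = +-cancelˡ-< (m * 20) j h (≤-trans p (≤-reflexive (+-comm h (m * 20))))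

        all-covered : ∀ {p q} → p < q → q < N → Covers es allBlocks p q
        all-covered {p} {q} p<q q<N with position m p | position m q
        ... | inside {a} {X} a<20 X<m | inside {b} {Y} b<20 Y<m with X ≟ Y
        ...   | yes refl = same-part X<m (+-cancelʳ-< (X * 20) a b p<q) b<20
        ...   | no X≢Y = distinct-parts X<m Y<m X≢Y a<20 b<20
        all-covered {p} {q} p<q q<N | inside {a} {X} a<20 X<m | outside j =
          subst (Covers es allBlocks (a at X)) (+-comm j (m * 20)) (part-hole X<m a<20 (hole-< q<N))
        all-covered {p} {q} p<q q<N | outside i | inside {b} {Y} b<20 Y<m =
          contradiction (<-trans p<q (at-< b<20 Y<m)) (≤⇒≯ (m≤m+n (m * 20) i))
        all-covered {p} {q} p<q q<N | outside i | outside j = subst₂ (Covers es allBlocks) (+-comm i (m * 20)) (+-comm j (m * 20))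
          (hole-cover (+-cancelˡ-< (m * 20) i j p<q) (hole-< q<N))

        S-count : length (blocks S) * A ≤ h * (h ∸ 1)
        S-count = ≤-trans (m≤m+n _ _) (few S)

        enough : length allBlocks * A ≤ N * (N ∸ 1)
        enough = cancel-pred (length allBlocks * A) N (begin
          length allBlocks * A + N
            ≡⟨ cong (λ l → l * A + N) (trans (length-++ holeBlocks) (cong₂ _+_ (length-map _ (blocks S)) (trans (length-++ partBlocks)
                 (cong (_+ length (classBlocks R 1 gs)) (trans (concatMap-length (λ x → map (Vec.map (place x)) (blocks H)) (range 0 m) (length (blocks H)) (λ x → length-map (Vec.map (place x)) (blocks H)))
                   (cong (_* length (blocks H)) (range-length 0 m))))))) ⟩
          (length (blocks S) + (m * length (blocks H) + length (classBlocks R 1 gs))) * A + N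
            ≡⟨ +-*-Solver.solve 6 (λ a b c x y z → (a :+ (x :* b :+ c)) :* y :+ z := a :* y :+ (x :* (b :* y) :+ c :* y) :+ z) refl
                 (length (blocks S)) (length (blocks H)) (length (classBlocks R 1 gs)) m A N ⟩
          length (blocks S) * A + (m * (length (blocks H) * A) + length (classBlocks R 1 gs) * A) + N
            ≤⟨ +-monoˡ-≤ N (+-mono-≤ S-count (+-mono-≤ (*-monoʳ-≤ m H-count) (class-count gs R 1))) ⟩
          h * (h ∸ 1) + (m * (380 + 40 * R) + m * (length gs * 800 + 40 * total gs)) + N
            ≡⟨ cong (λ l → h * (h ∸ 1) + (m * (380 + 40 * R) + m * (l * 800 + 40 * total gs)) + N) {length gs} {D} gs-length ⟩
          h * (h ∸ 1) + (m * (380 + 40 * R) + m * (D * 800 + 40 * total gs)) + (h + m * 20)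
            ≡⟨ cong (λ t → h * (h ∸ 1) + (m * (380 + 40 * R) + m * (D * 800 + 40 * total gs)) + (t + m * 20)) (sym h≡) ⟩
          h * (h ∸ 1) + (m * (380 + 40 * R) + m * (D * 800 + 40 * total gs)) + ((R + total gs) + m * 20)
            -- One factor `m` stays a variable, the other is expanded as 1 + (D + D): the summands
            -- 380, 800D and 20 make up 400m. Thus the blocks of the three kinds have no more arcs
            -- than there are ordered pairs.
            ≡⟨ +-*-Solver.solve 5 (λ q x r d t → q :+ (x :* (con 380 :+ con 40 :* r) :+ x :* (d :* con 800 :+ con 40 :* t)) :+ ((r :+ t) :+ x :* con 20)
                 := (q :+ (r :+ t)) :+ x :* (con 400 :* (con 1 :+ (d :+ d)) :+ con 40 :* (r :+ t))) refl (h * (h ∸ 1)) m R D (total gs) ⟩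
          h * (h ∸ 1) + (R + total gs) + m * (400 * m + 40 * (R + total gs))
            ≡⟨ cong (λ t → h * (h ∸ 1) + t + m * (400 * m + 40 * t)) h≡ ⟩
          h * (h ∸ 1) + h + m * (400 * m + 40 * h)
            ≡⟨ cong (_+ m * (400 * m + 40 * h)) (square-pred h) ⟩
          h * h + m * (400 * m + 40 * h)
            ≡⟨ +-*-Solver.solve 2 (λ a x → a :* a :+ x :* (con 400 :* x :+ con 40 :* a) := (a :+ x :* con 20) :* (a :+ x :* con 20)) refl h m ⟩
          N * N ∎)
          where
          open ≤-Reasoning
          open +-*-Solver using (_:+_; _:*_; _:=_; con)

      compose : Covering es N N
      compose = record
        { blocks = allBlocks
        ; ok     = allValid
        ; covers = λ _ → all-covered
        ; few    = ≤-trans (≤-reflexive (trans (cong (λ t → length allBlocks * A + t * (t ∸ 1)) (n∸n≡0 N)) (+-identityʳ _))) enough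
        }

  %-inverse : ∀ {m} k⁻ c {k} → k * k⁻ ≡ 1 + c * m → .{{_ : NonZero m}} → Invertible m k
  %-inverse k⁻ c eq = record { k⁻ = k⁻ ; inv = c , eq }

  -- With m = 5 + 6w: 2(3 + 3w) = 1 + m = 3(2 + 2w).
  inverses₅ : ∀ w k → 1 ≤ k → k ≤ 3 → Invertible (suc ((2 + w * 3) + (2 + w * 3))) k
  inverses₅ w 1 _ _ = %-inverse 1 0 refl
  inverses₅ w 2 _ _ = %-inverse (3 + w * 3) 1 (solve 1 (λ w → con 2 :* (con 3 :+ w :* con 3) := con 1 :+ con 1 :* (con 1 :+ ((con 2 :+ w :* con 3) :+ (con 2 :+ w :* con 3)))) refl w)
    where open +-*-Solver
  inverses₅ w 3 _ _ = %-inverse (2 + w * 2) 1 (solve 1 (λ w → con 3 :* (con 2 :+ w :* con 2) := con 1 :+ con 1 :* (con 1 :+ ((con 2 :+ w :* con 3) :+ (con 2 :+ w :* con 3)))) refl w)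
    where open +-*-Solver
  inverses₅ w (suc (suc (suc (suc k)))) _ (s≤s (s≤s (s≤s ())))

  -- With m = 7 + 6w: 2(4 + 3w) = 1 + m and 3(5 + 4w) = 1 + 2m.
  inverses₇ : ∀ w k → 1 ≤ k → k ≤ 3 → Invertible (suc ((3 + w * 3) + (3 + w * 3))) k
  inverses₇ w 1 _ _ = %-inverse 1 0 refl
  inverses₇ w 2 _ _ = %-inverse (4 + w * 3) 1 (solve 1 (λ w → con 2 :* (con 4 :+ w :* con 3) := con 1 :+ con 1 :* (con 1 :+ ((con 3 :+ w :* con 3) :+ (con 3 :+ w :* con 3)))) refl w)
    where open +-*-Solver
  inverses₇ w 3 _ _ = %-inverse (5 + w * 4) 2 (solve 1 (λ w → con 3 :* (con 5 :+ w :* con 4) := con 1 :+ con 2 :* (con 1 :+ ((con 3 :+ w :* con 3) :+ (con 3 :+ w :* con 3)))) refl w)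
    where open +-*-Solver
  inverses₇ w (suc (suc (suc (suc k)))) _ (s≤s (s≤s (s≤s ())))

  module Families (es : Edges) (κ : ℕ → ℕ → ℕ) (steps : Steps κ)
                  (plain : Gadgets.Gadget es κ) (s≡0 : Gadgets.Gadget.s plain ≡ 0) where

    open Gadgets es κ

    private
      total-plain : ∀ gs k → total (gs ++ replicate k plain) ≡ total gs
      total-plain [] zero = refl
      total-plain [] (suc k) = cong₂ _+_ s≡0 (total-plain [] k)
      total-plain (g ∷ gs) k = cong (Gadget.s g +_) (total-plain gs k)

      -- The differences left over by `gs` receive `plain`, which touches no hole point. So one list
      -- `gs` serves every `D` that is at least its length.
      scheme : ∀ D → (∀ k → 1 ≤ k → k ≤ 3 → Invertible (suc (D + D)) k) → ∀ {R h} (H : Covering es 20 (20 + R)) →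
        length (Covering.blocks H) * (length es + length es) ≤ 380 + 40 * R → ∀ gs → length gs ≤ D → R + total gs ≡ h →
        Covering es h h → Covering es (h + suc (D + D) * 20) (h + suc (D + D) * 20)
      scheme D inverses {R} H H-count gs gs≤D eq = Compose.compose es κ steps D inverses H H-count (gs ++ replicate (D ∸ length gs) plain)
        (trans (length-++ gs) (trans (cong (length gs +_) (length-replicate (D ∸ length gs))) (m+[n∸m]≡n gs≤D)))
        (trans (cong (R +_) (total-plain gs (D ∸ length gs))) eq)

    module Inner {R : ℕ} (H : Covering es 20 (20 + R))
                 (H-count : length (Covering.blocks H) * (length es + length es) ≤ 380 + 40 * R) where

      -- c + 5 + 6w parts of which c are replaced, together with the r further points, by the hole.
      family₅ : ∀ r c gs → R + total gs ≡ r + c * 20 → Covering es (r + c * 20) (r + c * 20) → ∀ w → length gs ≤ 2 + w * 3 →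
        Covering es (r + (c + (5 + w * 6)) * 20) (r + (c + (5 + w * 6)) * 20)
      family₅ r c gs eq S w gs≤ = subst (λ n → Covering es n n) (sym (solve 3 (λ r c w →
        r :+ (c :+ (con 5 :+ w :* con 6)) :* con 20 := (r :+ c :* con 20) :+ (con 1 :+ ((con 2 :+ w :* con 3) :+ (con 2 :+ w :* con 3))) :* con 20) refl r c w))
        (scheme (2 + w * 3) (inverses₅ w) H H-count gs gs≤ eq S)
        where open +-*-Solver

      family₇ : ∀ r c gs → R + total gs ≡ r + c * 20 → Covering es (r + c * 20) (r + c * 20) → ∀ w → length gs ≤ 3 + w * 3 →
        Covering es (r + (c + (7 + w * 6)) * 20) (r + (c + (7 + w * 6)) * 20)
      family₇ r c gs eq S w gs≤ = subst (λ n → Covering es n n) (sym (solve 3 (λ r c w →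
        r :+ (c :+ (con 7 :+ w :* con 6)) :* con 20 := (r :+ c :* con 20) :+ (con 1 :+ ((con 3 :+ w :* con 3) :+ (con 3 :+ w :* con 3))) :* con 20) refl r c w))
        (scheme (3 + w * 3) (inverses₇ w) H H-count gs gs≤ eq S)
        where open +-*-Solver

  -- The residue modulo 6 of the number of parts decides how many of them have to be merged into the
  -- hole.
  six : (P : ℕ → Set) → (∀ w → P (0 + w * 6)) → (∀ w → P (1 + w * 6)) → (∀ w → P (2 + w * 6)) →
        (∀ w → P (3 + w * 6)) → (∀ w → P (4 + w * 6)) → (∀ w → P (5 + w * 6)) → ∀ t → P t
  six P p₀ p₁ p₂ p₃ p₄ p₅ 0 = p₀ 0
  six P p₀ p₁ p₂ p₃ p₄ p₅ 1 = p₁ 0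
  six P p₀ p₁ p₂ p₃ p₄ p₅ 2 = p₂ 0
  six P p₀ p₁ p₂ p₃ p₄ p₅ 3 = p₃ 0
  six P p₀ p₁ p₂ p₃ p₄ p₅ 4 = p₄ 0
  six P p₀ p₁ p₂ p₃ p₄ p₅ 5 = p₅ 0
  six P p₀ p₁ p₂ p₃ p₄ p₅ (suc (suc (suc (suc (suc (suc t)))))) = six (λ t → P (6 + t))
    (λ w → p₀ (suc w)) (λ w → p₁ (suc w)) (λ w → p₂ (suc w)) (λ w → p₃ (suc w)) (λ w → p₄ (suc w)) (λ w → p₅ (suc w)) t

-- Designs developed from base blocks by a cyclic group

module Cyclic where

  open Coverings
  open Gadgetry using (if-true; if-false; if-cases; map-valid; map-joins)
  open Composition using (concatMap-All; concatMap-length; range-length; range-<)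
  open import Data.Bool using (Bool; true; false; _∧_; not; if_then_else_; T)
  open import Data.Nat using (ℕ; zero; suc; _+_; _*_; _∸_; _/_; _%_; _≤_; _<_; _≡ᵇ_; _<ᵇ_; _≤ᵇ_; s≤s; z≤n; NonZero)
  open import Data.Nat.DivMod
  open import Data.Nat.Properties
  open import Data.List using (List; []; _∷_; _++_; concatMap; map; length)
  open import Data.List.Properties using (length-map; length-++)
  open import Data.List.Membership.Propositional using (_∈_; find; lose)
  open import Data.List.Membership.Propositional.Properties using (∈-++⁻; ∈-map⁻)
  open import Data.List.Relation.Unary.All as All using (All; []; _∷_)
  import Data.List.Relation.Unary.All.Properties as All
  open import Data.List.Relation.Unary.Any as Any using (Any; here; there)
  import Data.List.Relation.Unary.Any.Properties as Any
  open import Data.Product using (_,_; proj₁; proj₂; swap)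
  open import Data.Sum using (inj₁; inj₂)
  open import Data.Unit using (tt)
  open import Data.Vec as Vec using (Vec)
  open import Relation.Binary using (tri<; tri≈; tri>)
  open import Relation.Binary.PropositionalEquality
  open import Relation.Nullary using (¬_; yes; no; contradiction)

  allᵇ : (ℕ → Bool) → ℕ → Bool
  allᵇ f zero = true
  allᵇ f (suc n) = f n ∧ allᵇ f n

  all-sound : ∀ f n → T (allᵇ f n) → ∀ {x} → x < n → T (f x)
  all-sound f (suc n) t (s≤s x≤n) with m≤n⇒m<n∨m≡n x≤n
  ... | inj₁ x<n = all-sound f n (proj₂ (∧-split (f n) t)) x<n
  ... | inj₂ refl = proj₁ (∧-split (f n) t)

  keep : (ℕ → Bool) → List ℕ → List ℕ
  keep f [] = []
  keep f (x ∷ xs) = if f x then x ∷ keep f xs else keep f xs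

  ∈-keep : ∀ f {x} xs → x ∈ xs → T (f x) → x ∈ keep f xs
  ∈-keep f (x ∷ xs) (here refl) t = subst (x ∈_) (sym (if-true {b = f x} t)) (here refl)
  ∈-keep f (y ∷ xs) (there m) t with f y
  ... | true = there (∈-keep f xs m t)
  ... | false = ∈-keep f xs m t

  T-not : ∀ {b} → ¬ T b → T (not b)
  T-not {true} ¬t = contradiction tt ¬t
  T-not {false} _ = tt

  T-∧ : ∀ {a b} → T a → T b → T (a ∧ b)
  T-∧ {true} _ t = t

  points : Cycles → ℕ
  points [] = 0
  points ((c , _) ∷ cs) = c + points cs

  %-+ : ∀ c .{{_ : NonZero c}} a b → (a % c + b) % c ≡ (a + b) % c
  %-+ c a b = trans (%-distribˡ-+ (a % c) b c) (trans (cong (λ t → (t + b % c) % c) (m%n%n≡m%n a c)) (sym (%-distribˡ-+ a b c)))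

  rotate-+ : ∀ c .{{_ : NonZero c}} d p s t → ((p + t * d) % c + s * d) % c ≡ (p + (t + s) * d) % c
  rotate-+ c d p s t = trans (%-+ c (p + t * d) (s * d)) (cong (_% c) (trans (+-assoc p _ _) (cong (p +_) (sym (*-distribʳ-+ d t s)))))

  shift-in : ∀ c d cs s {p} → p < suc c → shift ((suc c , d) ∷ cs) s p ≡ (p + s * d) % suc c
  shift-in c d cs s {p} p<c = if-true {b = p <ᵇ suc c} (<⇒<ᵇ p<c)

  shift-out : ∀ c d cs s j → shift ((suc c , d) ∷ cs) s (suc c + j) ≡ suc c + shift cs s j
  shift-out c d cs s j = trans (if-false {b = suc c + j <ᵇ suc c} {((suc c + j) + s * d) % suc c} {suc c + shift cs s (suc c + j ∸ suc c)}
    (λ t → <⇒≱ (<ᵇ⇒< (suc c + j) (suc c) t) (m≤m+n (suc c) j))) (cong (λ t → suc c + shift cs s t) (m+n∸m≡n (suc c) j))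

  data Split (c : ℕ) : ℕ → Set where
    low  : ∀ {p} → p < c → Split c p
    high : ∀ j → Split c (c + j)

  split : ∀ c p → Split c p
  split c p with p <? c
  ... | yes p<c = low p<c
  ... | no p≮c = subst (Split c) (m+[n∸m]≡n (≮⇒≥ p≮c)) (high (p ∸ c))

  shift-+ : ∀ cs s t p → shift cs s (shift cs t p) ≡ shift cs (t + s) p
  shift-+ [] s t p = refl
  shift-+ ((zero , d) ∷ cs) s t p = shift-+ cs s t p
  shift-+ ((suc c , d) ∷ cs) s t p with split (suc c) p
  ... | low p<c = trans (cong (shift ((suc c , d) ∷ cs) s) (shift-in c d cs t p<c))
    (trans (shift-in c d cs s (m%n<n (p + t * d) (suc c))) (trans (rotate-+ (suc c) d p s t) (sym (shift-in c d cs (t + s) p<c))))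
  ... | high j = trans (cong (shift ((suc c , d) ∷ cs) s) (shift-out c d cs t j))
    (trans (shift-out c d cs s (shift cs t j)) (trans (cong (suc c +_) (shift-+ cs s t j)) (sym (shift-out c d cs (t + s) j))))

  shift-< : ∀ cs s {p} → p < points cs → shift cs s p < points cs
  shift-< ((zero , d) ∷ cs) s p< = shift-< cs s p<
  shift-< ((suc c , d) ∷ cs) s {p} p< with split (suc c) p
  ... | low p<c = subst (_< suc c + points cs) (sym (shift-in c d cs s p<c)) (≤-trans (m%n<n (p + s * d) (suc c)) (m≤m+n (suc c) (points cs)))
  ... | high j = subst (_< suc c + points cs) (sym (shift-out c d cs s j)) (+-monoʳ-< (suc c) (shift-< cs s (+-cancelˡ-< (suc c) j (points cs) p<)))

  -- The points below q * k are permuted in k cycles of length q by adding k; they are divided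
  -- into w parts.  The next points, H of them, are permuted in the cycles hs.  A part together with
  -- e further points carries a copy of inner, and the points that are in no part carry a copy of hole.
  module Fill (es : Edges) (k q u w P e : ℕ) (hs : Cycles)
              .{{_ : NonZero k}} .{{_ : NonZero q}} .{{_ : NonZero u}} .{{_ : NonZero w}} where

    private instance
      M≢0 : NonZero (q * k)
      M≢0 = m*n≢0 q k

    M H n : ℕ
    M = q * k
    H = points hs
    n = M + H

    move : ℕ → ℕ → ℕ
    move s p = if p <ᵇ M then (p + s * k) % M else M + shift hs s (p ∸ M)

    -- Runs of `u` consecutive points are dealt to the `w` parts in turn; `index` numbers the points
    -- of a part, and `embed` is the inverse numbering.
    part index : ℕ → ℕ
    part x = (x / u) % w
    index x = x % u + u * (x / u / w)

    embed : ℕ → ℕ → ℕ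
    embed i p = if p <ᵇ P then p % u + u * (i + w * (p / u)) else n + (p ∸ P)

    -- These are the pairs left to the copies of `inner`.
    same : ℕ → ℕ → Bool
    same x y = (y <ᵇ M) ∧ (part x ≡ᵇ part y)

    -- The representative of an ordered pair whose first point is below `k`; moving by `q ∸ x / k`
    -- undoes `x / k` steps. The default `k` is the first coordinate of no representative.
    canon : ℕ → ℕ → Pair
    canon x y = if x <ᵇ M then (x % k , move (q ∸ x / k) y) else (k , 0)

    -- `canon` distinguishes the two ends, so every edge is presented in both directions.
    arcs : Edges
    arcs = es ++ map swap es

    row : ℕ → List ℕ
    row r = keep (λ z → not (same r z)) (range 0 n)

    -- The relations between `part`, `index`, `embed` and `move` are evaluated for the given
    -- parameters instead of being derived from divisibility. The last condition says that `q` steps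
    -- are the identity on the points outside the parts.
    partsOk : Bool
    partsOk = allᵇ (λ x → (index x <ᵇ P) ∧ (part x <ᵇ w) ∧ (embed (part x) (index x) ≡ᵇ x) ∧ (part (move 1 x) ≡ᵇ (part x + k / u) % w)) M
      ∧ allᵇ (λ i → allᵇ (λ p → (embed i p <ᵇ M) ∧ (index (embed i p) ≡ᵇ p)) P) w
      ∧ allᵇ (λ j → shift hs q j ≡ᵇ j) H

    developed : List Block → List Block
    developed L = concatMap (λ s → map (Vec.map (move s)) L) (range 0 q)

    few? : List Block → Covering es P (P + e) → Covering es (H + e) (H + e) → Bool
    few? L inner hole = (q * length L + (w * length (Covering.blocks inner) + length (Covering.blocks hole))) * (length es + length es)
      ≤ᵇ (n + e) * (n + e ∸ 1)

    isFilling : List Block → Covering es P (P + e) → Covering es (H + e) (H + e) → Bool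
    isFilling L inner hole = allValidᵇ n L ∧ Check.attains arcs canon row k L ∧ partsOk ∧ few? L inner hole

    move-in : ∀ s {p} → p < M → move s p ≡ (p + s * k) % M
    move-in s {p} p<M = if-true {b = p <ᵇ M} (<⇒<ᵇ p<M)

    move-out : ∀ s j → move s (M + j) ≡ M + shift hs s j
    move-out s j = trans (if-false {b = M + j <ᵇ M} {(M + j + s * k) % M} {M + shift hs s (M + j ∸ M)}
      (λ t → <⇒≱ (<ᵇ⇒< (M + j) M t) (m≤m+n M j))) (cong (λ t → M + shift hs s t) (m+n∸m≡n M j))

    move-+ : ∀ s t p → move s (move t p) ≡ move (t + s) p
    move-+ s t p with split M p
    ... | low p<M = trans (cong (move s) (move-in t p<M)) (trans (move-in s (m%n<n (p + t * k) M)) (trans (rotate-+ M k p s t) (sym (move-in (t + s) p<M))))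
    ... | high j = trans (cong (move s) (move-out t j)) (trans (move-out s (shift hs t j)) (trans (cong (M +_) (shift-+ hs s t j)) (sym (move-out (t + s) j))))

    move-<M : ∀ s {p} → p < M → move s p < M
    move-<M s {p} p<M = subst (_< M) (sym (move-in s p<M)) (m%n<n (p + s * k) M)

    move-< : ∀ s {p} → p < n → move s p < n
    move-< s {p} p<n with split M p
    ... | low p<M = ≤-trans (move-<M s p<M) (m≤m+n M H)
    ... | high j = subst (_< n) (sym (move-out s j)) (+-monoʳ-< M (shift-< hs s (+-cancelˡ-< M j H p<n)))

    module _ (L : List Block) (inner : Covering es P (P + e)) (hole : Covering es (H + e) (H + e)) (t : T (isFilling L inner hole)) where

      private
        t₁ = proj₁ (∧-split (allValidᵇ n L) t)
        t₂₃₄ = proj₂ (∧-split (allValidᵇ n L) t)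
        t₂ = proj₁ (∧-split (Check.attains arcs canon row k L) t₂₃₄)
        t₃₄ = proj₂ (∧-split (Check.attains arcs canon row k L) t₂₃₄)
        t₃ = proj₁ (∧-split partsOk t₃₄)
        t₄ = proj₂ (∧-split partsOk t₃₄)

        pointwise : ℕ → Bool
        pointwise x = (index x <ᵇ P) ∧ (part x <ᵇ w) ∧ (embed (part x) (index x) ≡ᵇ x) ∧ (part (move 1 x) ≡ᵇ (part x + k / u) % w)
        partwise : ℕ → Bool
        partwise i = allᵇ (λ p → (embed i p <ᵇ M) ∧ (index (embed i p) ≡ᵇ p)) P
        t₃₁ = ∧-split (allᵇ pointwise M) t₃
        t₃₂ = ∧-split (allᵇ partwise w) (proj₂ t₃₁)

        module _ {x : ℕ} (x<M : x < M) where
          private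
            a = ∧-split (index x <ᵇ P) (all-sound pointwise M (proj₁ t₃₁) x<M)
            b = ∧-split (part x <ᵇ w) (proj₂ a)
            c = ∧-split (embed (part x) (index x) ≡ᵇ x) (proj₂ b)
          index-< : index x < P
          index-< = <ᵇ⇒< (index x) P (proj₁ a)
          part-< : part x < w
          part-< = <ᵇ⇒< (part x) w (proj₁ b)
          embed-index : embed (part x) (index x) ≡ x
          embed-index = ≡ᵇ⇒≡ (embed (part x) (index x)) x (proj₁ c)
          part-step : part (move 1 x) ≡ (part x + k / u) % w
          part-step = ≡ᵇ⇒≡ (part (move 1 x)) ((part x + k / u) % w) (proj₂ c)

        module _ {i p : ℕ} (i<w : i < w) (p<P : p < P) where
          private
            a = ∧-split (embed i p <ᵇ M) (all-sound (λ p → (embed i p <ᵇ M) ∧ (index (embed i p) ≡ᵇ p)) P (all-sound partwise w (proj₁ t₃₂) i<w) p<P)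
          embed-< : embed i p < M
          embed-< = <ᵇ⇒< (embed i p) M (proj₁ a)
          index-embed : index (embed i p) ≡ p
          index-embed = ≡ᵇ⇒≡ (index (embed i p)) p (proj₂ a)

        embed-out : ∀ i j → embed i (P + j) ≡ n + j
        embed-out i j = trans (if-false {b = P + j <ᵇ P} {(P + j) % u + u * (i + w * ((P + j) / u))} {n + (P + j ∸ P)}
          (λ t → <⇒≱ (<ᵇ⇒< (P + j) P t) (m≤m+n P j))) (cong (n +_) (m+n∸m≡n P j))

        move-q : ∀ {p} → p < n → move q p ≡ p
        move-q {p} p<n with split M p
        ... | low p<M = trans (move-in q p<M) (trans ([m+n]%n≡m%n p M) (m<n⇒m%n≡m p<M))
        ... | high j = trans (move-out q j) (cong (M +_) (≡ᵇ⇒≡ (shift hs q j) j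
                (all-sound (λ j → shift hs q j ≡ᵇ j) H (proj₂ t₃₂) (+-cancelˡ-< M j H p<n))))

        move-*q : ∀ c {p} → p < n → move (c * q) p ≡ p
        move-*q zero {p} p<n with split M p
        ... | low p<M = trans (move-in 0 p<M) (trans (cong (_% M) (+-identityʳ p)) (m<n⇒m%n≡m p<M))
        -- `shift hs 0 j` need not reduce to `j`; that zero steps fix the point follows from the
        -- check for `q` steps, as 0 and `q` steps together are `q` steps.
        ... | high j = begin
          move 0 (M + j)                ≡⟨ cong (move 0) (sym (move-q p<n)) ⟩
          move 0 (move q (M + j))       ≡⟨ move-+ 0 q (M + j) ⟩
          move (q + 0) (M + j)          ≡⟨ cong (λ s → move s (M + j)) (+-identityʳ q) ⟩
          move q (M + j)                ≡⟨ move-q p<n ⟩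
          M + j                         ∎
          where open ≡-Reasoning
        move-*q (suc c) {p} p<n = trans (sym (move-+ (c * q) q p)) (trans (cong (move (c * q)) (move-q p<n)) (move-*q c p<n))

        move-% : ∀ s {p} → p < n → move (s % q) p ≡ move s p
        move-% s {p} p<n = trans (sym (move-*q (s / q) (move-< (s % q) p<n)))
          (trans (move-+ (s / q * q) (s % q) p) (cong (λ t → move t p) (sym (m≡m%n+[m/n]*n s q))))

        move-back : ∀ {s p} → s ≤ q → p < n → move s (move (q ∸ s) p) ≡ p
        move-back {s} {p} s≤q p<n = trans (move-+ s (q ∸ s) p) (trans (cong (λ t → move t p) (m∸n+n≡m s≤q)) (move-q p<n))

        move-forth : ∀ {s p} → s ≤ q → p < n → move (q ∸ s) (move s p) ≡ p
        move-forth {s} {p} s≤q p<n = trans (move-+ (q ∸ s) s p) (trans (cong (λ t → move t p) (m+[n∸m]≡n s≤q)) (move-q p<n))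

        move-injective : ∀ {s} → s ≤ q → ∀ {p p′} → p < n → p′ < n → move s p ≡ move s p′ → p ≡ p′
        move-injective {s} s≤q p< p′< eq = trans (sym (move-forth s≤q p<)) (trans (cong (move (q ∸ s)) eq) (move-forth s≤q p′<))

        -- One step rotates the parts by `k / u`, hence maps points of one part to points of one
        -- part; this is iterated.
        part-move : ∀ s {x y} → x < M → y < M → part x ≡ part y → part (move s x) ≡ part (move s y)
        part-move zero {x} {y} x<M y<M eq = subst₂ (λ a b → part a ≡ part b) (sym (move-*q 0 (≤-trans x<M (m≤m+n M H)))) (sym (move-*q 0 (≤-trans y<M (m≤m+n M H)))) eq
        part-move (suc s) {x} {y} x<M y<M eq = subst₂ (λ a b → part a ≡ part b) (move-+ s 1 x) (move-+ s 1 y)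
          (part-move s (move-<M 1 x<M) (move-<M 1 y<M) (trans (part-step x<M) (trans (cong (λ t → (t + k / u) % w) eq) (sym (part-step y<M)))))

        start : ∀ {x} → x < M → move (x / k) (x % k) ≡ x
        start {x} x<M = trans (move-in (x / k) (≤-<-trans (m%n≤m x k) x<M))
          (trans (cong (_% M) (sym (m≡m%n+[m/n]*n x k))) (m<n⇒m%n≡m x<M))

        -- Being in a common part is invariant under `move`, so the representative of (x , y) is one
        -- of the checked pairs. The base block that attains it is then moved so that its arc
        -- becomes (x , y).
        developed-cover : ∀ {x y} → x < M → y < n → ¬ T (same x y) → Covers es (developed L) x y
        developed-cover {x} {y} x<M y<n diff with find (Check.attains-sound arcs canon row k L t₂ {r} {z} (m%n<n x k) z∈)
          where
          r = x % k
          z = move (q ∸ x / k) y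
          x/k≤q : x / k ≤ q
          x/k≤q = <⇒≤ (m<n*o⇒m/o<n x<M)
          z∈ : z ∈ row r
          z∈ = ∈-keep (λ z → not (same r z)) (range 0 n) (∈-range 0 n z≤n (move-< (q ∸ x / k) y<n)) (T-not λ s →
            let z<M , eq = ∧-split (z <ᵇ M) s
                z<M = <ᵇ⇒< z M z<M
                y≡ = move-back x/k≤q y<n
            in diff (T-∧ (<⇒<ᵇ (subst (_< M) y≡ (move-<M (x / k) z<M)))
                 (≡⇒≡ᵇ (part x) (part y) (trans (cong part (sym (start x<M))) (trans
                   (part-move (x / k) (≤-<-trans (m%n≤m x k) x<M) z<M (≡ᵇ⇒≡ (part r) (part z) eq)) (cong part y≡))))))
        ... | B , B∈ , m with find m
        ...   | (f , g) , fg∈ , eq with if-cases ((B ! f) <ᵇ M) eq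
        ...     | inj₂ (_ , bad) = contradiction (m%n<n x k) (<-irrefl (sym (cong proj₁ bad)))
        ...     | inj₁ (b<M , good) = Any.concatMap⁺ (λ s → map (Vec.map (move s)) L)
            (lose {x = s₀ % q} (∈-range 0 q z≤n (m%n<n s₀ q)) (Any.map⁺ (lose {x = B} B∈
              (subst₂ (λ a b → Joins es a b (Vec.map (move (s₀ % q)) B)) x≡ y≡ (map-joins es (move (s₀ % q)) {B = B} joined)))))
          where
          v = B ! f
          v′ = B ! g
          v<M : v < M
          v<M = <ᵇ⇒< v M b<M
          B-ok = All.lookup (allValid-sound n L t₁) B∈
          i = x / k
          j = v / k
          s₀ = q ∸ j + i
          i≤q : i ≤ q
          i≤q = <⇒≤ (m<n*o⇒m/o<n x<M)
          j≤q : j ≤ q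
          j≤q = <⇒≤ (m<n*o⇒m/o<n v<M)
          v<n = ≤-trans v<M (m≤m+n M H)
          joined : Joins es v v′ B
          joined with ∈-++⁻ es fg∈
          ... | inj₁ fg∈es = lose fg∈es (inj₁ (refl , refl))
          ... | inj₂ fg∈sw with ∈-map⁻ swap fg∈sw
          ...   | (g′ , f′) , gf∈ , refl = lose gf∈ (inj₂ (refl , refl))
          x≡ : move (s₀ % q) v ≡ x
          x≡ = begin
            move (s₀ % q) v                       ≡⟨ move-% s₀ v<n ⟩
            move s₀ v                             ≡⟨ sym (move-+ i (q ∸ j) v) ⟩
            move i (move (q ∸ j) v)               ≡⟨ cong (λ t → move i (move (q ∸ j) t)) (sym (start v<M)) ⟩
            move i (move (q ∸ j) (move j (v % k))) ≡⟨ cong (move i) (move-forth j≤q (≤-<-trans (m%n≤m v k) v<n)) ⟩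
            move i (v % k)                        ≡⟨ cong (move i) (cong proj₁ good) ⟩
            move i (x % k)                        ≡⟨ start x<M ⟩
            x                                     ∎
            where open ≡-Reasoning
          y≡ : move (s₀ % q) v′ ≡ y
          y≡ = begin
            move (s₀ % q) v′            ≡⟨ move-% s₀ (Valid.bound B-ok g) ⟩
            move s₀ v′                  ≡⟨ sym (move-+ i (q ∸ j) v′) ⟩
            move i (move (q ∸ j) v′)    ≡⟨ cong (move i) (cong proj₂ good) ⟩
            move i (move (q ∸ i) y)     ≡⟨ move-back i≤q y<n ⟩
            y                           ∎
            where open ≡-Reasoning

        N : ℕ
        N = n + e

        innerBlocks holeBlocks : List Block
        innerBlocks = concatMap (λ i → map (Vec.map (embed i)) (Covering.blocks inner)) (range 0 w)
        holeBlocks = map (Vec.map (M +_)) (Covering.blocks hole)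

        Blocks : List Block
        Blocks = developed L ++ innerBlocks ++ holeBlocks

        flip : ∀ {L x y} → Covers es L x y → Covers es L y x
        flip {x = x} {y} = Any.map λ {B} → Joins-sym {es} {x} {y} {B}

        inner-cover : ∀ {i a b} → i < w → a < P → a < b → b < P + e → Covers es Blocks (embed i a) (embed i b)
        inner-cover {i} i<w a<P a<b b< = Any.++⁺ʳ (developed L) (Any.++⁺ˡ (Any.concatMap⁺ (λ i → map (Vec.map (embed i)) (Covering.blocks inner))
          (lose {x = i} (∈-range 0 w z≤n i<w) (Any.map⁺ (Any.map (λ {B} → map-joins es (embed i) {B = B}) (Covering.covers inner a<P a<b b<))))))

        within : ∀ {x y} → x < M → y < M → part x ≡ part y → x ≢ y → Covers es Blocks x y
        within {x} {y} x<M y<M eq x≢y = subst₂ (Covers es Blocks) (embed-index x<M) (trans (cong (λ i → embed i (index y)) eq) (embed-index y<M)) go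
          where
          go : Covers es Blocks (embed (part x) (index x)) (embed (part x) (index y))
          go with <-cmp (index x) (index y)
          ... | tri< a<b _ _ = inner-cover (part-< x<M) (index-< x<M) a<b (≤-trans (index-< y<M) (m≤m+n P e))
          ... | tri> _ _ b<a = flip (inner-cover (part-< x<M) (index-< y<M) b<a (≤-trans (index-< x<M) (m≤m+n P e)))
          ... | tri≈ _ a≡b _ = contradiction (trans (sym (embed-index x<M)) (trans (cong₂ embed eq a≡b) (embed-index y<M))) x≢y

        to-extra : ∀ {x j} → x < M → j < e → Covers es Blocks x (n + j)
        to-extra {x} {j} x<M j<e = subst₂ (Covers es Blocks) (embed-index x<M) (embed-out (part x) j)
          (inner-cover (part-< x<M) (index-< x<M) (≤-trans (index-< x<M) (m≤m+n P j)) (+-monoʳ-< P j<e))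

        in-hole : ∀ {i j} → i < j → j < H + e → Covers es Blocks (M + i) (M + j)
        in-hole i<j j< = Any.++⁺ʳ (developed L) (Any.++⁺ʳ innerBlocks (Any.map⁺ (Any.map (λ {B} → map-joins es (M +_) {B = B})
          (Covering.covers hole (<-trans i<j j<) i<j j<))))

        all-covered : ∀ {x y} → x < y → y < N → Covers es Blocks x y
        all-covered {x} {y} x<y y<N with split M x
        all-covered {x} {y} x<y y<N | high i with split M y
        ... | low y<M = contradiction (<-trans x<y y<M) (≤⇒≯ (m≤m+n M i))
        ... | high j = in-hole (+-cancelˡ-< M i j x<y) (+-cancelˡ-< M j (H + e) (≤-trans y<N (≤-reflexive (+-assoc M H e))))
        all-covered {x} {y} x<y y<N | low x<M with split n y
        ... | high j = to-extra x<M (+-cancelˡ-< n j e y<N)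
        ... | low y<n with y <? M
        ...   | no y≮M = Any.++⁺ˡ (developed-cover x<M y<n λ s → y≮M (<ᵇ⇒< y M (proj₁ (∧-split (y <ᵇ M) s))))
        ...   | yes y<M with part x ≟ part y
        ...     | yes eq = within x<M y<M eq (<⇒≢ x<y)
        ...     | no ≢ = Any.++⁺ˡ (developed-cover x<M y<n λ s → ≢ (≡ᵇ⇒≡ (part x) (part y) (proj₂ (∧-split (y <ᵇ M) s))))

        embed-<N : ∀ {i} → i < w → ∀ {p} → p < P + e → embed i p < N
        embed-<N {i} i<w {p} p< with split P p
        ... | low p<P = ≤-trans (embed-< i<w p<P) (≤-trans (m≤m+n M H) (m≤m+n n e))
        ... | high j = subst (_< N) (sym (embed-out i j)) (+-monoʳ-< n (+-cancelˡ-< P j e p<))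

        embed-apart : ∀ {i p j} → i < w → p < P → embed i p ≢ embed i (P + j)
        embed-apart {i} {p} {j} i<w p<P eq = <⇒≱ (embed-< i<w p<P)
          (≤-trans (≤-trans (m≤m+n M H) (m≤m+n n j)) (≤-reflexive (sym (trans eq (embed-out i j)))))

        embed-injective : ∀ {i} → i < w → ∀ {p p′} → p < P + e → p′ < P + e → embed i p ≡ embed i p′ → p ≡ p′
        embed-injective {i} i<w {p} {p′} _ _ eq with split P p | split P p′
        ... | low p<P | low p′<P = trans (sym (index-embed i<w p<P)) (trans (cong index eq) (index-embed i<w p′<P))
        ... | low p<P | high j = contradiction eq (embed-apart i<w p<P)
        ... | high j | low p′<P = contradiction (sym eq) (embed-apart i<w p′<P)
        ... | high j | high j′ = cong (P +_) (+-cancelˡ-≡ n j j′ (trans (sym (embed-out i j)) (trans eq (embed-out i j′))))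

        allValid : All (Valid N) Blocks
        allValid = All.++⁺
          (concatMap-All _ (range 0 q) λ {s} s∈ → All.map⁺ (All.map (λ {B} → map-valid (move s)
            (λ p< → ≤-trans (move-< s p<) (m≤m+n n e)) (move-injective (<⇒≤ (range-< 0 q s∈))) {B}) (allValid-sound n L t₁)))
          (All.++⁺
            (concatMap-All _ (range 0 w) λ {i} i∈ → All.map⁺ (All.map (λ {B} → map-valid (embed i)
              (embed-<N (range-< 0 w i∈)) (embed-injective (range-< 0 w i∈)) {B}) (Covering.ok inner)))
            (All.map⁺ (All.map (λ {B} → map-valid (M +_)
              (λ {p} p< → ≤-trans (+-monoʳ-< M p<) (≤-reflexive (sym (+-assoc M H e)))) (λ {p} {p′} _ _ → +-cancelˡ-≡ M p p′) {B}) (Covering.ok hole))))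

        Blocks-length : length Blocks ≡ q * length L + (w * length (Covering.blocks inner) + length (Covering.blocks hole))
        Blocks-length = trans (length-++ (developed L)) (cong₂ _+_
          (trans (concatMap-length (λ s → map (Vec.map (move s)) L) (range 0 q) (length L) (λ s → length-map (Vec.map (move s)) L)) (cong (_* length L) (range-length 0 q)))
          (trans (length-++ innerBlocks) (cong₂ _+_
            (trans (concatMap-length (λ i → map (Vec.map (embed i)) (Covering.blocks inner)) (range 0 w) (length (Covering.blocks inner))
              (λ i → length-map (Vec.map (embed i)) (Covering.blocks inner))) (cong (_* length (Covering.blocks inner)) (range-length 0 w)))
            (length-map (Vec.map (M +_)) (Covering.blocks hole)))))

      fill : Covering es N N
      fill = record
        { blocks = Blocks
        ; ok     = allValid
        ; covers = λ _ → all-covered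
        ; few    = ≤-trans (≤-reflexive (trans (cong (λ t → length Blocks * (length es + length es) + t * (t ∸ 1)) (n∸n≡0 N)) (+-identityʳ _)))
            (≤-trans (≤-reflexive (cong (_* (length es + length es)) Blocks-length)) (≤ᵇ⇒≤ _ _ t₄))
        }

-- Explicit base blocks and their assembly

module Constructions where

  open Coverings
  open Gadgetry
  open Composition
  open Cyclic
  open Necessity using (Admissible)
  open import Data.Bool using (_∧_; T)
  open import Data.Nat using (ℕ; zero; suc; _+_; _*_; _∸_; _%_; _≡ᵇ_; _≤ᵇ_; s≤s; z≤n; NonZero)
  open import Data.Nat.Properties using (≤ᵇ⇒≤; ≡ᵇ⇒≡)
  open import Data.List using (List; []; _∷_)
  open import Data.Product using (_,_; proj₁; proj₂)
  open import Data.Unit using (tt)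
  open import Data.Vec using ([]; _∷_)
  open import Relation.Binary.PropositionalEquality using (_≢_; refl; sym; subst)
  open import Data.Sum using (inj₁; inj₂)
  open import Data.Nat.DivMod using (_/_; m≡m%n+[m/n]*n)
  open import Relation.Nullary using (contradiction)

  -- All lists of blocks below were found by computer search.
  b : ℕ → ℕ → ℕ → ℕ → ℕ → ℕ → Block
  b v₁ v₂ v₃ v₄ v₅ v₆ = v₁ ∷ v₂ ∷ v₃ ∷ v₄ ∷ v₅ ∷ v₆ ∷ []

  -- Depends on a - b modulo 20 only, which is what the rotations used in developing gadgets leave
  -- invariant.
  circulant : List ℕ → ℕ → ℕ → ℕ
  circulant ks a b = entry ks ((a + (20 ∸ b)) % 20)
    where
    entry : List ℕ → ℕ → ℕ
    entry [] _ = 0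
    entry (k ∷ _) zero = k
    entry (_ ∷ ks) (suc i) = entry ks i

  steps : ∀ κ → T (allᵇ (λ a → allᵇ (λ b → (1 ≤ᵇ κ a b) ∧ (κ a b ≤ᵇ 3) ∧ (κ a b ≡ᵇ κ b a)) 20) 20) → Steps κ
  steps κ t = record
    { lower = λ {a} {b} a<20 b<20 → ≤ᵇ⇒≤ _ _ (proj₁ (at a b a<20 b<20))
    ; upper = λ {a} {b} a<20 b<20 → ≤ᵇ⇒≤ _ _ (proj₁ (∧-split (κ a b ≤ᵇ 3) (proj₂ (at a b a<20 b<20))))
    ; symm  = λ {a} {b} a<20 b<20 → ≡ᵇ⇒≡ _ _ (proj₂ (∧-split (κ a b ≤ᵇ 3) (proj₂ (at a b a<20 b<20))))
    }
    where
    at = λ a b a<20 b<20 → ∧-split (1 ≤ᵇ κ a b) {(κ a b ≤ᵇ 3) ∧ (κ a b ≡ᵇ κ b a)}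
      (all-sound (λ b → (1 ≤ᵇ κ a b) ∧ (κ a b ≤ᵇ 3) ∧ (κ a b ≡ᵇ κ b a)) 20
        (all-sound (λ a → allᵇ (λ b → (1 ≤ᵇ κ a b) ∧ (κ a b ≤ᵇ 3) ∧ (κ a b ≡ᵇ κ b a)) 20) 20 t {a} a<20) {b} b<20)

  by-residue : (P : ℕ → Set) → (∀ t → P (0 + t * 20)) → (∀ t → P (1 + t * 20)) →
    (∀ t → P (5 + t * 20)) → (∀ t → P (16 + t * 20)) → ∀ n → Admissible (n % 20) → P n
  by-residue P p₀ p₁ p₅ p₁₆ n adm = subst P (sym (m≡m%n+[m/n]*n n 20)) (go (n / 20) adm)
    where
    go : ∀ t {r} → Admissible r → P (r + t * 20)
    go t (inj₁ refl) = p₀ t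
    go t (inj₂ (inj₁ refl)) = p₁ t
    go t (inj₂ (inj₂ (inj₁ refl))) = p₅ t
    go t (inj₂ (inj₂ (inj₂ refl))) = p₁₆ t

  module Fillings (es : Edges) where

    empty : Covering es 0 0
    empty = covering es 0 0 [] tt

    single : Covering es 1 1
    single = covering es 1 1 [] tt

    -- With P = 1, e = 0 and `single` as `inner` the parts are single points: the base blocks then
    -- account for all pairs that are not inside the hole.
    fill : ∀ k q u w P e hs .{{_ : NonZero k}} .{{_ : NonZero q}} .{{_ : NonZero u}} .{{_ : NonZero w}} →
      (inner : Covering es P (P + e)) (hole : Covering es (points hs + e) (points hs + e)) (L : List Block) →
      T (Fill.isFilling es k q u w P e hs L inner hole) → Covering es (q * k + points hs + e) (q * k + points hs + e)
    fill k q u w P e hs inner hole L = Fill.fill es k q u w P e hs L inner hole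

  -- The designs of `n₃`

  module Coverings₃ where

    es : Edges
    es = (v5 , v3) ∷ (v5 , v2) ∷ (v5 , v1) ∷ (v4 , v3) ∷ (v4 , v2) ∷ (v4 , v1) ∷ (v6 , v1) ∷ (v3 , v2) ∷ (v3 , v1) ∷ (v2 , v1) ∷ []

    open Fillings es

    -- A rotation of order 19 with one fixed point; the 19 blocks are a single orbit.
    design-20 : Covering es 20 20
    design-20 = fill 1 19 1 19 1 0 ((1 , 1) ∷ []) single single (
      b 0 11 13 14 4 19 ∷ []) tt

    design-21 : Covering es 21 21
    design-21 = fill 3 7 1 21 1 0 [] single empty (
      b 13 0 18 17 6 16 ∷ b 11 8 3 17 1 0 ∷ b 1 14 12 13 16 17 ∷ []) tt

    inner-21 : Covering es 20 21
    inner-21 = puncture design-21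

    design-25 : Covering es 25 25
    design-25 = fill 5 5 1 25 1 0 [] single empty (
      b 12 10 24 8 14 19 ∷ b 3 1 14 8 13 17 ∷ b 6 7 17 23 11 22 ∷ b 15 9 14 6 16 22 ∷ b 21 18 10 0 15 11 ∷
      b 10 22 19 2 23 7 ∷ []) tt

    design-36 : Covering es 36 36
    design-36 = fill 4 9 1 36 1 0 [] single empty (
      b 16 0 1 10 33 18 ∷ b 27 23 3 8 34 24 ∷ b 10 32 5 7 30 24 ∷ b 30 2 6 15 9 17 ∷ b 33 15 8 34 14 7 ∷
      b 4 3 16 12 9 22 ∷ b 21 1 35 9 7 8 ∷ []) tt

    design-40 : Covering es 40 40
    design-40 = fill 1 39 1 39 1 0 ((1 , 1) ∷ []) single single (
      b 20 29 25 26 9 38 ∷ b 4 33 18 26 31 39 ∷ []) tt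

    design-41 : Covering es 41 41
    design-41 = fill 1 41 1 41 1 0 [] single empty (
      b 3 40 2 17 9 14 ∷ b 27 22 14 2 5 29 ∷ []) tt

    design-45 : Covering es 45 45
    design-45 = fill 4 11 1 44 1 0 ((1 , 1) ∷ []) single single (
      b 0 2 37 36 6 40 ∷ b 30 35 43 10 9 38 ∷ b 6 44 3 12 9 17 ∷ b 10 25 27 42 26 24 ∷ b 12 0 34 41 27 23 ∷
      b 35 14 16 40 32 5 ∷ b 31 17 8 22 15 35 ∷ b 39 8 7 29 33 19 ∷ b 29 16 21 5 33 10 ∷ []) tt

    design-56 : Covering es 56 56
    design-56 = fill 5 11 1 55 1 0 ((1 , 1) ∷ []) single single (
      b 13 33 4 22 44 1 ∷ b 32 49 55 30 13 48 ∷ b 25 54 22 45 52 23 ∷ b 1 54 34 33 12 30 ∷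
      b 6 33 46 25 12 26 ∷ b 34 6 37 9 0 29 ∷ b 37 17 22 29 21 47 ∷ b 5 23 20 19 9 29 ∷
      b 26 19 25 35 1 23 ∷ b 16 7 38 33 0 55 ∷ b 46 5 27 1 35 29 ∷ b 9 3 51 19 1 21 ∷ b 50 23 38 45 37 7 ∷
      b 53 2 8 40 16 28 ∷ []) tt

    design-60 : Covering es 60 60
    design-60 = fill 1 59 1 59 1 0 ((1 , 1) ∷ []) single single (
      b 29 3 52 47 15 2 ∷ b 35 22 11 28 14 33 ∷ b 57 37 28 56 53 59 ∷ []) tt

    design-61 : Covering es 61 61
    design-61 = fill 1 61 1 61 1 0 [] single empty (
      b 20 15 23 16 38 4 ∷ b 36 7 9 57 42 45 ∷ b 25 13 35 55 49 8 ∷ []) tt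

    design-65 : Covering es 65 65
    design-65 = fill 5 13 1 65 1 0 [] single empty (
      b 19 37 32 45 31 12 ∷ b 30 59 50 15 25 44 ∷ b 41 46 35 24 56 34 ∷ b 18 28 21 52 29 10 ∷
      b 5 41 33 58 3 17 ∷ b 45 27 36 18 23 49 ∷ b 11 7 35 52 45 37 ∷ b 33 22 0 7 62 15 ∷
      b 4 29 63 12 24 48 ∷ b 42 12 56 14 31 6 ∷ b 63 42 26 40 39 62 ∷ b 27 4 8 59 54 39 ∷
      b 1 21 20 23 39 43 ∷ b 13 30 7 29 62 63 ∷ b 3 59 23 56 10 8 ∷ b 46 44 50 9 11 30 ∷ []) tt

    design-76 : Covering es 76 76
    design-76 = fill 4 19 1 76 1 0 [] single empty (
      b 37 38 24 28 68 25 ∷ b 45 22 62 65 35 60 ∷ b 71 69 64 17 25 33 ∷ b 3 65 50 57 26 69 ∷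
      b 43 6 27 23 69 57 ∷ b 26 24 17 45 21 18 ∷ b 6 64 40 70 75 41 ∷ b 23 22 69 38 18 74 ∷
      b 3 70 32 14 16 22 ∷ b 55 28 19 67 22 14 ∷ b 16 17 38 6 66 36 ∷ b 28 69 53 20 51 54 ∷
      b 67 64 22 24 36 48 ∷ b 3 20 73 8 37 64 ∷ b 63 45 39 71 64 8 ∷ []) tt

    -- The parts are the residue classes modulo 4 in ℤ/80. The 30 edges of the base blocks realise
    -- the 30 differences up to 40 that are not divisible by 4. The same base blocks serve order 81,
    -- where each part is completed by a common point.
    design-80 : Covering es 80 80
    design-80 = fill 1 80 1 4 20 0 [] design-20 empty (
      b 12 47 74 9 61 34 ∷ b 36 29 66 27 19 35 ∷ b 4 50 79 73 25 65 ∷ []) tt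

    design-81 : Covering es 81 81
    design-81 = fill 1 80 1 4 20 1 [] inner-21 single (
      b 12 47 74 9 61 34 ∷ b 36 29 66 27 19 35 ∷ b 4 50 79 73 25 65 ∷ []) tt

    design-85 : Covering es 85 85
    design-85 = fill 2 30 2 3 20 0 ((10 , 1) ∷ (15 , 1) ∷ []) design-20 design-25 (
      b 40 12 66 45 9 55 ∷ b 9 17 37 73 76 70 ∷ b 26 13 22 65 66 84 ∷ b 67 19 45 23 29 53 ∷
      b 78 31 52 45 32 16 ∷ b 12 35 64 50 14 20 ∷ b 18 34 8 77 78 60 ∷ b 84 8 54 11 35 42 ∷
      b 53 42 51 72 70 18 ∷ []) tt

    design-96 : Covering es 96 96
    design-96 = fill 2 30 2 3 20 1 ((15 , 1) ∷ (10 , 1) ∷ (10 , 1) ∷ []) inner-21 design-36 (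
      b 40 43 9 90 70 67 ∷ b 48 21 58 76 75 59 ∷ b 21 24 94 23 40 82 ∷ b 40 8 0 64 61 6 ∷
      b 1 53 21 73 65 10 ∷ b 52 1 56 87 91 65 ∷ b 49 28 14 65 62 70 ∷ b 3 48 41 79 84 78 ∷
      b 32 11 54 93 75 94 ∷ b 7 20 22 84 63 51 ∷ b 17 31 21 67 90 50 ∷ []) tt

    design-105 : Covering es 105 105
    design-105 = fill 2 40 2 4 20 0 ((20 , 1) ∷ (5 , 1) ∷ []) design-20 design-25 (
      b 74 89 73 4 37 47 ∷ b 40 90 42 68 7 91 ∷ b 53 57 91 39 7 83 ∷ b 60 66 24 94 90 79 ∷
      b 29 67 38 92 102 72 ∷ b 41 102 63 36 35 90 ∷ b 92 54 74 61 57 77 ∷ b 6 57 97 18 36 72 ∷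
      b 32 50 54 102 29 63 ∷ b 35 33 45 22 97 9 ∷ b 58 92 73 13 12 53 ∷ []) tt

    design-116 : Covering es 116 116
    design-116 = fill 2 40 2 4 20 1 ((20 , 1) ∷ (10 , 1) ∷ (5 , 1) ∷ []) inner-21 design-36 (
      b 96 42 13 70 22 52 ∷ b 15 68 96 27 73 95 ∷ b 76 58 57 103 101 86 ∷ b 32 11 61 107 7 34 ∷
      b 61 63 43 95 83 100 ∷ b 67 56 21 112 113 109 ∷ b 24 59 46 90 110 102 ∷ b 13 30 56 104 18 24 ∷
      b 10 31 16 82 81 111 ∷ b 31 67 91 24 73 94 ∷ b 36 6 72 87 2 106 ∷ b 93 5 33 2 66 20 ∷
      b 10 77 102 7 63 91 ∷ []) tt

    κ : ℕ → ℕ → ℕ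
    κ = circulant (1 ∷ 1 ∷ 1 ∷ 3 ∷ 1 ∷ 2 ∷ 2 ∷ 2 ∷ 1 ∷ 1 ∷ 1 ∷ 1 ∷ 1 ∷ 2 ∷ 2 ∷ 2 ∷ 1 ∷ 3 ∷ 1 ∷ 1 ∷ [])

    κ-steps : Steps κ
    κ-steps = steps κ tt

    open Gadgets es κ

    gadget-0 : Gadget
    gadget-0 = gadget 0 (developed 20 ((20 , 1) ∷ (20 , 1) ∷ (20 , 1) ∷ (20 , 1) ∷ []) (
      b 0 24 77 45 46 20 ∷ b 0 36 63 54 55 30 ∷ [])) tt

    gadget-10 : Gadget
    gadget-10 = gadget 10 (developed 20 ((20 , 1) ∷ (20 , 1) ∷ (20 , 1) ∷ (20 , 1) ∷ (10 , 1) ∷ []) (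
      b 64 53 7 80 88 40 ∷ b 49 37 89 70 71 39 ∷ b 36 0 63 45 55 16 ∷ [])) tt

    -- The 400 + 20 · 15 edges need 70 blocks, which is no multiple of 20: rotations by two points
    -- give ten images of seven base blocks.
    gadget-15 : Gadget
    gadget-15 = gadget 15 (developed 10 ((20 , 2) ∷ (20 , 2) ∷ (20 , 2) ∷ (20 , 2) ∷ (10 , 1) ∷ (5 , 1) ∷ []) (
      b 63 54 0 82 93 41 ∷ b 81 7 54 26 64 5 ∷ b 74 39 94 11 43 54 ∷ b 52 19 20 86 90 83 ∷
      b 22 75 18 44 43 40 ∷ b 33 49 86 3 67 13 ∷ b 34 88 50 5 69 61 ∷ [])) tt

    gadget-20 : Gadget
    gadget-20 = gadget 20 (developed 20 ((20 , 1) ∷ (20 , 1) ∷ (20 , 1) ∷ (20 , 1) ∷ (20 , 1) ∷ []) (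
      b 18 52 36 61 85 28 ∷ b 63 28 6 52 91 98 ∷ b 39 58 66 80 98 19 ∷ b 67 34 55 91 85 93 ∷ [])) tt

    gadget-30 : Gadget
    gadget-30 = gadget 30 (developed 20 ((20 , 1) ∷ (20 , 1) ∷ (20 , 1) ∷ (20 , 1) ∷ (20 , 1) ∷ (10 , 1) ∷ []) (
      b 43 31 10 82 91 63 ∷ b 37 45 64 99 102 109 ∷ b 102 66 31 42 9 28 ∷ b 18 44 28 81 94 83 ∷
      b 72 9 96 38 27 101 ∷ [])) tt

    gadget-40 : Gadget
    gadget-40 = gadget 40 (developed 20 ((20 , 1) ∷ (20 , 1) ∷ (20 , 1) ∷ (20 , 1) ∷ (20 , 1) ∷ (20 , 1) ∷ []) (
      b 58 29 76 115 101 116 ∷ b 32 66 54 101 108 52 ∷ b 7 52 31 92 81 115 ∷ b 25 41 60 96 98 92 ∷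
      b 17 28 74 96 80 25 ∷ b 50 60 17 110 101 94 ∷ [])) tt

    open Families es κ κ-steps gadget-0 refl

    module Inner₁ = Inner {1} inner-21 (≤ᵇ⇒≤ _ _ tt)
    module Inner₀ = Inner {0} design-20 (≤ᵇ⇒≤ _ _ tt)

    -- The second argument of a family is the least number of parts whose removal leaves 5 or more
    -- parts, in number prime to 6.
    cover-0 : ∀ t → Covering es (0 + t * 20) (0 + t * 20)
    cover-0 0 = empty
    cover-0 1 = design-20
    cover-0 2 = design-40
    cover-0 3 = design-60
    cover-0 4 = design-80
    cover-0 (suc (suc (suc (suc (suc t))))) = six (λ t → Covering es (0 + (5 + t) * 20) (0 + (5 + t) * 20))
      (λ w → Inner₀.family₅ 0 0 [] refl empty w (z≤n))
      (λ w → Inner₀.family₅ 0 1 (gadget-20 ∷ []) refl design-20 w (s≤s z≤n))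
      (λ w → Inner₀.family₇ 0 0 [] refl empty w (z≤n))
      (λ w → Inner₀.family₇ 0 1 (gadget-20 ∷ []) refl design-20 w (s≤s z≤n))
      (λ w → Inner₀.family₇ 0 2 (gadget-20 ∷ gadget-20 ∷ []) refl design-40 w (s≤s (s≤s z≤n)))
      (λ w → Inner₀.family₇ 0 3 (gadget-20 ∷ gadget-20 ∷ gadget-20 ∷ []) refl design-60 w (s≤s (s≤s (s≤s z≤n))))
      t

    cover-1 : ∀ t → Covering es (1 + t * 20) (1 + t * 20)
    cover-1 0 = single
    cover-1 1 = design-21
    cover-1 2 = design-41
    cover-1 3 = design-61
    cover-1 4 = design-81
    cover-1 (suc (suc (suc (suc (suc t))))) = six (λ t → Covering es (1 + (5 + t) * 20) (1 + (5 + t) * 20))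
      (λ w → Inner₁.family₅ 1 0 [] refl single w (z≤n))
      (λ w → Inner₁.family₅ 1 1 (gadget-20 ∷ []) refl design-21 w (s≤s z≤n))
      (λ w → Inner₁.family₇ 1 0 [] refl single w (z≤n))
      (λ w → Inner₁.family₇ 1 1 (gadget-20 ∷ []) refl design-21 w (s≤s z≤n))
      (λ w → Inner₁.family₇ 1 2 (gadget-20 ∷ gadget-20 ∷ []) refl design-41 w (s≤s (s≤s z≤n)))
      (λ w → Inner₁.family₇ 1 3 (gadget-20 ∷ gadget-20 ∷ gadget-20 ∷ []) refl design-61 w (s≤s (s≤s (s≤s z≤n))))
      t

    -- There is no design of order 5, so at least one part is merged into the hole. The points of
    -- the gadgets add up to the whole hole, as the parts share none.
    cover-5 : ∀ t → Covering es (5 + suc t * 20) (5 + suc t * 20)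
    cover-5 0 = design-25
    cover-5 1 = design-45
    cover-5 2 = design-65
    cover-5 3 = design-85
    cover-5 4 = design-105
    cover-5 (suc (suc (suc (suc (suc t))))) = six (λ t → Covering es (5 + (6 + t) * 20) (5 + (6 + t) * 20))
      (λ w → Inner₀.family₅ 5 1 (gadget-10 ∷ gadget-15 ∷ []) refl design-25 w (s≤s (s≤s z≤n)))
      (λ w → Inner₀.family₅ 5 2 (gadget-15 ∷ gadget-30 ∷ []) refl design-45 w (s≤s (s≤s z≤n)))
      (λ w → Inner₀.family₇ 5 1 (gadget-10 ∷ gadget-15 ∷ []) refl design-25 w (s≤s (s≤s z≤n)))
      (λ w → Inner₀.family₇ 5 2 (gadget-15 ∷ gadget-30 ∷ []) refl design-45 w (s≤s (s≤s z≤n)))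
      (λ w → Inner₀.family₇ 5 3 (gadget-15 ∷ gadget-20 ∷ gadget-30 ∷ []) refl design-65 w (s≤s (s≤s (s≤s z≤n))))
      (λ w → Inner₀.family₇ 5 4 (gadget-15 ∷ gadget-30 ∷ gadget-40 ∷ []) refl design-85 w (s≤s (s≤s (s≤s z≤n))))
      t

    -- With one shared point the gadgets have to supply 35, 55, 75 or 95 hole points, all sums of
    -- available sizes; these sizes are multiples of 5, while 36, 56, 76 and 96 are not.
    cover-16 : ∀ t → Covering es (16 + suc t * 20) (16 + suc t * 20)
    cover-16 0 = design-36
    cover-16 1 = design-56
    cover-16 2 = design-76
    cover-16 3 = design-96
    cover-16 4 = design-116
    cover-16 (suc (suc (suc (suc (suc t))))) = six (λ t → Covering es (16 + (6 + t) * 20) (16 + (6 + t) * 20))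
      (λ w → Inner₁.family₅ 16 1 (gadget-15 ∷ gadget-20 ∷ []) refl design-36 w (s≤s (s≤s z≤n)))
      (λ w → Inner₁.family₅ 16 2 (gadget-15 ∷ gadget-40 ∷ []) refl design-56 w (s≤s (s≤s z≤n)))
      (λ w → Inner₁.family₇ 16 1 (gadget-15 ∷ gadget-20 ∷ []) refl design-36 w (s≤s (s≤s z≤n)))
      (λ w → Inner₁.family₇ 16 2 (gadget-15 ∷ gadget-40 ∷ []) refl design-56 w (s≤s (s≤s z≤n)))
      (λ w → Inner₁.family₇ 16 3 (gadget-15 ∷ gadget-30 ∷ gadget-30 ∷ []) refl design-76 w (s≤s (s≤s (s≤s z≤n))))
      (λ w → Inner₁.family₇ 16 4 (gadget-15 ∷ gadget-40 ∷ gadget-40 ∷ []) refl design-96 w (s≤s (s≤s (s≤s z≤n))))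
      t

    cover : ∀ n → Admissible (n % 20) → n ≢ 5 → n ≢ 16 → Covering es n n
    cover = by-residue (λ n → n ≢ 5 → n ≢ 16 → Covering es n n)
      (λ t _ _ → cover-0 t)
      (λ t _ _ → cover-1 t)
      (λ { zero n≢5 _ → contradiction refl n≢5 ; (suc t) _ _ → cover-5 t })
      (λ { zero _ n≢16 → contradiction refl n≢16 ; (suc t) _ _ → cover-16 t })

  -- The designs of `n₆`

  module Coverings₆ where

    es : Edges
    es = (v6 , v2) ∷ (v6 , v3) ∷ (v6 , v1) ∷ (v5 , v2) ∷ (v5 , v3) ∷ (v5 , v1) ∷ (v4 , v2) ∷ (v4 , v3) ∷ (v4 , v1) ∷ (v2 , v1) ∷ []

    open Fillings es

    -- The 19 blocks are listed in full and not developed from base blocks.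
    design-20 : Covering es 20 20
    design-20 = covering es 20 20 (
      b 5 11 6 7 9 19 ∷ b 1 16 10 8 15 7 ∷ b 0 3 11 10 16 6 ∷ b 0 14 8 15 13 18 ∷ b 3 7 10 18 14 12 ∷
      b 3 5 7 8 13 15 ∷ b 17 19 16 12 13 18 ∷ b 4 13 15 11 18 12 ∷ b 8 12 17 11 14 6 ∷ b 2 3 14 1 11 19 ∷
      b 2 5 9 17 12 16 ∷ b 4 9 17 3 8 7 ∷ b 1 18 0 11 5 12 ∷ b 0 1 16 17 4 19 ∷ b 4 15 10 17 2 19 ∷
      b 0 2 19 9 7 8 ∷ b 4 5 16 10 6 14 ∷ b 2 6 9 13 18 14 ∷ b 1 10 15 13 9 6 ∷ []) tt

    design-21 : Covering es 21 21
    design-21 = fill 3 7 1 21 1 0 [] single empty (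
      b 3 5 19 13 2 16 ∷ b 17 10 20 19 9 5 ∷ b 7 3 5 0 12 9 ∷ []) tt

    inner-21 : Covering es 20 21
    inner-21 = puncture design-21

    design-25 : Covering es 25 25
    design-25 = fill 5 5 1 25 1 0 [] single empty (
      b 4 5 3 10 11 7 ∷ b 20 23 24 10 4 3 ∷ b 24 13 11 14 1 16 ∷ b 13 22 2 3 4 11 ∷ b 22 9 3 5 21 17 ∷
      b 10 7 15 22 1 11 ∷ []) tt

    design-36 : Covering es 36 36
    design-36 = fill 4 9 1 36 1 0 [] single empty (
      b 27 6 14 28 7 2 ∷ b 21 3 15 12 32 5 ∷ b 35 13 9 3 12 2 ∷ b 27 13 2 22 19 15 ∷ b 23 8 4 14 28 12 ∷
      b 1 22 26 9 24 32 ∷ b 0 17 26 21 29 18 ∷ []) tt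

    design-40 : Covering es 40 40
    design-40 = fill 3 13 1 39 1 0 ((1 , 1) ∷ []) single single (
      b 7 31 28 17 6 25 ∷ b 35 32 33 23 31 37 ∷ b 2 26 28 18 9 19 ∷ b 23 31 15 39 4 24 ∷
      b 35 9 12 15 14 24 ∷ b 0 18 8 34 14 31 ∷ []) tt

    design-41 : Covering es 41 41
    design-41 = fill 1 41 1 41 1 0 [] single empty (
      b 28 3 36 7 38 0 ∷ b 10 18 26 37 33 27 ∷ []) tt

    design-45 : Covering es 45 45
    design-45 = fill 4 11 1 44 1 0 ((1 , 1) ∷ []) single single (
      b 0 10 29 22 18 3 ∷ b 36 20 18 17 43 24 ∷ b 19 13 8 3 28 7 ∷ b 40 10 42 11 1 29 ∷ b 44 1 27 6 23 0 ∷
      b 37 41 19 21 5 14 ∷ b 42 13 26 40 36 0 ∷ b 42 22 15 39 7 26 ∷ b 40 15 35 33 5 4 ∷ []) tt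

    design-56 : Covering es 56 56
    design-56 = fill 8 7 1 56 1 0 [] single empty (
      b 3 4 6 31 55 47 ∷ b 3 5 4 8 17 34 ∷ b 3 6 5 14 22 38 ∷ b 3 7 6 0 1 2 ∷ b 4 5 6 40 25 50 ∷
      b 4 6 3 32 9 18 ∷ b 4 7 5 29 53 45 ∷ b 5 6 3 48 41 26 ∷ b 5 7 6 24 49 42 ∷ b 6 7 5 28 52 44 ∷
      b 32 31 46 50 23 19 ∷ b 18 49 52 33 20 41 ∷ b 3 19 38 13 12 40 ∷ b 13 41 26 9 39 40 ∷
      b 9 55 30 40 39 35 ∷ b 32 42 44 10 36 26 ∷ b 3 35 14 21 20 25 ∷ b 21 26 48 18 15 25 ∷
      b 18 47 54 25 15 11 ∷ b 9 24 28 16 12 48 ∷ b 3 11 22 37 36 50 ∷ b 37 48 41 32 23 50 ∷ []) tt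

    design-60 : Covering es 60 60
    design-60 = fill 1 60 1 3 20 0 [] design-20 empty (
      b 52 56 43 33 30 36 ∷ b 11 54 45 43 40 46 ∷ []) tt

    design-61 : Covering es 61 61
    design-61 = fill 1 61 1 61 1 0 [] single empty (
      b 36 55 27 57 23 19 ∷ b 52 2 38 11 53 5 ∷ b 8 31 37 13 15 43 ∷ []) tt

    design-65 : Covering es 65 65
    design-65 = fill 2 20 2 2 20 0 ((20 , 1) ∷ (5 , 1) ∷ []) design-20 design-25 (
      b 25 15 13 55 48 58 ∷ b 12 23 39 49 46 64 ∷ b 30 60 45 32 16 13 ∷ b 37 55 62 31 23 2 ∷
      b 7 56 55 0 28 16 ∷ b 56 6 57 36 12 24 ∷ b 44 39 23 36 21 24 ∷ []) tt

    design-76 : Covering es 76 76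
    design-76 = fill 4 19 1 76 1 0 [] single empty (
      b 43 37 68 41 16 66 ∷ b 36 67 5 29 53 59 ∷ b 71 14 61 72 64 55 ∷ b 35 40 44 24 3 1 ∷
      b 72 53 14 73 9 34 ∷ b 55 26 21 54 37 68 ∷ b 25 71 30 46 62 15 ∷ b 23 8 42 49 69 63 ∷
      b 75 53 5 17 3 2 ∷ b 49 62 8 50 58 72 ∷ b 63 16 66 60 26 21 ∷ b 18 23 44 4 40 11 ∷
      b 67 57 52 34 22 43 ∷ b 51 62 30 38 3 0 ∷ b 34 40 57 32 12 49 ∷ []) tt

    design-80 : Covering es 80 80
    design-80 = fill 1 80 1 4 20 0 [] design-20 empty (
      b 31 56 71 38 37 66 ∷ b 13 0 45 15 71 14 ∷ b 57 19 59 36 16 30 ∷ []) tt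

    design-81 : Covering es 81 81
    design-81 = fill 1 80 1 4 20 1 [] inner-21 single (
      b 31 56 71 38 37 66 ∷ b 13 0 45 15 71 14 ∷ b 57 19 59 36 16 30 ∷ []) tt

    design-85 : Covering es 85 85
    design-85 = fill 2 30 2 3 20 0 ((10 , 1) ∷ (15 , 1) ∷ []) design-20 design-25 (
      b 15 43 44 41 71 69 ∷ b 51 30 36 29 81 64 ∷ b 77 45 50 16 5 42 ∷ b 50 80 38 0 13 17 ∷
      b 43 26 49 67 59 75 ∷ b 24 67 10 15 8 38 ∷ b 19 77 66 32 10 8 ∷ b 14 55 30 75 74 10 ∷
      b 68 3 70 55 7 49 ∷ []) tt

    design-96 : Covering es 96 96
    design-96 = fill 2 30 2 3 20 1 ((15 , 1) ∷ (10 , 1) ∷ (10 , 1) ∷ []) inner-21 design-36 (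
      b 4 30 48 83 61 8 ∷ b 33 49 15 77 87 73 ∷ b 83 46 80 13 9 37 ∷ b 59 77 78 6 30 2 ∷
      b 36 44 1 69 94 46 ∷ b 26 54 58 62 70 67 ∷ b 18 94 90 2 32 57 ∷ b 87 37 1 52 20 41 ∷
      b 37 59 13 38 27 26 ∷ b 11 37 25 68 64 65 ∷ b 15 10 21 85 65 13 ∷ []) tt

    design-105 : Covering es 105 105
    design-105 = fill 2 40 2 4 20 0 ((20 , 1) ∷ (5 , 1) ∷ []) design-20 design-25 (
      b 97 73 52 47 15 18 ∷ b 45 15 9 93 99 86 ∷ b 73 11 32 79 45 54 ∷ b 15 95 80 10 26 42 ∷
      b 57 15 9 13 74 60 ∷ b 77 98 89 63 10 67 ∷ b 36 104 102 43 10 1 ∷ b 72 94 24 23 6 3 ∷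
      b 3 60 101 63 56 32 ∷ b 4 14 36 83 75 16 ∷ b 54 60 48 87 18 96 ∷ []) tt

    design-116 : Covering es 116 116
    design-116 = fill 2 40 2 4 20 1 ((20 , 1) ∷ (10 , 1) ∷ (5 , 1) ∷ []) inner-21 design-36 (
      b 99 42 80 56 20 38 ∷ b 41 53 8 83 110 90 ∷ b 37 89 53 47 72 33 ∷ b 49 74 56 62 5 28 ∷
      b 32 15 65 92 99 67 ∷ b 99 62 38 9 61 35 ∷ b 24 26 36 101 109 6 ∷ b 63 4 10 48 41 114 ∷
      b 1 68 62 98 88 96 ∷ b 28 114 49 67 2 35 ∷ b 13 80 5 39 10 43 ∷ b 44 104 103 35 63 49 ∷
      b 108 46 102 35 9 36 ∷ []) tt

    -- Unlike `n₃`, the graph `n₆` is 3-colourable, and the steps 1 and 2 suffice; the same holds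
    -- for `n₈`.
    κ : ℕ → ℕ → ℕ
    κ = circulant (2 ∷ 2 ∷ 2 ∷ 1 ∷ 1 ∷ 1 ∷ 1 ∷ 1 ∷ 1 ∷ 2 ∷ 2 ∷ 2 ∷ 1 ∷ 1 ∷ 1 ∷ 1 ∷ 1 ∷ 1 ∷ 2 ∷ 2 ∷ [])

    κ-steps : Steps κ
    κ-steps = steps κ tt

    open Gadgets es κ

    gadget-0 : Gadget
    gadget-0 = gadget 0 (developed 20 ((20 , 1) ∷ (20 , 1) ∷ (20 , 1) ∷ (20 , 1) ∷ []) (
      b 0 23 33 50 58 59 ∷ b 20 48 57 8 6 61 ∷ [])) tt

    gadget-10 : Gadget
    gadget-10 = gadget 10 (developed 20 ((20 , 1) ∷ (20 , 1) ∷ (20 , 1) ∷ (20 , 1) ∷ (10 , 1) ∷ []) (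
      b 71 81 8 20 33 22 ∷ b 20 13 27 53 43 55 ∷ b 33 9 11 85 50 86 ∷ [])) tt

    gadget-15 : Gadget
    gadget-15 = gadget 15 (developed 10 ((20 , 2) ∷ (20 , 2) ∷ (20 , 2) ∷ (20 , 2) ∷ (10 , 1) ∷ (5 , 1) ∷ []) (
      b 35 65 11 81 50 52 ∷ b 93 40 88 32 76 33 ∷ b 87 45 42 39 69 4 ∷ b 22 18 34 88 85 48 ∷
      b 59 23 32 0 72 90 ∷ b 39 80 93 14 61 47 ∷ b 29 12 3 41 54 43 ∷ [])) tt

    gadget-20 : Gadget
    gadget-20 = gadget 20 (developed 20 ((20 , 1) ∷ (20 , 1) ∷ (20 , 1) ∷ (20 , 1) ∷ (20 , 1) ∷ []) (
      b 80 57 95 19 29 7 ∷ b 15 27 77 89 94 54 ∷ b 29 87 82 42 78 12 ∷ b 48 32 59 73 8 74 ∷ [])) tt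

    gadget-30 : Gadget
    gadget-30 = gadget 30 (developed 20 ((20 , 1) ∷ (20 , 1) ∷ (20 , 1) ∷ (20 , 1) ∷ (20 , 1) ∷ (10 , 1) ∷ []) (
      b 58 108 106 0 65 34 ∷ b 86 24 90 11 74 40 ∷ b 50 98 84 75 67 11 ∷ b 43 35 37 77 102 66 ∷
      b 23 64 70 58 88 84 ∷ [])) tt

    gadget-40 : Gadget
    gadget-40 = gadget 40 (developed 20 ((20 , 1) ∷ (20 , 1) ∷ (20 , 1) ∷ (20 , 1) ∷ (20 , 1) ∷ (20 , 1) ∷ []) (
      b 77 96 85 43 51 28 ∷ b 72 55 46 95 87 104 ∷ b 52 115 110 10 14 60 ∷ b 97 46 30 70 71 61 ∷
      b 114 27 116 50 77 43 ∷ b 55 23 29 117 16 93 ∷ [])) tt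

    open Families es κ κ-steps gadget-0 refl

    module Inner₁ = Inner {1} inner-21 (≤ᵇ⇒≤ _ _ tt)
    module Inner₀ = Inner {0} design-20 (≤ᵇ⇒≤ _ _ tt)

    cover-0 : ∀ t → Covering es (0 + t * 20) (0 + t * 20)
    cover-0 0 = empty
    cover-0 1 = design-20
    cover-0 2 = design-40
    cover-0 3 = design-60
    cover-0 4 = design-80
    cover-0 (suc (suc (suc (suc (suc t))))) = six (λ t → Covering es (0 + (5 + t) * 20) (0 + (5 + t) * 20))
      (λ w → Inner₀.family₅ 0 0 [] refl empty w (z≤n))
      (λ w → Inner₀.family₅ 0 1 (gadget-20 ∷ []) refl design-20 w (s≤s z≤n))
      (λ w → Inner₀.family₇ 0 0 [] refl empty w (z≤n))
      (λ w → Inner₀.family₇ 0 1 (gadget-20 ∷ []) refl design-20 w (s≤s z≤n))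
      (λ w → Inner₀.family₇ 0 2 (gadget-20 ∷ gadget-20 ∷ []) refl design-40 w (s≤s (s≤s z≤n)))
      (λ w → Inner₀.family₇ 0 3 (gadget-20 ∷ gadget-20 ∷ gadget-20 ∷ []) refl design-60 w (s≤s (s≤s (s≤s z≤n))))
      t

    cover-1 : ∀ t → Covering es (1 + t * 20) (1 + t * 20)
    cover-1 0 = single
    cover-1 1 = design-21
    cover-1 2 = design-41
    cover-1 3 = design-61
    cover-1 4 = design-81
    cover-1 (suc (suc (suc (suc (suc t))))) = six (λ t → Covering es (1 + (5 + t) * 20) (1 + (5 + t) * 20))
      (λ w → Inner₁.family₅ 1 0 [] refl single w (z≤n))
      (λ w → Inner₁.family₅ 1 1 (gadget-20 ∷ []) refl design-21 w (s≤s z≤n))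
      (λ w → Inner₁.family₇ 1 0 [] refl single w (z≤n))
      (λ w → Inner₁.family₇ 1 1 (gadget-20 ∷ []) refl design-21 w (s≤s z≤n))
      (λ w → Inner₁.family₇ 1 2 (gadget-20 ∷ gadget-20 ∷ []) refl design-41 w (s≤s (s≤s z≤n)))
      (λ w → Inner₁.family₇ 1 3 (gadget-20 ∷ gadget-20 ∷ gadget-20 ∷ []) refl design-61 w (s≤s (s≤s (s≤s z≤n))))
      t

    cover-5 : ∀ t → Covering es (5 + suc t * 20) (5 + suc t * 20)
    cover-5 0 = design-25
    cover-5 1 = design-45
    cover-5 2 = design-65
    cover-5 3 = design-85
    cover-5 4 = design-105
    cover-5 (suc (suc (suc (suc (suc t))))) = six (λ t → Covering es (5 + (6 + t) * 20) (5 + (6 + t) * 20))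
      (λ w → Inner₀.family₅ 5 1 (gadget-10 ∷ gadget-15 ∷ []) refl design-25 w (s≤s (s≤s z≤n)))
      (λ w → Inner₀.family₅ 5 2 (gadget-15 ∷ gadget-30 ∷ []) refl design-45 w (s≤s (s≤s z≤n)))
      (λ w → Inner₀.family₇ 5 1 (gadget-10 ∷ gadget-15 ∷ []) refl design-25 w (s≤s (s≤s z≤n)))
      (λ w → Inner₀.family₇ 5 2 (gadget-15 ∷ gadget-30 ∷ []) refl design-45 w (s≤s (s≤s z≤n)))
      (λ w → Inner₀.family₇ 5 3 (gadget-15 ∷ gadget-20 ∷ gadget-30 ∷ []) refl design-65 w (s≤s (s≤s (s≤s z≤n))))
      (λ w → Inner₀.family₇ 5 4 (gadget-15 ∷ gadget-30 ∷ gadget-40 ∷ []) refl design-85 w (s≤s (s≤s (s≤s z≤n))))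
      t

    cover-16 : ∀ t → Covering es (16 + suc t * 20) (16 + suc t * 20)
    cover-16 0 = design-36
    cover-16 1 = design-56
    cover-16 2 = design-76
    cover-16 3 = design-96
    cover-16 4 = design-116
    cover-16 (suc (suc (suc (suc (suc t))))) = six (λ t → Covering es (16 + (6 + t) * 20) (16 + (6 + t) * 20))
      (λ w → Inner₁.family₅ 16 1 (gadget-15 ∷ gadget-20 ∷ []) refl design-36 w (s≤s (s≤s z≤n)))
      (λ w → Inner₁.family₅ 16 2 (gadget-15 ∷ gadget-40 ∷ []) refl design-56 w (s≤s (s≤s z≤n)))
      (λ w → Inner₁.family₇ 16 1 (gadget-15 ∷ gadget-20 ∷ []) refl design-36 w (s≤s (s≤s z≤n)))
      (λ w → Inner₁.family₇ 16 2 (gadget-15 ∷ gadget-40 ∷ []) refl design-56 w (s≤s (s≤s z≤n)))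
      (λ w → Inner₁.family₇ 16 3 (gadget-15 ∷ gadget-30 ∷ gadget-30 ∷ []) refl design-76 w (s≤s (s≤s (s≤s z≤n))))
      (λ w → Inner₁.family₇ 16 4 (gadget-15 ∷ gadget-40 ∷ gadget-40 ∷ []) refl design-96 w (s≤s (s≤s (s≤s z≤n))))
      t

    cover : ∀ n → Admissible (n % 20) → n ≢ 5 → n ≢ 16 → Covering es n n
    cover = by-residue (λ n → n ≢ 5 → n ≢ 16 → Covering es n n)
      (λ t _ _ → cover-0 t)
      (λ t _ _ → cover-1 t)
      (λ { zero n≢5 _ → contradiction refl n≢5 ; (suc t) _ _ → cover-5 t })
      (λ { zero _ n≢16 → contradiction refl n≢16 ; (suc t) _ _ → cover-16 t })

  -- The designs of `n₈`

  module Coverings₈ where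

    es : Edges
    es = (v6 , v4) ∷ (v6 , v2) ∷ (v6 , v1) ∷ (v5 , v3) ∷ (v5 , v2) ∷ (v5 , v1) ∷ (v4 , v2) ∷ (v4 , v1) ∷ (v3 , v2) ∷ (v3 , v1) ∷ []

    open Fillings es

    -- The first seven blocks are an orbit of the rotation of order 7 on 6, ..., 12 and on 13, ...,
    -- 19. In the others the hubs are 0, 1 or 2, 3 or 4, 5; each such pair is joined to 6, ..., 19
    -- and to the cyclically next pair, whose two points are joined by an edge off the hubs.
    design-20 : Covering es 20 20
    design-20 = covering es 20 20 (
      b 11 16 7 15 6 18 ∷ b 12 17 8 16 7 19 ∷ b 6 18 9 17 8 13 ∷ b 7 19 10 18 9 14 ∷ b 8 13 11 19 10 15 ∷
      b 9 14 12 13 11 16 ∷ b 10 15 6 14 12 17 ∷ b 0 1 6 7 14 15 ∷ b 0 1 8 9 16 17 ∷ b 0 1 10 11 18 19 ∷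
      b 0 1 12 2 13 3 ∷ b 2 3 6 7 18 19 ∷ b 2 3 8 9 13 14 ∷ b 2 3 10 11 15 16 ∷ b 2 3 12 4 17 5 ∷
      b 4 5 6 7 19 13 ∷ b 4 5 8 9 14 15 ∷ b 4 5 10 11 16 17 ∷ b 4 5 12 0 18 1 ∷ []) tt

    design-21 : Covering es 21 21
    design-21 = fill 1 21 1 21 1 0 [] single empty (
      b 8 6 4 9 18 14 ∷ []) tt

    inner-21 : Covering es 20 21
    inner-21 = puncture design-21

    design-25 : Covering es 25 25
    design-25 = fill 5 5 1 25 1 0 [] single empty (
      b 7 22 8 6 13 19 ∷ b 24 14 6 9 10 23 ∷ b 21 10 2 8 19 23 ∷ b 5 22 0 24 7 17 ∷ b 16 6 23 1 2 0 ∷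
      b 10 24 3 18 0 21 ∷ []) tt

    design-36 : Covering es 36 36
    design-36 = fill 4 9 1 36 1 0 [] single empty (
      b 33 27 15 0 8 1 ∷ b 25 21 13 18 27 34 ∷ b 14 23 28 13 10 29 ∷ b 15 21 4 16 10 19 ∷
      b 6 19 30 32 3 34 ∷ b 4 21 2 12 8 28 ∷ b 4 11 25 18 30 19 ∷ []) tt

    design-40 : Covering es 40 40
    design-40 = fill 3 13 1 39 1 0 ((1 , 1) ∷ []) single single (
      b 30 8 31 20 13 38 ∷ b 15 32 9 36 18 22 ∷ b 35 7 16 30 10 11 ∷ b 2 4 30 0 15 19 ∷
      b 30 35 22 18 39 28 ∷ b 38 34 0 7 32 35 ∷ []) tt

    design-41 : Covering es 41 41
    design-41 = fill 1 41 1 41 1 0 [] single empty (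
      b 9 10 27 19 23 39 ∷ b 23 9 24 4 17 7 ∷ []) tt

    design-45 : Covering es 45 45
    design-45 = fill 4 11 1 44 1 0 ((1 , 1) ∷ []) single single (
      b 29 28 17 21 13 24 ∷ b 35 40 41 5 16 39 ∷ b 44 28 23 1 20 34 ∷ b 29 2 38 34 39 9 ∷
      b 19 35 30 22 4 21 ∷ b 28 33 35 12 18 39 ∷ b 41 35 15 10 23 19 ∷ b 4 29 2 26 6 16 ∷
      b 18 23 38 32 0 2 ∷ []) tt

    design-56 : Covering es 56 56
    design-56 = fill 8 7 1 56 1 0 [] single empty (
      b 47 21 11 7 41 37 ∷ b 52 22 16 12 42 38 ∷ b 10 28 16 24 27 23 ∷ b 11 29 17 25 32 28 ∷
      b 16 30 18 26 33 29 ∷ b 17 31 19 27 34 30 ∷ b 25 54 15 6 26 33 ∷ b 26 55 20 7 27 34 ∷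
      b 27 4 21 12 32 35 ∷ b 32 5 22 13 33 40 ∷ b 44 4 25 42 18 53 ∷ b 45 5 26 43 19 54 ∷
      b 46 6 27 48 24 55 ∷ b 47 7 32 49 25 4 ∷ b 10 17 5 33 37 42 ∷ b 11 18 6 34 38 43 ∷
      b 16 19 7 35 39 48 ∷ b 17 24 12 40 44 49 ∷ b 13 4 54 8 31 26 ∷ b 14 5 55 9 36 27 ∷
      b 15 6 4 10 37 32 ∷ b 20 7 5 11 38 33 ∷ []) tt

    design-60 : Covering es 60 60
    design-60 = fill 1 60 1 3 20 0 [] design-20 empty (
      b 30 48 37 13 11 8 ∷ b 28 16 24 44 14 15 ∷ []) tt

    design-61 : Covering es 61 61
    design-61 = fill 1 61 1 61 1 0 [] single empty (
      b 35 59 24 15 43 11 ∷ b 18 37 49 39 15 46 ∷ b 25 49 35 31 50 54 ∷ []) tt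

    design-65 : Covering es 65 65
    design-65 = fill 5 13 1 65 1 0 [] single empty (
      b 14 24 39 15 44 16 ∷ b 28 27 19 47 29 48 ∷ b 33 59 28 11 5 48 ∷ b 32 59 27 10 6 47 ∷
      b 25 13 20 22 45 38 ∷ b 26 12 21 23 46 37 ∷ b 57 31 64 55 45 25 ∷ b 58 30 64 56 46 26 ∷
      b 33 16 57 45 9 60 ∷ b 32 15 58 46 9 61 ∷ b 25 17 39 35 16 64 ∷ b 26 18 39 36 15 64 ∷
      b 2 63 15 33 57 6 ∷ b 3 62 16 32 58 5 ∷ b 48 37 31 30 34 9 ∷ b 47 38 30 31 34 9 ∷ []) tt

    design-76 : Covering es 76 76
    design-76 = fill 4 19 1 76 1 0 [] single empty (
      b 46 38 49 4 30 52 ∷ b 18 54 61 30 43 53 ∷ b 46 11 47 23 41 32 ∷ b 8 33 20 61 37 59 ∷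
      b 4 53 31 63 27 56 ∷ b 4 24 34 29 44 61 ∷ b 36 60 42 44 55 62 ∷ b 4 59 7 67 54 73 ∷
      b 57 74 65 42 26 15 ∷ b 29 62 47 43 19 13 ∷ b 29 17 72 46 5 42 ∷ b 25 41 52 5 63 40 ∷
      b 29 15 31 71 60 50 ∷ b 14 48 70 52 16 11 ∷ b 46 40 7 55 39 10 ∷ []) tt

    design-80 : Covering es 80 80
    design-80 = fill 1 80 1 4 20 0 [] design-20 empty (
      b 61 27 0 78 18 68 ∷ b 39 15 9 60 40 37 ∷ b 47 76 1 50 34 61 ∷ []) tt

    design-81 : Covering es 81 81
    design-81 = fill 1 80 1 4 20 1 [] inner-21 single (
      b 61 27 0 78 18 68 ∷ b 39 15 9 60 40 37 ∷ b 47 76 1 50 34 61 ∷ []) tt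

    design-85 : Covering es 85 85
    design-85 = fill 2 30 2 3 20 0 ((10 , 1) ∷ (15 , 1) ∷ []) design-20 design-25 (
      b 45 57 59 24 48 28 ∷ b 77 63 53 36 38 20 ∷ b 60 84 56 39 41 58 ∷ b 50 3 65 53 16 78 ∷
      b 56 72 16 24 18 23 ∷ b 26 45 82 70 40 5 ∷ b 56 58 49 79 67 6 ∷ b 45 33 61 17 10 64 ∷
      b 39 5 43 13 76 75 ∷ []) tt

    design-96 : Covering es 96 96
    design-96 = fill 2 30 2 3 20 1 ((15 , 1) ∷ (10 , 1) ∷ (10 , 1) ∷ []) inner-21 design-36 (
      b 71 68 36 43 33 15 ∷ b 7 55 63 52 11 93 ∷ b 13 4 3 91 83 21 ∷ b 15 57 83 37 30 4 ∷
      b 62 65 42 38 17 43 ∷ b 88 84 11 29 13 3 ∷ b 48 30 11 39 50 72 ∷ b 50 8 24 79 85 40 ∷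
      b 72 78 12 50 4 36 ∷ b 18 51 76 22 5 93 ∷ b 63 89 28 1 6 22 ∷ []) tt

    design-105 : Covering es 105 105
    design-105 = fill 2 40 2 4 20 0 ((20 , 1) ∷ (5 , 1) ∷ []) design-20 design-25 (
      b 60 49 85 78 74 103 ∷ b 48 64 79 75 98 104 ∷ b 45 13 27 1 95 80 ∷ b 83 35 40 25 37 55 ∷
      b 52 60 82 64 15 43 ∷ b 43 75 21 62 54 56 ∷ b 32 87 61 31 58 74 ∷ b 94 56 63 54 21 10 ∷
      b 93 101 51 40 47 13 ∷ b 59 26 95 31 36 65 ∷ b 78 76 48 56 83 99 ∷ []) tt

    design-116 : Covering es 116 116
    design-116 = fill 2 40 2 4 20 1 ((20 , 1) ∷ (10 , 1) ∷ (5 , 1) ∷ []) inner-21 design-36 (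
      b 71 22 56 98 44 57 ∷ b 110 80 22 58 69 31 ∷ b 79 74 1 97 94 37 ∷ b 98 109 72 73 51 37 ∷
      b 57 72 47 12 84 99 ∷ b 28 96 42 22 25 17 ∷ b 48 7 66 74 111 76 ∷ b 58 35 114 39 1 9 ∷
      b 70 42 0 61 99 105 ∷ b 92 107 62 0 32 44 ∷ b 56 35 106 94 13 15 ∷ b 41 66 70 102 69 53 ∷
      b 73 62 103 85 11 67 ∷ []) tt

    κ : ℕ → ℕ → ℕ
    κ = circulant (2 ∷ 1 ∷ 2 ∷ 1 ∷ 1 ∷ 1 ∷ 1 ∷ 1 ∷ 1 ∷ 2 ∷ 1 ∷ 2 ∷ 1 ∷ 1 ∷ 1 ∷ 1 ∷ 1 ∷ 1 ∷ 2 ∷ 1 ∷ [])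

    κ-steps : Steps κ
    κ-steps = steps κ tt

    open Gadgets es κ

    gadget-0 : Gadget
    gadget-0 = gadget 0 (developed 20 ((20 , 1) ∷ (20 , 1) ∷ (20 , 1) ∷ (20 , 1) ∷ []) (
      b 20 24 1 52 41 62 ∷ b 20 38 4 13 53 44 ∷ [])) tt

    gadget-10 : Gadget
    gadget-10 = gadget 10 (developed 20 ((20 , 1) ∷ (20 , 1) ∷ (20 , 1) ∷ (20 , 1) ∷ (10 , 1) ∷ []) (
      b 51 84 78 35 36 2 ∷ b 40 49 32 79 83 28 ∷ b 69 71 45 46 31 86 ∷ [])) tt

    gadget-15 : Gadget
    gadget-15 = gadget 15 (developed 10 ((20 , 2) ∷ (20 , 2) ∷ (20 , 2) ∷ (20 , 2) ∷ (10 , 1) ∷ (5 , 1) ∷ []) (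
      b 91 31 6 47 55 60 ∷ b 55 27 89 78 13 94 ∷ b 27 22 17 8 87 93 ∷ b 88 83 58 2 16 37 ∷
      b 23 38 44 2 6 42 ∷ b 28 21 58 79 87 56 ∷ b 52 53 65 87 25 79 ∷ [])) tt

    gadget-20 : Gadget
    gadget-20 = gadget 20 (developed 20 ((20 , 1) ∷ (20 , 1) ∷ (20 , 1) ∷ (20 , 1) ∷ (20 , 1) ∷ []) (
      b 68 72 87 30 45 42 ∷ b 2 67 42 53 38 94 ∷ b 2 56 85 87 37 23 ∷ b 97 93 40 39 77 47 ∷ [])) tt

    gadget-30 : Gadget
    gadget-30 = gadget 30 (developed 20 ((20 , 1) ∷ (20 , 1) ∷ (20 , 1) ∷ (20 , 1) ∷ (20 , 1) ∷ (10 , 1) ∷ []) (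
      b 95 99 44 41 74 3 ∷ b 84 106 51 40 36 67 ∷ b 68 5 37 54 45 106 ∷ b 44 55 61 108 39 31 ∷
      b 84 91 22 25 41 4 ∷ [])) tt

    gadget-40 : Gadget
    gadget-40 = gadget 40 (developed 20 ((20 , 1) ∷ (20 , 1) ∷ (20 , 1) ∷ (20 , 1) ∷ (20 , 1) ∷ (10 , 1) ∷ (10 , 1) ∷ []) (
      b 86 111 29 14 45 27 ∷ b 87 84 37 2 49 44 ∷ b 43 91 5 37 35 3 ∷ b 85 103 36 21 12 14 ∷
      b 20 22 57 41 115 111 ∷ b 22 20 71 100 106 17 ∷ [])) tt

    open Families es κ κ-steps gadget-0 refl

    module Inner₁ = Inner {1} inner-21 (≤ᵇ⇒≤ _ _ tt)
    module Inner₀ = Inner {0} design-20 (≤ᵇ⇒≤ _ _ tt)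

    cover-0 : ∀ t → Covering es (0 + t * 20) (0 + t * 20)
    cover-0 0 = empty
    cover-0 1 = design-20
    cover-0 2 = design-40
    cover-0 3 = design-60
    cover-0 4 = design-80
    cover-0 (suc (suc (suc (suc (suc t))))) = six (λ t → Covering es (0 + (5 + t) * 20) (0 + (5 + t) * 20))
      (λ w → Inner₀.family₅ 0 0 [] refl empty w (z≤n))
      (λ w → Inner₀.family₅ 0 1 (gadget-20 ∷ []) refl design-20 w (s≤s z≤n))
      (λ w → Inner₀.family₇ 0 0 [] refl empty w (z≤n))
      (λ w → Inner₀.family₇ 0 1 (gadget-20 ∷ []) refl design-20 w (s≤s z≤n))
      (λ w → Inner₀.family₇ 0 2 (gadget-20 ∷ gadget-20 ∷ []) refl design-40 w (s≤s (s≤s z≤n)))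
      (λ w → Inner₀.family₇ 0 3 (gadget-20 ∷ gadget-20 ∷ gadget-20 ∷ []) refl design-60 w (s≤s (s≤s (s≤s z≤n))))
      t

    cover-1 : ∀ t → Covering es (1 + t * 20) (1 + t * 20)
    cover-1 0 = single
    cover-1 1 = design-21
    cover-1 2 = design-41
    cover-1 3 = design-61
    cover-1 4 = design-81
    cover-1 (suc (suc (suc (suc (suc t))))) = six (λ t → Covering es (1 + (5 + t) * 20) (1 + (5 + t) * 20))
      (λ w → Inner₁.family₅ 1 0 [] refl single w (z≤n))
      (λ w → Inner₁.family₅ 1 1 (gadget-20 ∷ []) refl design-21 w (s≤s z≤n))
      (λ w → Inner₁.family₇ 1 0 [] refl single w (z≤n))
      (λ w → Inner₁.family₇ 1 1 (gadget-20 ∷ []) refl design-21 w (s≤s z≤n))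
      (λ w → Inner₁.family₇ 1 2 (gadget-20 ∷ gadget-20 ∷ []) refl design-41 w (s≤s (s≤s z≤n)))
      (λ w → Inner₁.family₇ 1 3 (gadget-20 ∷ gadget-20 ∷ gadget-20 ∷ []) refl design-61 w (s≤s (s≤s (s≤s z≤n))))
      t

    cover-5 : ∀ t → Covering es (5 + suc t * 20) (5 + suc t * 20)
    cover-5 0 = design-25
    cover-5 1 = design-45
    cover-5 2 = design-65
    cover-5 3 = design-85
    cover-5 4 = design-105
    cover-5 (suc (suc (suc (suc (suc t))))) = six (λ t → Covering es (5 + (6 + t) * 20) (5 + (6 + t) * 20))
      (λ w → Inner₀.family₅ 5 1 (gadget-10 ∷ gadget-15 ∷ []) refl design-25 w (s≤s (s≤s z≤n)))
      (λ w → Inner₀.family₅ 5 2 (gadget-15 ∷ gadget-30 ∷ []) refl design-45 w (s≤s (s≤s z≤n)))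
      (λ w → Inner₀.family₇ 5 1 (gadget-10 ∷ gadget-15 ∷ []) refl design-25 w (s≤s (s≤s z≤n)))
      (λ w → Inner₀.family₇ 5 2 (gadget-15 ∷ gadget-30 ∷ []) refl design-45 w (s≤s (s≤s z≤n)))
      (λ w → Inner₀.family₇ 5 3 (gadget-15 ∷ gadget-20 ∷ gadget-30 ∷ []) refl design-65 w (s≤s (s≤s (s≤s z≤n))))
      (λ w → Inner₀.family₇ 5 4 (gadget-15 ∷ gadget-30 ∷ gadget-40 ∷ []) refl design-85 w (s≤s (s≤s (s≤s z≤n))))
      t

    cover-16 : ∀ t → Covering es (16 + suc t * 20) (16 + suc t * 20)
    cover-16 0 = design-36
    cover-16 1 = design-56
    cover-16 2 = design-76
    cover-16 3 = design-96
    cover-16 4 = design-116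
    cover-16 (suc (suc (suc (suc (suc t))))) = six (λ t → Covering es (16 + (6 + t) * 20) (16 + (6 + t) * 20))
      (λ w → Inner₁.family₅ 16 1 (gadget-15 ∷ gadget-20 ∷ []) refl design-36 w (s≤s (s≤s z≤n)))
      (λ w → Inner₁.family₅ 16 2 (gadget-15 ∷ gadget-40 ∷ []) refl design-56 w (s≤s (s≤s z≤n)))
      (λ w → Inner₁.family₇ 16 1 (gadget-15 ∷ gadget-20 ∷ []) refl design-36 w (s≤s (s≤s z≤n)))
      (λ w → Inner₁.family₇ 16 2 (gadget-15 ∷ gadget-40 ∷ []) refl design-56 w (s≤s (s≤s z≤n)))
      (λ w → Inner₁.family₇ 16 3 (gadget-15 ∷ gadget-30 ∷ gadget-30 ∷ []) refl design-76 w (s≤s (s≤s (s≤s z≤n))))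
      (λ w → Inner₁.family₇ 16 4 (gadget-15 ∷ gadget-40 ∷ gadget-40 ∷ []) refl design-96 w (s≤s (s≤s (s≤s z≤n))))
      t

    cover : ∀ n → Admissible (n % 20) → n ≢ 5 → n ≢ 16 → Covering es n n
    cover = by-residue (λ n → n ≢ 5 → n ≢ 16 → Covering es n n)
      (λ t _ _ → cover-0 t)
      (λ t _ _ → cover-1 t)
      (λ { zero n≢5 _ → contradiction refl n≢5 ; (suc t) _ _ → cover-5 t })
      (λ { zero _ n≢16 → contradiction refl n≢16 ; (suc t) _ _ → cover-16 t })

  -- The designs of `n₁₀`

  module Coverings₁₀ where

    es : Edges
    es = (v4 , v3) ∷ (v4 , v2) ∷ (v4 , v5) ∷ (v4 , v1) ∷ (v6 , v1) ∷ (v3 , v2) ∷ (v3 , v5) ∷ (v3 , v1) ∷ (v2 , v5) ∷ (v2 , v1) ∷ []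

    open Fillings es

    design-20 : Covering es 20 20
    design-20 = fill 1 19 1 19 1 0 ((1 , 1) ∷ []) single single (
      b 4 8 16 14 13 19 ∷ []) tt

    design-21 : Covering es 21 21
    design-21 = fill 1 21 1 21 1 0 [] single empty (
      b 19 15 8 0 20 1 ∷ []) tt

    inner-21 : Covering es 20 21
    inner-21 = puncture design-21

    design-25 : Covering es 25 25
    design-25 = fill 5 5 1 25 1 0 [] single empty (
      b 12 19 20 0 13 6 ∷ b 20 22 23 17 19 2 ∷ b 24 14 23 11 9 12 ∷ b 0 11 21 4 12 9 ∷ b 10 20 18 1 21 24 ∷
      b 3 12 1 8 22 13 ∷ []) tt

    design-36 : Covering es 36 36
    design-36 = fill 4 9 1 36 1 0 [] single empty (
      b 4 8 29 14 20 7 ∷ b 25 24 19 11 7 8 ∷ b 25 3 18 29 2 30 ∷ b 34 17 1 7 25 3 ∷ b 23 6 10 8 34 7 ∷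
      b 2 20 27 25 28 31 ∷ b 18 15 4 17 24 32 ∷ []) tt

    design-40 : Covering es 40 40
    design-40 = fill 1 39 1 39 1 0 ((1 , 1) ∷ []) single single (
      b 16 32 15 22 13 39 ∷ b 29 26 5 1 13 34 ∷ []) tt

    design-41 : Covering es 41 41
    design-41 = fill 1 41 1 41 1 0 [] single empty (
      b 23 25 31 30 8 9 ∷ b 10 14 1 30 4 40 ∷ []) tt

    design-45 : Covering es 45 45
    design-45 = fill 4 11 1 44 1 0 ((1 , 1) ∷ []) single single (
      b 34 6 26 20 23 2 ∷ b 31 38 5 29 40 0 ∷ b 8 44 18 1 19 31 ∷ b 16 37 34 38 15 32 ∷
      b 35 29 37 24 23 2 ∷ b 23 9 19 14 43 10 ∷ b 17 1 30 5 4 10 ∷ b 36 32 24 26 5 21 ∷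
      b 7 32 12 39 3 35 ∷ []) tt

    design-56 : Covering es 56 56
    design-56 = fill 5 11 1 55 1 0 ((1 , 1) ∷ []) single single (
      b 12 19 1 41 51 8 ∷ b 10 55 3 31 22 17 ∷ b 34 43 52 39 51 42 ∷ b 10 35 25 48 4 11 ∷
      b 39 40 1 3 21 55 ∷ b 45 29 4 49 28 40 ∷ b 51 26 3 0 19 4 ∷ b 46 27 3 44 50 43 ∷ b 2 35 47 26 22 0 ∷
      b 29 7 23 1 25 44 ∷ b 23 48 6 22 19 3 ∷ b 45 42 19 7 47 1 ∷ b 47 0 6 20 9 33 ∷ b 47 13 53 3 25 49 ∷ []) tt

    design-60 : Covering es 60 60
    design-60 = fill 1 59 1 59 1 0 ((1 , 1) ∷ []) single single (
      b 55 40 28 22 18 25 ∷ b 13 11 14 6 49 0 ∷ b 40 0 9 23 48 59 ∷ []) tt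

    design-61 : Covering es 61 61
    design-61 = fill 1 61 1 61 1 0 [] single empty (
      b 60 30 46 34 43 41 ∷ b 14 50 55 48 40 38 ∷ b 25 42 43 4 10 36 ∷ []) tt

    design-65 : Covering es 65 65
    design-65 = fill 5 13 1 65 1 0 [] single empty (
      b 2 17 46 27 4 64 ∷ b 17 15 1 43 34 19 ∷ b 52 38 41 47 6 19 ∷ b 19 55 10 62 31 5 ∷
      b 14 25 16 19 7 62 ∷ b 3 23 20 57 63 10 ∷ b 63 29 51 46 50 36 ∷ b 4 16 41 34 26 54 ∷
      b 40 15 21 50 7 63 ∷ b 0 13 11 18 31 8 ∷ b 18 64 39 26 63 29 ∷ b 38 37 8 57 40 62 ∷
      b 24 25 52 20 51 42 ∷ b 37 44 64 58 48 29 ∷ b 48 52 26 10 22 63 ∷ b 60 34 44 10 8 48 ∷ []) tt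

    design-76 : Covering es 76 76
    design-76 = fill 4 19 1 76 1 0 [] single empty (
      b 72 33 54 16 15 60 ∷ b 30 62 39 34 55 21 ∷ b 22 51 6 12 7 32 ∷ b 7 42 27 68 65 32 ∷
      b 38 4 37 12 64 69 ∷ b 49 74 60 37 11 41 ∷ b 44 40 27 72 63 66 ∷ b 64 35 28 9 31 73 ∷
      b 31 52 19 21 70 73 ∷ b 24 29 26 9 69 22 ∷ b 34 48 41 26 59 54 ∷ b 5 53 19 49 43 68 ∷
      b 69 75 45 58 47 50 ∷ b 47 61 39 66 20 50 ∷ b 17 46 16 58 22 64 ∷ []) tt

    design-80 : Covering es 80 80
    design-80 = fill 1 80 1 4 20 0 [] design-20 empty (
      b 59 54 40 53 11 24 ∷ b 29 55 32 62 73 7 ∷ b 20 66 51 41 68 11 ∷ []) tt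

    design-81 : Covering es 81 81
    design-81 = fill 1 80 1 4 20 1 [] inner-21 single (
      b 59 54 40 53 11 24 ∷ b 29 55 32 62 73 7 ∷ b 20 66 51 41 68 11 ∷ []) tt

    design-85 : Covering es 85 85
    design-85 = fill 2 30 2 3 20 0 ((10 , 1) ∷ (15 , 1) ∷ []) design-20 design-25 (
      b 26 78 25 34 21 70 ∷ b 78 43 59 32 64 52 ∷ b 43 51 61 58 30 15 ∷ b 30 45 10 74 7 70 ∷
      b 34 66 12 51 10 64 ∷ b 72 32 35 37 79 19 ∷ b 64 51 18 41 62 53 ∷ b 46 74 2 12 58 67 ∷
      b 7 76 33 53 24 77 ∷ []) tt

    design-96 : Covering es 96 96
    design-96 = fill 2 30 2 3 20 1 ((15 , 1) ∷ (10 , 1) ∷ (10 , 1) ∷ []) inner-21 design-36 (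
      b 77 18 56 22 93 13 ∷ b 54 82 39 41 31 68 ∷ b 65 11 38 7 85 17 ∷ b 90 7 39 46 67 20 ∷
      b 88 50 40 7 77 29 ∷ b 70 31 53 50 94 39 ∷ b 78 8 19 5 85 47 ∷ b 72 33 58 7 68 16 ∷
      b 24 83 40 26 31 39 ∷ b 73 44 36 16 70 40 ∷ b 43 59 67 20 19 81 ∷ []) tt

    design-105 : Covering es 105 105
    design-105 = fill 2 40 2 4 20 0 ((20 , 1) ∷ (5 , 1) ∷ []) design-20 design-25 (
      b 94 18 48 31 88 37 ∷ b 78 24 42 87 22 13 ∷ b 29 92 78 19 20 102 ∷ b 58 81 63 1 36 45 ∷
      b 74 33 98 63 19 95 ∷ b 1 5 104 39 2 92 ∷ b 101 44 30 11 40 12 ∷ b 47 69 98 67 15 36 ∷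
      b 44 41 6 35 94 56 ∷ b 40 3 15 87 76 102 ∷ b 34 97 0 6 59 29 ∷ []) tt

    design-116 : Covering es 116 116
    design-116 = fill 2 40 2 4 20 1 ((20 , 1) ∷ (10 , 1) ∷ (5 , 1) ∷ []) inner-21 design-36 (
      b 51 105 4 54 9 100 ∷ b 15 89 28 65 6 37 ∷ b 113 56 55 3 111 44 ∷ b 89 0 19 36 112 2 ∷
      b 98 55 74 17 95 5 ∷ b 23 34 104 37 24 97 ∷ b 64 55 99 29 9 5 ∷ b 43 48 84 28 2 14 ∷
      b 31 19 13 103 23 67 ∷ b 28 10 22 87 53 67 ∷ b 93 9 2 78 98 19 ∷ b 3 28 1 99 30 94 ∷
      b 103 16 54 68 108 29 ∷ []) tt

    -- The largest gadget for this graph has 30 further points. The hole of order 56 therefore takes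
    -- three gadgets, while five parts admit two; the holes of order 85 and 96 take four, while
    -- seven parts admit three. This leaves the orders 156, 225 and 236.
    design-156 : Covering es 156 156
    design-156 = fill 1 111 1 111 1 0 ((37 , 1) ∷ (3 , 1) ∷ (3 , 1) ∷ (1 , 1) ∷ (1 , 1) ∷ []) single design-45 (
      b 92 52 26 136 80 155 ∷ b 7 95 54 116 84 62 ∷ b 62 64 65 99 83 142 ∷ b 48 69 2 122 82 154 ∷
      b 126 28 14 22 122 87 ∷ b 6 33 92 140 75 57 ∷ b 2 118 104 17 29 126 ∷ b 20 99 92 70 149 0 ∷
      b 123 8 4 57 153 32 ∷ b 127 72 4 105 67 22 ∷ []) tt

    design-225 : Covering es 225 225
    design-225 = fill 1 225 1 5 45 0 [] design-45 empty (
      b 188 202 20 196 93 199 ∷ b 48 126 217 99 38 186 ∷ b 163 42 140 104 173 6 ∷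
      b 11 103 119 137 200 189 ∷ b 180 154 163 192 161 113 ∷ b 93 157 199 56 223 7 ∷
      b 111 164 35 183 186 90 ∷ b 37 5 33 116 117 108 ∷ b 145 97 43 56 4 189 ∷ []) tt

    design-236 : Covering es 236 236
    design-236 = fill 1 171 1 171 1 0 ((19 , 1) ∷ (19 , 1) ∷ (9 , 1) ∷ (9 , 1) ∷ (9 , 1) ∷ []) single design-65 (
      b 7 109 129 235 144 214 ∷ b 153 193 135 95 105 122 ∷ b 67 78 24 171 168 224 ∷ b 4 149 146 213 61 46 ∷
      b 29 41 109 113 185 235 ∷ b 120 6 0 221 38 133 ∷ b 155 96 57 208 32 79 ∷ b 195 122 167 130 158 106 ∷
      b 21 220 88 121 69 103 ∷ b 125 81 230 64 57 187 ∷ b 198 39 160 55 202 2 ∷ b 54 162 172 102 164 88 ∷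
      b 113 19 168 169 72 90 ∷ b 214 119 49 54 188 127 ∷ b 126 79 171 1 93 167 ∷ []) tt

    κ : ℕ → ℕ → ℕ
    κ = circulant (1 ∷ 1 ∷ 1 ∷ 3 ∷ 2 ∷ 2 ∷ 1 ∷ 1 ∷ 2 ∷ 1 ∷ 2 ∷ 1 ∷ 2 ∷ 1 ∷ 1 ∷ 2 ∷ 2 ∷ 3 ∷ 1 ∷ 1 ∷ [])

    κ-steps : Steps κ
    κ-steps = steps κ tt

    open Gadgets es κ

    gadget-0 : Gadget
    gadget-0 = gadget 0 (developed 20 ((20 , 1) ∷ (20 , 1) ∷ (20 , 1) ∷ (20 , 1) ∷ []) (
      b 20 1 53 64 39 0 ∷ b 20 13 41 70 35 76 ∷ [])) tt

    gadget-10 : Gadget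
    gadget-10 = gadget 10 (developed 20 ((20 , 1) ∷ (20 , 1) ∷ (20 , 1) ∷ (20 , 1) ∷ (10 , 1) ∷ []) (
      b 22 15 72 51 80 2 ∷ b 56 30 75 12 44 8 ∷ b 88 71 58 36 82 5 ∷ [])) tt

    gadget-15 : Gadget
    gadget-15 = gadget 15 (developed 10 ((20 , 2) ∷ (20 , 2) ∷ (20 , 2) ∷ (20 , 2) ∷ (10 , 1) ∷ (5 , 1) ∷ []) (
      b 2 81 65 52 21 94 ∷ b 16 27 41 93 9 23 ∷ b 1 78 85 22 44 21 ∷ b 28 60 81 47 17 48 ∷
      b 61 33 86 59 68 91 ∷ b 26 70 94 44 25 61 ∷ b 84 25 61 52 4 30 ∷ [])) tt

    gadget-20 : Gadget
    gadget-20 = gadget 20 (developed 20 ((20 , 1) ∷ (20 , 1) ∷ (20 , 1) ∷ (20 , 1) ∷ (20 , 1) ∷ []) (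
      b 76 94 43 21 7 56 ∷ b 80 44 12 75 98 56 ∷ b 24 84 69 43 25 94 ∷ b 95 33 6 63 54 58 ∷ [])) tt

    gadget-30 : Gadget
    gadget-30 = gadget 30 (developed 20 ((20 , 1) ∷ (20 , 1) ∷ (20 , 1) ∷ (20 , 1) ∷ (20 , 1) ∷ (10 , 1) ∷ []) (
      b 48 16 80 29 79 28 ∷ b 27 85 56 63 35 93 ∷ b 80 72 37 15 105 43 ∷ b 102 37 3 48 109 55 ∷
      b 92 57 39 13 93 45 ∷ [])) tt

    open Families es κ κ-steps gadget-0 refl

    module Inner₁ = Inner {1} inner-21 (≤ᵇ⇒≤ _ _ tt)
    module Inner₀ = Inner {0} design-20 (≤ᵇ⇒≤ _ _ tt)

    cover-0 : ∀ t → Covering es (0 + t * 20) (0 + t * 20)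
    cover-0 0 = empty
    cover-0 1 = design-20
    cover-0 2 = design-40
    cover-0 3 = design-60
    cover-0 4 = design-80
    cover-0 (suc (suc (suc (suc (suc t))))) = six (λ t → Covering es (0 + (5 + t) * 20) (0 + (5 + t) * 20))
      (λ w → Inner₀.family₅ 0 0 [] refl empty w (z≤n))
      (λ w → Inner₀.family₅ 0 1 (gadget-20 ∷ []) refl design-20 w (s≤s z≤n))
      (λ w → Inner₀.family₇ 0 0 [] refl empty w (z≤n))
      (λ w → Inner₀.family₇ 0 1 (gadget-20 ∷ []) refl design-20 w (s≤s z≤n))
      (λ w → Inner₀.family₇ 0 2 (gadget-20 ∷ gadget-20 ∷ []) refl design-40 w (s≤s (s≤s z≤n)))
      (λ w → Inner₀.family₇ 0 3 (gadget-20 ∷ gadget-20 ∷ gadget-20 ∷ []) refl design-60 w (s≤s (s≤s (s≤s z≤n))))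
      t

    cover-1 : ∀ t → Covering es (1 + t * 20) (1 + t * 20)
    cover-1 0 = single
    cover-1 1 = design-21
    cover-1 2 = design-41
    cover-1 3 = design-61
    cover-1 4 = design-81
    cover-1 (suc (suc (suc (suc (suc t))))) = six (λ t → Covering es (1 + (5 + t) * 20) (1 + (5 + t) * 20))
      (λ w → Inner₁.family₅ 1 0 [] refl single w (z≤n))
      (λ w → Inner₁.family₅ 1 1 (gadget-20 ∷ []) refl design-21 w (s≤s z≤n))
      (λ w → Inner₁.family₇ 1 0 [] refl single w (z≤n))
      (λ w → Inner₁.family₇ 1 1 (gadget-20 ∷ []) refl design-21 w (s≤s z≤n))
      (λ w → Inner₁.family₇ 1 2 (gadget-20 ∷ gadget-20 ∷ []) refl design-41 w (s≤s (s≤s z≤n)))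
      (λ w → Inner₁.family₇ 1 3 (gadget-20 ∷ gadget-20 ∷ gadget-20 ∷ []) refl design-61 w (s≤s (s≤s (s≤s z≤n))))
      t

    cover-5 : ∀ t → Covering es (5 + suc t * 20) (5 + suc t * 20)
    cover-5 0 = design-25
    cover-5 1 = design-45
    cover-5 2 = design-65
    cover-5 3 = design-85
    cover-5 4 = design-105
    cover-5 (suc (suc (suc (suc (suc t))))) = six (λ t → Covering es (5 + (6 + t) * 20) (5 + (6 + t) * 20))
      (λ w → Inner₀.family₅ 5 1 (gadget-10 ∷ gadget-15 ∷ []) refl design-25 w (s≤s (s≤s z≤n)))
      (λ w → Inner₀.family₅ 5 2 (gadget-15 ∷ gadget-30 ∷ []) refl design-45 w (s≤s (s≤s z≤n)))
      (λ w → Inner₀.family₇ 5 1 (gadget-10 ∷ gadget-15 ∷ []) refl design-25 w (s≤s (s≤s z≤n)))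
      (λ w → Inner₀.family₇ 5 2 (gadget-15 ∷ gadget-30 ∷ []) refl design-45 w (s≤s (s≤s z≤n)))
      (λ w → Inner₀.family₇ 5 3 (gadget-15 ∷ gadget-20 ∷ gadget-30 ∷ []) refl design-65 w (s≤s (s≤s (s≤s z≤n))))
      (λ { zero → design-225 ; (suc w) → Inner₀.family₇ 5 4 (gadget-15 ∷ gadget-20 ∷ gadget-20 ∷ gadget-30 ∷ []) refl design-85 (suc w) (s≤s (s≤s (s≤s (s≤s z≤n)))) })
      t

    cover-16 : ∀ t → Covering es (16 + suc t * 20) (16 + suc t * 20)
    cover-16 0 = design-36
    cover-16 1 = design-56
    cover-16 2 = design-76
    cover-16 3 = design-96
    cover-16 4 = design-116
    cover-16 (suc (suc (suc (suc (suc t))))) = six (λ t → Covering es (16 + (6 + t) * 20) (16 + (6 + t) * 20))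
      (λ w → Inner₁.family₅ 16 1 (gadget-15 ∷ gadget-20 ∷ []) refl design-36 w (s≤s (s≤s z≤n)))
      (λ { zero → design-156 ; (suc w) → Inner₁.family₅ 16 2 (gadget-15 ∷ gadget-20 ∷ gadget-20 ∷ []) refl design-56 (suc w) (s≤s (s≤s (s≤s z≤n))) })
      (λ w → Inner₁.family₇ 16 1 (gadget-15 ∷ gadget-20 ∷ []) refl design-36 w (s≤s (s≤s z≤n)))
      (λ w → Inner₁.family₇ 16 2 (gadget-15 ∷ gadget-20 ∷ gadget-20 ∷ []) refl design-56 w (s≤s (s≤s (s≤s z≤n))))
      (λ w → Inner₁.family₇ 16 3 (gadget-15 ∷ gadget-30 ∷ gadget-30 ∷ []) refl design-76 w (s≤s (s≤s (s≤s z≤n))))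
      (λ { zero → design-236 ; (suc w) → Inner₁.family₇ 16 4 (gadget-15 ∷ gadget-20 ∷ gadget-30 ∷ gadget-30 ∷ []) refl design-96 (suc w) (s≤s (s≤s (s≤s (s≤s z≤n)))) })
      t

    cover : ∀ n → Admissible (n % 20) → n ≢ 5 → n ≢ 16 → Covering es n n
    cover = by-residue (λ n → n ≢ 5 → n ≢ 16 → Covering es n n)
      (λ t _ _ → cover-0 t)
      (λ t _ _ → cover-1 t)
      (λ { zero n≢5 _ → contradiction refl n≢5 ; (suc t) _ _ → cover-5 t })
      (λ { zero _ n≢16 → contradiction refl n≢16 ; (suc t) _ _ → cover-16 t })

  -- The designs of `n₁₃`

  module Coverings₁₃ where

    es : Edges
    es = (v6 , v4) ∷ (v6 , v3) ∷ (v6 , v1) ∷ (v5 , v3) ∷ (v5 , v2) ∷ (v5 , v1) ∷ (v4 , v2) ∷ (v4 , v1) ∷ (v3 , v1) ∷ (v2 , v1) ∷ []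

    open Fillings es

    design-21 : Covering es 21 21
    design-21 = fill 1 21 1 21 1 0 [] single empty (
      b 8 18 10 3 1 11 ∷ []) tt

    inner-21 : Covering es 20 21
    inner-21 = puncture design-21

    design-25 : Covering es 25 25
    design-25 = fill 5 5 1 25 1 0 [] single empty (
      b 19 6 15 14 5 23 ∷ b 19 10 22 21 17 0 ∷ b 13 20 3 8 22 14 ∷ b 18 21 16 7 11 17 ∷ b 18 15 22 20 6 1 ∷
      b 19 12 7 4 20 1 ∷ []) tt

    design-36 : Covering es 36 36
    design-36 = fill 4 9 1 36 1 0 [] single empty (
      b 27 7 23 17 32 5 ∷ b 2 7 11 18 35 30 ∷ b 1 30 34 28 9 17 ∷ b 21 28 16 0 15 4 ∷ b 1 10 5 24 3 6 ∷
      b 5 8 4 18 11 19 ∷ b 4 10 2 20 23 34 ∷ []) tt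

    design-40 : Covering es 40 40
    design-40 = fill 3 13 1 39 1 0 ((1 , 1) ∷ []) single single (
      b 36 10 9 5 12 30 ∷ b 21 5 2 23 12 1 ∷ b 12 29 7 39 23 4 ∷ b 7 35 17 38 5 31 ∷ b 22 35 26 36 0 2 ∷
      b 37 21 31 28 10 27 ∷ []) tt

    design-41 : Covering es 41 41
    design-41 = fill 1 41 1 41 1 0 [] single empty (
      b 39 18 35 27 4 28 ∷ b 26 39 7 0 31 23 ∷ []) tt

    design-45 : Covering es 45 45
    design-45 = fill 5 9 1 45 1 0 [] single empty (
      b 33 6 20 40 21 38 ∷ b 30 2 16 21 39 26 ∷ b 4 0 44 27 16 20 ∷ b 33 31 32 22 3 29 ∷
      b 1 23 19 33 32 44 ∷ b 15 3 10 27 29 25 ∷ b 12 11 18 36 24 39 ∷ b 15 21 4 40 14 18 ∷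
      b 15 12 9 2 37 7 ∷ b 33 7 2 37 36 41 ∷ b 13 38 14 30 29 6 ∷ []) tt

    design-56 : Covering es 56 56
    design-56 = fill 5 11 1 55 1 0 ((1 , 1) ∷ []) single single (
      b 19 7 5 28 18 21 ∷ b 12 16 30 26 20 18 ∷ b 25 14 47 18 12 36 ∷ b 32 29 3 8 35 31 ∷
      b 41 49 32 8 26 14 ∷ b 30 51 37 48 9 10 ∷ b 10 46 29 12 11 19 ∷ b 25 31 37 0 33 53 ∷
      b 45 22 40 5 14 44 ∷ b 29 34 12 9 41 42 ∷ b 55 23 46 54 20 22 ∷ b 18 17 37 32 1 27 ∷
      b 43 18 53 54 38 14 ∷ b 46 33 24 0 21 41 ∷ []) tt

    -- Three parts of 20 points cannot be filled alone for this graph. Instead 39 points are rotated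
    -- around a hole of order 21, whose points form cycles of length 3.
    design-60 : Covering es 60 60
    design-60 = fill 1 39 1 39 1 0 ((3 , 1) ∷ (3 , 1) ∷ (3 , 1) ∷ (3 , 1) ∷ (3 , 1) ∷ (3 , 1) ∷ (3 , 1) ∷ []) single design-21 (
      b 8 40 18 16 30 51 ∷ b 25 47 27 14 18 56 ∷ b 36 23 37 49 43 1 ∷ b 27 9 58 33 32 13 ∷ []) tt

    design-61 : Covering es 61 61
    design-61 = fill 1 61 1 61 1 0 [] single empty (
      b 55 33 39 50 24 27 ∷ b 2 1 42 60 28 10 ∷ b 4 0 22 10 41 58 ∷ []) tt

    design-65 : Covering es 65 65
    design-65 = fill 5 13 1 65 1 0 [] single empty (
      b 0 62 47 60 38 34 ∷ b 0 49 10 46 52 24 ∷ b 0 36 43 37 48 27 ∷ b 0 51 12 25 23 31 ∷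
      b 0 28 1 21 22 61 ∷ b 0 13 56 54 33 64 ∷ b 0 20 59 18 8 57 ∷ b 0 58 32 19 7 15 ∷ b 1 25 58 54 55 56 ∷
      b 1 59 29 46 50 63 ∷ b 2 41 47 63 11 62 ∷ b 2 33 37 29 51 6 ∷ b 3 16 58 22 43 4 ∷ b 3 9 19 59 36 38 ∷
      b 4 27 37 44 49 9 ∷ b 4 51 12 62 36 33 ∷ []) tt

    design-76 : Covering es 76 76
    design-76 = fill 4 19 1 76 1 0 [] single empty (
      b 41 10 70 47 67 49 ∷ b 75 67 10 22 62 31 ∷ b 70 16 69 26 66 34 ∷ b 0 65 44 6 9 57 ∷
      b 35 70 71 32 10 2 ∷ b 54 56 20 7 71 34 ∷ b 51 71 56 64 40 47 ∷ b 20 37 22 16 68 72 ∷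
      b 1 70 5 28 58 14 ∷ b 75 20 23 73 56 0 ∷ b 60 13 65 31 23 72 ∷ b 35 23 13 69 53 7 ∷
      b 65 26 64 37 21 49 ∷ b 2 20 30 45 12 8 ∷ b 51 65 67 50 13 1 ∷ []) tt

    -- This replaces the missing design of order 20: a part is filled together with ten points of
    -- the hole, whose 45 mutual pairs stay uncovered. The other 390 pairs make 39 blocks.
    cover-30 : Covering es 20 30
    cover-30 = covering es 20 30 (
      b 1 0 16 26 27 17 ∷ b 0 20 3 18 19 2 ∷ b 0 21 7 8 9 6 ∷ b 0 22 5 16 17 4 ∷ b 0 23 13 10 11 12 ∷
      b 20 1 8 13 12 9 ∷ b 21 1 19 5 4 18 ∷ b 22 1 11 18 19 10 ∷ b 23 1 14 8 9 15 ∷ b 2 24 28 12 8 14 ∷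
      b 3 25 29 13 9 15 ∷ b 2 22 27 5 15 13 ∷ b 3 22 26 4 14 12 ∷ b 2 11 6 4 21 20 ∷ b 3 10 7 5 21 20 ∷
      b 2 25 7 16 19 23 ∷ b 3 24 6 17 18 23 ∷ b 4 24 10 13 15 28 ∷ b 5 25 11 12 14 29 ∷
      b 6 13 16 29 26 19 ∷ b 7 12 17 28 27 18 ∷ b 8 14 26 16 4 5 ∷ b 9 15 27 17 5 4 ∷ b 10 9 26 24 2 19 ∷
      b 11 8 27 25 3 18 ∷ b 12 9 6 19 22 15 ∷ b 13 8 7 18 22 14 ∷ b 14 24 29 1 0 10 ∷ b 15 25 28 1 0 11 ∷
      b 16 15 13 20 21 10 ∷ b 17 14 12 20 21 11 ∷ b 18 12 4 16 23 29 ∷ b 19 13 5 17 23 28 ∷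
      b 24 7 11 5 16 6 ∷ b 25 6 10 4 17 7 ∷ b 26 15 9 7 18 11 ∷ b 27 14 8 6 19 10 ∷ b 28 1 16 6 3 9 ∷
      b 29 1 17 7 2 8 ∷ []) tt

    design-80 : Covering es 80 80
    design-80 = fill 5 11 1 55 1 0 ((11 , 1) ∷ (11 , 1) ∷ (1 , 1) ∷ (1 , 1) ∷ (1 , 1) ∷ []) single design-25 (
      b 77 9 23 27 46 15 ∷ b 78 32 54 11 38 40 ∷ b 79 24 28 47 16 5 ∷ b 66 49 18 7 21 25 ∷
      b 66 42 34 51 13 35 ∷ b 66 2 4 1 3 0 ∷ b 50 5 27 46 35 58 ∷ b 74 8 37 14 18 1 ∷ b 61 18 23 35 45 37 ∷
      b 2 35 12 71 62 51 ∷ b 41 16 23 27 51 64 ∷ b 68 19 53 30 49 2 ∷ b 62 49 9 51 26 53 ∷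
      b 3 51 33 70 65 42 ∷ b 12 47 9 23 42 60 ∷ b 72 45 44 36 25 3 ∷ b 65 25 15 42 22 44 ∷
      b 4 42 39 67 63 13 ∷ b 33 28 15 9 13 59 ∷ b 73 26 10 52 21 4 ∷ b 63 21 46 13 8 10 ∷
      b 0 13 50 69 57 34 ∷ b 39 24 46 15 34 56 ∷ b 76 22 31 43 7 0 ∷ b 57 7 27 34 19 31 ∷
      b 1 34 41 75 61 35 ∷ []) tt

    design-81 : Covering es 81 81
    design-81 = fill 1 80 1 4 20 1 [] inner-21 single (
      b 66 5 23 31 0 72 ∷ b 1 30 54 51 12 64 ∷ b 63 65 16 56 62 41 ∷ []) tt

    design-85 : Covering es 85 85
    design-85 = fill 2 30 2 3 20 10 ((15 , 1) ∷ []) cover-30 design-25 (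
      b 20 62 65 37 42 53 ∷ b 28 26 38 60 13 49 ∷ b 60 31 45 4 41 7 ∷ b 15 13 36 70 16 29 ∷
      b 3 40 23 74 54 55 ∷ b 74 4 28 45 20 19 ∷ b 60 48 24 14 20 29 ∷ []) tt

    design-96 : Covering es 96 96
    design-96 = fill 5 15 1 75 1 0 ((15 , 1) ∷ (3 , 1) ∷ (3 , 1) ∷ []) single design-21 (
      b 75 24 23 22 21 20 ∷ b 90 49 33 17 1 60 ∷ b 90 54 68 7 21 35 ∷ b 90 57 14 41 73 25 ∷
      b 4 79 60 72 24 36 ∷ b 81 28 17 1 43 69 ∷ b 49 44 40 52 74 93 ∷ b 48 37 83 58 6 67 ∷
      b 57 40 17 44 39 80 ∷ b 0 79 61 73 20 37 ∷ b 81 29 18 2 44 65 ∷ b 45 40 41 53 70 93 ∷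
      b 49 38 83 59 7 68 ∷ b 58 41 18 40 35 80 ∷ b 1 79 62 74 21 38 ∷ b 81 25 19 3 40 66 ∷
      b 46 41 42 54 71 93 ∷ b 45 39 83 55 8 69 ∷ b 59 42 19 41 36 80 ∷ b 2 79 63 70 22 39 ∷
      b 81 26 15 4 41 67 ∷ b 47 42 43 50 72 93 ∷ b 46 35 83 56 9 65 ∷ b 55 43 15 42 37 80 ∷
      b 3 79 64 71 23 35 ∷ b 81 27 16 0 42 68 ∷ b 48 43 44 51 73 93 ∷ b 47 36 83 57 5 66 ∷
      b 56 44 16 43 38 80 ∷ []) tt

    design-100 : Covering es 100 100
    design-100 = fill 1 75 1 3 25 0 ((25 , 1) ∷ []) design-25 design-25 (
      b 87 23 20 1 40 63 ∷ b 90 69 27 20 67 64 ∷ b 55 98 80 69 21 50 ∷ b 61 50 9 60 94 68 ∷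
      b 48 44 20 19 76 85 ∷ []) tt

    design-105 : Covering es 105 105
    design-105 = fill 2 40 2 4 20 10 ((10 , 1) ∷ (5 , 1) ∷ []) cover-30 design-25 (
      b 76 63 35 49 0 46 ∷ b 32 88 68 50 43 82 ∷ b 90 54 71 60 52 75 ∷ b 74 4 28 62 25 8 ∷
      b 49 2 78 82 77 36 ∷ b 91 25 48 79 20 11 ∷ b 69 35 89 33 78 39 ∷ b 5 84 43 27 23 78 ∷
      b 89 51 7 41 28 60 ∷ []) tt

    design-116 : Covering es 116 116
    design-116 = fill 5 15 1 75 1 0 ((15 , 1) ∷ (15 , 1) ∷ (5 , 1) ∷ (3 , 1) ∷ (3 , 1) ∷ []) single design-41 (
      b 75 22 24 21 23 20 ∷ b 110 12 29 41 58 70 ∷ b 110 4 48 17 61 30 ∷ b 110 54 38 22 6 65 ∷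
      b 81 5 37 60 27 58 ∷ b 61 33 50 42 78 114 ∷ b 107 26 58 40 34 56 ∷ b 30 26 4 103 95 53 ∷
      b 44 0 66 39 101 95 ∷ b 74 0 36 78 103 29 ∷ b 52 2 29 77 69 14 ∷ b 81 6 38 61 28 59 ∷
      b 62 34 51 43 78 114 ∷ b 108 27 59 41 30 57 ∷ b 31 27 0 91 98 54 ∷ b 40 1 67 35 104 98 ∷
      b 70 1 37 78 91 25 ∷ b 53 3 25 77 65 10 ∷ b 81 7 39 62 29 55 ∷ b 63 30 52 44 78 114 ∷
      b 109 28 55 42 31 58 ∷ b 32 28 1 94 101 50 ∷ b 41 2 68 36 92 101 ∷ b 71 2 38 78 94 26 ∷
      b 54 4 26 77 66 11 ∷ b 81 8 35 63 25 56 ∷ b 64 31 53 40 78 114 ∷ b 105 29 56 43 32 59 ∷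
      b 33 29 2 97 104 51 ∷ b 42 3 69 37 95 104 ∷ b 72 3 39 78 97 27 ∷ b 50 0 27 77 67 12 ∷
      b 81 9 36 64 26 57 ∷ b 60 32 54 41 78 114 ∷ b 106 25 57 44 33 55 ∷ b 34 25 3 100 92 52 ∷
      b 43 4 65 38 98 92 ∷ b 73 4 35 78 100 28 ∷ b 51 1 28 77 68 13 ∷ []) tt

    design-120 : Covering es 120 120
    design-120 = fill 1 99 1 99 1 0 ((9 , 1) ∷ (9 , 1) ∷ (3 , 1) ∷ []) single design-21 (
      b 68 82 84 103 93 44 ∷ b 45 27 38 83 92 1 ∷ b 68 1 89 94 104 91 ∷ b 38 91 95 50 102 46 ∷
      b 40 119 110 30 62 59 ∷ b 75 11 60 111 24 80 ∷ b 94 25 22 114 93 55 ∷ []) tt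

    -- 156, 160, 216, 220, 225, 236 and 240 are the orders with five or seven parts outside the hole
    -- for which the list of gadgets is longer than the number of differences.
    design-156 : Covering es 156 156
    design-156 = fill 1 111 1 111 1 0 ((3 , 1) ∷ (3 , 1) ∷ (3 , 1) ∷ (3 , 1) ∷ (3 , 1) ∷ (3 , 1) ∷ (3 , 1) ∷ (3 , 1) ∷ (3 , 1) ∷ (3 , 1) ∷ (3 , 1) ∷ (3 , 1) ∷ (3 , 1) ∷ (3 , 1) ∷ (3 , 1) ∷ []) single design-45 (
      b 5 90 100 131 155 49 ∷ b 108 138 122 28 62 31 ∷ b 38 134 85 48 1 147 ∷ b 84 91 117 115 16 107 ∷
      b 24 2 64 83 152 65 ∷ b 61 146 81 74 90 93 ∷ b 84 28 99 36 82 78 ∷ b 14 123 75 52 9 137 ∷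
      b 80 45 22 127 94 55 ∷ b 51 47 40 23 113 141 ∷ []) tt

    design-160 : Covering es 160 160
    design-160 = fill 1 160 1 4 40 0 [] design-40 empty (
      b 46 148 32 79 33 89 ∷ b 92 71 118 157 77 111 ∷ b 12 134 74 117 23 99 ∷ b 0 126 110 5 27 3 ∷
      b 116 94 139 19 85 49 ∷ b 153 116 106 87 35 28 ∷ []) tt

    design-216 : Covering es 216 216
    design-216 = fill 1 216 1 6 36 0 [] design-36 empty (
      b 6 141 149 205 163 111 ∷ b 28 79 113 147 39 128 ∷ b 65 152 132 118 19 128 ∷ b 21 41 65 208 180 13 ∷
      b 22 104 207 101 97 146 ∷ b 158 41 156 0 195 28 ∷ b 61 29 56 62 6 132 ∷ b 67 123 93 110 158 214 ∷
      b 63 199 79 152 172 54 ∷ []) tt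

    design-220 : Covering es 220 220
    design-220 = fill 1 180 1 3 60 0 ((20 , 1) ∷ (20 , 1) ∷ []) design-60 design-40 (
      b 106 165 164 5 183 206 ∷ b 139 5 120 153 187 20 ∷ b 115 90 12 196 179 86 ∷
      b 188 157 139 168 135 14 ∷ b 154 2 89 45 159 202 ∷ b 155 13 120 153 205 219 ∷
      b 44 54 171 142 172 187 ∷ b 162 86 145 79 200 95 ∷ b 201 138 65 94 172 150 ∷
      b 133 125 102 84 197 170 ∷ []) tt

    design-225 : Covering es 225 225
    design-225 = fill 1 225 1 5 45 0 [] design-45 empty (
      b 87 120 204 18 71 186 ∷ b 221 209 24 217 155 170 ∷ b 135 118 97 54 174 73 ∷ b 162 183 46 101 10 59 ∷
      b 12 96 75 144 118 86 ∷ b 35 162 67 159 156 76 ∷ b 138 206 4 94 27 101 ∷ b 107 54 136 20 40 138 ∷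
      b 216 217 69 18 145 157 ∷ []) tt

    design-236 : Covering es 236 236
    design-236 = fill 1 171 1 171 1 0 ((19 , 1) ∷ (19 , 1) ∷ (9 , 1) ∷ (9 , 1) ∷ (9 , 1) ∷ []) single design-65 (
      b 156 42 166 8 225 232 ∷ b 45 111 104 164 211 209 ∷ b 158 207 219 55 109 35 ∷
      b 116 167 85 162 156 235 ∷ b 176 95 11 94 140 120 ∷ b 39 23 174 97 14 18 ∷ b 78 71 11 231 208 28 ∷
      b 110 37 106 218 91 147 ∷ b 5 92 19 48 27 158 ∷ b 192 92 84 125 9 164 ∷ b 180 31 160 33 66 132 ∷
      b 194 46 66 43 135 129 ∷ b 39 66 184 197 10 120 ∷ b 120 42 133 158 186 217 ∷
      b 99 123 23 159 93 35 ∷ []) tt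

    design-240 : Covering es 240 240
    design-240 = fill 1 240 1 4 60 0 [] design-60 empty (
      b 104 109 235 179 50 141 ∷ b 13 147 226 236 224 99 ∷ b 142 76 79 61 193 40 ∷
      b 239 232 110 154 189 228 ∷ b 80 153 67 195 86 98 ∷ b 170 231 113 21 148 160 ∷ b 80 187 103 9 94 54 ∷
      b 32 239 119 174 238 29 ∷ b 37 136 147 90 78 172 ∷ []) tt

    κ : ℕ → ℕ → ℕ
    κ = circulant (2 ∷ 1 ∷ 3 ∷ 2 ∷ 2 ∷ 1 ∷ 1 ∷ 2 ∷ 1 ∷ 1 ∷ 1 ∷ 1 ∷ 1 ∷ 2 ∷ 1 ∷ 1 ∷ 2 ∷ 2 ∷ 3 ∷ 1 ∷ [])

    κ-steps : Steps κ
    κ-steps = steps κ tt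

    open Gadgets es κ

    gadget-0 : Gadget
    gadget-0 = gadget 0 (developed 20 ((20 , 1) ∷ (20 , 1) ∷ (20 , 1) ∷ (20 , 1) ∷ []) (
      b 20 1 52 48 63 15 ∷ b 20 6 55 46 64 76 ∷ [])) tt

    gadget-15 : Gadget
    gadget-15 = gadget 15 (developed 10 ((20 , 2) ∷ (20 , 2) ∷ (20 , 2) ∷ (20 , 2) ∷ (10 , 1) ∷ (5 , 1) ∷ []) (
      b 94 14 8 29 41 66 ∷ b 92 61 9 3 38 56 ∷ b 80 73 64 41 43 20 ∷ b 34 43 45 71 83 9 ∷
      b 50 10 60 22 24 84 ∷ b 37 85 18 48 60 86 ∷ b 49 9 5 23 24 87 ∷ [])) tt

    gadget-20 : Gadget
    gadget-20 = gadget 20 (developed 20 ((20 , 1) ∷ (20 , 1) ∷ (20 , 1) ∷ (20 , 1) ∷ (20 , 1) ∷ []) (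
      b 27 1 71 63 41 95 ∷ b 13 92 40 56 71 83 ∷ b 95 18 42 30 37 9 ∷ b 48 77 33 20 88 82 ∷ [])) tt

    open Families es κ κ-steps gadget-0 refl

    module Inner₁ = Inner {1} inner-21 (≤ᵇ⇒≤ _ _ tt)
    module Inner₁₀ = Inner {10} cover-30 (≤ᵇ⇒≤ _ _ tt)

    cover-1 : ∀ t → Covering es (1 + t * 20) (1 + t * 20)
    cover-1 0 = single
    cover-1 1 = design-21
    cover-1 2 = design-41
    cover-1 3 = design-61
    cover-1 4 = design-81
    cover-1 (suc (suc (suc (suc (suc t))))) = six (λ t → Covering es (1 + (5 + t) * 20) (1 + (5 + t) * 20))
      (λ w → Inner₁.family₅ 1 0 [] refl single w (z≤n))
      (λ w → Inner₁.family₅ 1 1 (gadget-20 ∷ []) refl design-21 w (s≤s z≤n))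
      (λ w → Inner₁.family₇ 1 0 [] refl single w (z≤n))
      (λ w → Inner₁.family₇ 1 1 (gadget-20 ∷ []) refl design-21 w (s≤s z≤n))
      (λ w → Inner₁.family₇ 1 2 (gadget-20 ∷ gadget-20 ∷ []) refl design-41 w (s≤s (s≤s z≤n)))
      (λ w → Inner₁.family₇ 1 3 (gadget-20 ∷ gadget-20 ∷ gadget-20 ∷ []) refl design-61 w (s≤s (s≤s (s≤s z≤n))))
      t

    -- The hole contains the ten shared points and cannot have order 20, so its order is at least 40
    -- and two or more parts are merged. The gadgets supply all its points but ten.
    cover-0 : ∀ t → Covering es (0 + suc (suc t) * 20) (0 + suc (suc t) * 20)
    cover-0 0 = design-40
    cover-0 1 = design-60
    cover-0 2 = design-80
    cover-0 3 = design-100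
    cover-0 4 = design-120
    cover-0 (suc (suc (suc (suc (suc t))))) = six (λ t → Covering es (0 + (7 + t) * 20) (0 + (7 + t) * 20))
      (λ w → Inner₁₀.family₅ 0 2 (gadget-15 ∷ gadget-15 ∷ []) refl design-40 w (s≤s (s≤s z≤n)))
      (λ { zero → design-160 ; (suc w) → Inner₁₀.family₅ 0 3 (gadget-15 ∷ gadget-15 ∷ gadget-20 ∷ []) refl design-60 (suc w) (s≤s (s≤s (s≤s z≤n))) })
      (λ w → Inner₁₀.family₇ 0 2 (gadget-15 ∷ gadget-15 ∷ []) refl design-40 w (s≤s (s≤s z≤n)))
      (λ w → Inner₁₀.family₇ 0 3 (gadget-15 ∷ gadget-15 ∷ gadget-20 ∷ []) refl design-60 w (s≤s (s≤s (s≤s z≤n))))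
      (λ { zero → design-220 ; (suc w) → Inner₁₀.family₇ 0 4 (gadget-15 ∷ gadget-15 ∷ gadget-20 ∷ gadget-20 ∷ []) refl design-80 (suc w) (s≤s (s≤s (s≤s (s≤s z≤n)))) })
      (λ { zero → design-240 ; (suc w) → Inner₁₀.family₇ 0 5 (gadget-15 ∷ gadget-15 ∷ gadget-20 ∷ gadget-20 ∷ gadget-20 ∷ []) refl design-100 (suc w) (s≤s (s≤s (s≤s (s≤s (s≤s z≤n))))) })
      t

    -- With ten shared points, the holes of order 25, 45, 65 and 85 leave 15, 35, 55 and 75 points
    -- to the gadgets.
    cover-5 : ∀ t → Covering es (5 + suc t * 20) (5 + suc t * 20)
    cover-5 0 = design-25
    cover-5 1 = design-45
    cover-5 2 = design-65
    cover-5 3 = design-85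
    cover-5 4 = design-105
    cover-5 (suc (suc (suc (suc (suc t))))) = six (λ t → Covering es (5 + (6 + t) * 20) (5 + (6 + t) * 20))
      (λ w → Inner₁₀.family₅ 5 1 (gadget-15 ∷ []) refl design-25 w (s≤s z≤n))
      (λ w → Inner₁₀.family₅ 5 2 (gadget-15 ∷ gadget-20 ∷ []) refl design-45 w (s≤s (s≤s z≤n)))
      (λ w → Inner₁₀.family₇ 5 1 (gadget-15 ∷ []) refl design-25 w (s≤s z≤n))
      (λ w → Inner₁₀.family₇ 5 2 (gadget-15 ∷ gadget-20 ∷ []) refl design-45 w (s≤s (s≤s z≤n)))
      (λ w → Inner₁₀.family₇ 5 3 (gadget-15 ∷ gadget-20 ∷ gadget-20 ∷ []) refl design-65 w (s≤s (s≤s (s≤s z≤n))))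
      (λ { zero → design-225 ; (suc w) → Inner₁₀.family₇ 5 4 (gadget-15 ∷ gadget-20 ∷ gadget-20 ∷ gadget-20 ∷ []) refl design-85 (suc w) (s≤s (s≤s (s≤s (s≤s z≤n)))) })
      t

    cover-16 : ∀ t → Covering es (16 + suc t * 20) (16 + suc t * 20)
    cover-16 0 = design-36
    cover-16 1 = design-56
    cover-16 2 = design-76
    cover-16 3 = design-96
    cover-16 4 = design-116
    cover-16 (suc (suc (suc (suc (suc t))))) = six (λ t → Covering es (16 + (6 + t) * 20) (16 + (6 + t) * 20))
      (λ w → Inner₁.family₅ 16 1 (gadget-15 ∷ gadget-20 ∷ []) refl design-36 w (s≤s (s≤s z≤n)))
      (λ { zero → design-156 ; (suc w) → Inner₁.family₅ 16 2 (gadget-15 ∷ gadget-20 ∷ gadget-20 ∷ []) refl design-56 (suc w) (s≤s (s≤s (s≤s z≤n))) })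
      (λ w → Inner₁.family₇ 16 1 (gadget-15 ∷ gadget-20 ∷ []) refl design-36 w (s≤s (s≤s z≤n)))
      (λ w → Inner₁.family₇ 16 2 (gadget-15 ∷ gadget-20 ∷ gadget-20 ∷ []) refl design-56 w (s≤s (s≤s (s≤s z≤n))))
      (λ { zero → design-216 ; (suc w) → Inner₁.family₇ 16 3 (gadget-15 ∷ gadget-20 ∷ gadget-20 ∷ gadget-20 ∷ []) refl design-76 (suc w) (s≤s (s≤s (s≤s (s≤s z≤n)))) })
      (λ { zero → design-236 ; (suc w) → Inner₁.family₇ 16 4 (gadget-15 ∷ gadget-20 ∷ gadget-20 ∷ gadget-20 ∷ gadget-20 ∷ []) refl design-96 (suc w) (s≤s (s≤s (s≤s (s≤s (s≤s z≤n))))) })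
      t

    cover : ∀ n → Admissible (n % 20) → n ≢ 5 → n ≢ 16 → n ≢ 20 → Covering es n n
    cover = by-residue (λ n → n ≢ 5 → n ≢ 16 → n ≢ 20 → Covering es n n)
      (λ { zero _ _ _ → empty ; (suc zero) _ _ n≢20 → contradiction refl n≢20 ; (suc (suc t)) _ _ _ → cover-0 t })
      (λ t _ _ _ → cover-1 t)
      (λ { zero n≢5 _ _ → contradiction refl n≢5 ; (suc t) _ _ _ → cover-5 t })
      (λ { zero _ n≢16 _ → contradiction refl n≢16 ; (suc t) _ _ _ → cover-16 t })

-- The spectra of the five graphs

open Necessity
open Coverings
open Constructions
open import Data.Nat using (ℕ; _%_; s≤s; z≤n)
open import Data.Fin using (Fin)
open import Data.List using ([]; _∷_)
open import Data.List.Membership.Propositional using (_∈_)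
open import Data.List.Relation.Unary.Any using (here; there)
open import Data.Product using (_×_; _,_)
open import Data.Sum using (_⊎_)
open import Function.Bundles using (_⇔_; mk⇔)
open import Relation.Binary.PropositionalEquality using (_≡_; _≢_; refl)

necessary₃ : ∀ {n} → Design n₃ n → Admissible (n % 20) × n ≢ 5
necessary₃ D = TenEdges.residue n₃ adj₃? D refl , TenEdges.n≢5 n₃ adj₃? D refl

sufficient₃ : ∀ {n} → n ≢ 16 → Admissible (n % 20) × n ≢ 5 → Design n₃ n
sufficient₃ {n} n≢16 (r , n≢5) = Covering⇒Design Coverings₃.es n (s≤s z≤n) (Coverings₃.cover n r n≢5 n≢16)

necessary₆ : ∀ {n} → Design n₆ n → Admissible (n % 20) × n ≢ 5
necessary₆ D = TenEdges.residue n₆ adj₆? D refl , TenEdges.n≢5 n₆ adj₆? D refl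

sufficient₆ : ∀ {n} → n ≢ 16 → Admissible (n % 20) × n ≢ 5 → Design n₆ n
sufficient₆ {n} n≢16 (r , n≢5) = Covering⇒Design Coverings₆.es n (s≤s z≤n) (Coverings₆.cover n r n≢5 n≢16)

necessary₁₀ : ∀ {n} → Design n₁₀ n → Admissible (n % 20) × n ≢ 5
necessary₁₀ D = TenEdges.residue n₁₀ adj₁₀? D refl , TenEdges.n≢5 n₁₀ adj₁₀? D refl

sufficient₁₀ : ∀ {n} → n ≢ 16 → Admissible (n % 20) × n ≢ 5 → Design n₁₀ n
sufficient₁₀ {n} n≢16 (r , n≢5) = Covering⇒Design Coverings₁₀.es n (s≤s z≤n) (Coverings₁₀.cover n r n≢5 n≢16)

necessary₈ : ∀ {n} → Design n₈ n → Admissible (n % 20) × n ≢ 5 × n ≢ 16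
necessary₈ D = Octahedral.n₈-residue D , Octahedral.n₈≢5 D , Octahedral.n₈≢16 D

sufficient₈ : ∀ {n} → Admissible (n % 20) × n ≢ 5 × n ≢ 16 → Design n₈ n
sufficient₈ {n} (r , n≢5 , n≢16) = Covering⇒Design Coverings₈.es n (s≤s z≤n) (Coverings₈.cover n r n≢5 n≢16)

necessary₁₃ : ∀ {n} → Design n₁₃ n → Admissible (n % 20) × n ≢ 5 × n ≢ 16 × n ≢ 20
necessary₁₃ D = Wheel.n₁₃-residue D , Wheel.n₁₃≢5 D , Wheel.n₁₃≢16 D , Wheel.n₁₃≢20 D

sufficient₁₃ : ∀ {n} → Admissible (n % 20) × n ≢ 5 × n ≢ 16 × n ≢ 20 → Design n₁₃ n
sufficient₁₃ {n} (r , n≢5 , n≢16 , n≢20) = Covering⇒Design Coverings₁₃.es n (s≤s z≤n) (Coverings₁₃.cover n r n≢5 n≢16 n≢20)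

part-i : ∀ n G → G ∈ (n₃ ∷ n₆ ∷ n₁₀ ∷ []) → n ≢ 16 → Design G n ⇔ (Admissible (n % 20) × n ≢ 5)
part-i n _ (here refl) n≢16 = mk⇔ necessary₃ (sufficient₃ n≢16)
part-i n _ (there (here refl)) n≢16 = mk⇔ necessary₆ (sufficient₆ n≢16)
part-i n _ (there (there (here refl))) n≢16 = mk⇔ necessary₁₀ (sufficient₁₀ n≢16)

theorem1p1 : (n : ℕ) →
    ((G : Graph (Fin 6)) → G ∈ (n₃ ∷ n₆ ∷ n₁₀ ∷ []) → n ≢ 16 →
    (Design G n ⇔ ((n % 20 ≡ 0 ⊎ n % 20 ≡ 1 ⊎ n % 20 ≡ 5 ⊎ n % 20 ≡ 16) × n ≢ 5)))
    × (Design n₈ n ⇔ ((n % 20 ≡ 0 ⊎ n % 20 ≡ 1 ⊎ n % 20 ≡ 5 ⊎ n % 20 ≡ 16) × n ≢ 5 × n ≢ 16))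
    × (Design n₁₃ n ⇔ ((n % 20 ≡ 0 ⊎ n % 20 ≡ 1 ⊎ n % 20 ≡ 5 ⊎ n % 20 ≡ 16) × n ≢ 5 × n ≢ 16 × n ≢ 20))
theorem1p1 n = part-i n , mk⇔ necessary₈ sufficient₈ , mk⇔ necessary₁₃ sufficient₁₃
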